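{- The following twenty mesh patterns $(12,R)$ are pairwise equidistributed, where $R$ ranges over: $\{(0,2),(1,2),(2,2),(1,1),(2,1),(0,0)\}$, $\{(0,2),(2,2),(0,1),(1,1),(0,0),(1,0)\}$, $\{(1,2),(2,2),(1,1),(2,1),(0,0),(2,0)\}$, $\{(2,2),(0,1),(1,1),(0,0),(1,0),(2,0)\}$, $\{(0,2),(1,2),(2,2),(0,1),(2,1),(1,0)\}$, $\{(0,2),(1,2),(0,1),(2,1),(0,0),(1,0)\}$, $\{(1,2),(2,2),(0,1),(2,1),(1,0),(2,0)\}$, $\{(1,2),(0,1),(2,1),(0,0),(1,0),(2,0)\}$, $\{(0,2),(1,2),(0,1),(1,1),(2,1),(2,0)\}$, $\{(0,2),(1,2),(0,1),(1,1),(1,0),(2,0)\}$, $\{(0,2),(1,2),(1,1),(2,1),(1,0),(2,0)\}$, $\{(0,2),(0,1),(1,1),(2,1),(1,0),(2,0)\}$, $\{(0,2),(1,2),(2,2),(1,1),(0,0),(2,0)\}$, $\{(0,2),(2,2),(0,1),(1,1),(0,0),(2,0)\}$, $\{(0,2),(2,2),(1,1),(2,1),(0,0),(2,0)\}$, $\{(0,2),(2,2),(1,1),(0,0),(1,0),(2,0)\}$, $\{(0,2),(1,2),(0,1),(2,1),(0,0),(2,0)\}$, $\{(0,2),(1,2),(2,2),(0,1),(1,0),(2,0)\}$, $\{(0,2),(2,2),(0,1),(2,1),(1,0),(2,0)\}$, $\{(0,2),(1,2),(2,1),(0,0),(1,0),(2,0)\}$. Moreover, for each such pattern $p$, with $F(x)=\sum_{n\ge0}n!x^n$,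 $A(x)=\sum_{n\ge0}s_{n,0}(p)x^n$ and $F(x,q)=\sum_{n\ge0}x^n\sum_{\pi\in S_n}q^{p(\pi)}$, $$A(x)=\frac{(1+x)F(x)}{1+xF(x)},\qquad F(x,q)=\frac{(1+x(1-q))F(x)}{1+x(1-q)F(x)}.$$
   Context: For $R\subseteq\{0,1,2\}^2$ and $\pi=\pi_1\cdots\pi_n\in S_n$, an occurrence of the mesh pattern $(12,R)$ in $\pi$ is a pair of positions $i_1<i_2$ with $\pi_{i_1}<\pi_{i_2}$ such that, setting $x_0=0,x_1=i_1,x_2=i_2,x_3=n+1$ and $y_0=0,y_1=\pi_{i_1},y_2=\pi_{i_2},y_3=n+1$, for every $(a,b)\in R$ there is no index $k$ with $x_a<k<x_{a+1}$ and $y_b<\pi_k<y_{b+1}$. $p(\pi)$ is the number of occurrences of $p$ in $\pi$; $s_{n,k}(p)$ the number of $\pi\in S_n$ with $p(\pi)=k$; $p_1,p_2$ are equidistributed if $s_{n,k}(p_1)=s_{n,k}(p_2)$ for all $n,k\ge 0$. Generating functions are formal power series. -}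

module Defs where

open import Data.Bool using (Bool; true; false; _∧_; _∨_; not; if_then_else_)
open import Data.Nat using (ℕ; zero; suc; _∸_; _<ᵇ_; _≡ᵇ_)
open import Data.Nat using (_!)
open import Data.Bool.ListAction using (all; any)
open import Data.Fin using (Fin; toℕ)
open import Data.Vec using (Vec; []; _∷_; lookup)
open import Data.List using (List; []; _∷_; [_]; map; concatMap; filterᵇ; length; allFin; upTo; foldr)
open import Data.Product using (_×_; _,_)
open import Data.Integer using (ℤ; +_; -[1+_])
import Data.Integer as ℤ
open import Relation.Binary.PropositionalEquality using (_≡_)

-- Permutations of [n] = {1,…,n}.
-- A word π₁⋯πₙ is a vector of length n with entries in Fin n;
-- the value πᵢ is 1 + toℕ (lookup π (i-1)).

allWords : (m n : ℕ) → List (Vec (Fin m) n)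
allWords m zero    = [ [] ]
allWords m (suc n) = concatMap (λ v → map (λ a → a ∷ v) (allFin m)) (allWords m n)

injectiveᵇ : ∀ {n} → Vec (Fin n) n → Bool
injectiveᵇ {n} π =
  all (λ i → all (λ j → (toℕ i ≡ᵇ toℕ j) ∨ not (toℕ (lookup π i) ≡ᵇ toℕ (lookup π j)))
                 (allFin n))
      (allFin n)

Perms : (n : ℕ) → List (Vec (Fin n) n)
Perms n = filterᵇ injectiveᵇ (allWords n n)

pos : ∀ {n} → Fin n → ℕ
pos i = suc (toℕ i)

val : ∀ {n} → Vec (Fin n) n → Fin n → ℕ
val π i = suc (toℕ (lookup π i))

-- Mesh patterns (12, R), R ⊆ {0,1,2}², given as a list of pairs (a , b).

MeshR : Set
MeshR = List (ℕ × ℕ)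

gridLine : ℕ → ℕ → ℕ → ℕ → ℕ
gridLine u₁ u₂ n zero                   = 0
gridLine u₁ u₂ n (suc zero)             = u₁
gridLine u₁ u₂ n (suc (suc zero))       = u₂
gridLine u₁ u₂ n (suc (suc (suc _)))    = suc n

strictlyBetween : ℕ → ℕ → ℕ → Bool
strictlyBetween lo x hi = (lo <ᵇ x) ∧ (x <ᵇ hi)

isOccᵇ : ∀ {n} → MeshR → Vec (Fin n) n → Fin n → Fin n → Bool
isOccᵇ {n} R π i₁ i₂ =
  (pos i₁ <ᵇ pos i₂) ∧ (val π i₁ <ᵇ val π i₂) ∧
  all (λ { (a , b) →
        not (any (λ k →
               strictlyBetween (gridLine (pos i₁) (pos i₂) n a) (pos k)
                               (gridLine (pos i₁) (pos i₂) n (suc a))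
             ∧ strictlyBetween (gridLine (val π i₁) (val π i₂) n b) (val π k)
                               (gridLine (val π i₁) (val π i₂) n (suc b)))
             (allFin n)) })
      R

occ : ∀ {n} → MeshR → Vec (Fin n) n → ℕ
occ {n} R π = length (concatMap (λ i₁ → filterᵇ (λ i₂ → isOccᵇ R π i₁ i₂) (allFin n)) (allFin n))

s : MeshR → ℕ → ℕ → ℕ
s R n k = length (filterᵇ (λ π → occ R π ≡ᵇ k) (Perms n))

Equidistributed : MeshR → MeshR → Set
Equidistributed R₁ R₂ = ∀ n k → s R₁ n k ≡ s R₂ n k

-- Formal power series with integer coefficients.
-- Univariate: ℕ → ℤ (coefficient of xⁿ);
-- bivariate in x, q: ℕ → ℕ → ℤ (coefficient of xⁿ qᵏ).

Ser : Set
Ser = ℕ → ℤ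

Ser₂ : Set
Ser₂ = ℕ → ℕ → ℤ

sumℤ : List ℤ → ℤ
sumℤ = foldr ℤ._+_ (+ 0)

_⊛_ : Ser → Ser → Ser
(f ⊛ g) n = sumℤ (map (λ i → f i ℤ.* g (n ∸ i)) (upTo (suc n)))

_⊛₂_ : Ser₂ → Ser₂ → Ser₂
(f ⊛₂ g) n k =
  sumℤ (map (λ i → sumℤ (map (λ j → f i j ℤ.* g (n ∸ i) (k ∸ j)) (upTo (suc k))))
            (upTo (suc n)))

Fact : Ser
Fact n = + (n !)

onePlusX : Ser
onePlusX zero          = + 1
onePlusX (suc zero)    = + 1
onePlusX (suc (suc _)) = + 0

X : Ser
X (suc zero) = + 1
X _          = + 0

oneSer : Ser
oneSer zero    = + 1
oneSer (suc _) = + 0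

_⊕_ : Ser → Ser → Ser
(f ⊕ g) n = f n ℤ.+ g n

Agf : MeshR → Ser
Agf R n = + s R n 0

Fact₂ : Ser₂
Fact₂ n zero    = + (n !)
Fact₂ n (suc _) = + 0

onePlusX1q : Ser₂
onePlusX1q zero zero                 = + 1
onePlusX1q (suc zero) zero           = + 1
onePlusX1q (suc zero) (suc zero)     = -[1+ 0 ]
onePlusX1q _ _                       = + 0

X1q : Ser₂
X1q (suc zero) zero       = + 1
X1q (suc zero) (suc zero) = -[1+ 0 ]
X1q _ _                   = + 0

one₂ : Ser₂
one₂ zero zero = + 1
one₂ _ _       = + 0

_⊕₂_ : Ser₂ → Ser₂ → Ser₂
(f ⊕₂ g) n k = f n k ℤ.+ g n k

-- F(x,q) = Σₙ xⁿ Σ_{π∈Sₙ} q^{p(π)} ; coefficient of xⁿ qᵏ is s_{n,k}(p)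
Fq : MeshR → Ser₂
Fq R n k = + s R n k

-- A = (1+x)F / (1+xF), stated as A·(1+xF) = (1+x)F (1+xF is invertible)
AFormula : MeshR → Set
AFormula R = ∀ n → (Agf R ⊛ (oneSer ⊕ (X ⊛ Fact))) n ≡ (onePlusX ⊛ Fact) n

-- F(x,q) = (1+x(1-q))F / (1+x(1-q)F), stated multiplied out
FqFormula : MeshR → Set
FqFormula R = ∀ n k → (Fq R ⊛₂ (one₂ ⊕₂ (X1q ⊛₂ Fact₂))) n k ≡ (onePlusX1q ⊛₂ Fact₂) n k

patterns : List MeshR
patterns =
    ((0 , 2) ∷ (1 , 2) ∷ (2 , 2) ∷ (1 , 1) ∷ (2 , 1) ∷ (0 , 0) ∷ [])
  ∷ ((0 , 2) ∷ (2 , 2) ∷ (0 , 1) ∷ (1 , 1) ∷ (0 , 0) ∷ (1 , 0) ∷ [])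
  ∷ ((1 , 2) ∷ (2 , 2) ∷ (1 , 1) ∷ (2 , 1) ∷ (0 , 0) ∷ (2 , 0) ∷ [])
  ∷ ((2 , 2) ∷ (0 , 1) ∷ (1 , 1) ∷ (0 , 0) ∷ (1 , 0) ∷ (2 , 0) ∷ [])
  ∷ ((0 , 2) ∷ (1 , 2) ∷ (2 , 2) ∷ (0 , 1) ∷ (2 , 1) ∷ (1 , 0) ∷ [])
  ∷ ((0 , 2) ∷ (1 , 2) ∷ (0 , 1) ∷ (2 , 1) ∷ (0 , 0) ∷ (1 , 0) ∷ [])
  ∷ ((1 , 2) ∷ (2 , 2) ∷ (0 , 1) ∷ (2 , 1) ∷ (1 , 0) ∷ (2 , 0) ∷ [])
  ∷ ((1 , 2) ∷ (0 , 1) ∷ (2 , 1) ∷ (0 , 0) ∷ (1 , 0) ∷ (2 , 0) ∷ [])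
  ∷ ((0 , 2) ∷ (1 , 2) ∷ (0 , 1) ∷ (1 , 1) ∷ (2 , 1) ∷ (2 , 0) ∷ [])
  ∷ ((0 , 2) ∷ (1 , 2) ∷ (0 , 1) ∷ (1 , 1) ∷ (1 , 0) ∷ (2 , 0) ∷ [])
  ∷ ((0 , 2) ∷ (1 , 2) ∷ (1 , 1) ∷ (2 , 1) ∷ (1 , 0) ∷ (2 , 0) ∷ [])
  ∷ ((0 , 2) ∷ (0 , 1) ∷ (1 , 1) ∷ (2 , 1) ∷ (1 , 0) ∷ (2 , 0) ∷ [])
  ∷ ((0 , 2) ∷ (1 , 2) ∷ (2 , 2) ∷ (1 , 1) ∷ (0 , 0) ∷ (2 , 0) ∷ [])
  ∷ ((0 , 2) ∷ (2 , 2) ∷ (0 , 1) ∷ (1 , 1) ∷ (0 , 0) ∷ (2 , 0) ∷ [])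
  ∷ ((0 , 2) ∷ (2 , 2) ∷ (1 , 1) ∷ (2 , 1) ∷ (0 , 0) ∷ (2 , 0) ∷ [])
  ∷ ((0 , 2) ∷ (2 , 2) ∷ (1 , 1) ∷ (0 , 0) ∷ (1 , 0) ∷ (2 , 0) ∷ [])
  ∷ ((0 , 2) ∷ (1 , 2) ∷ (0 , 1) ∷ (2 , 1) ∷ (0 , 0) ∷ (2 , 0) ∷ [])
  ∷ ((0 , 2) ∷ (1 , 2) ∷ (2 , 2) ∷ (0 , 1) ∷ (1 , 0) ∷ (2 , 0) ∷ [])
  ∷ ((0 , 2) ∷ (2 , 2) ∷ (0 , 1) ∷ (2 , 1) ∷ (1 , 0) ∷ (2 , 0) ∷ [])
  ∷ ((0 , 2) ∷ (1 , 2) ∷ (2 , 1) ∷ (0 , 0) ∷ (1 , 0) ∷ (2 , 0) ∷ [])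
  ∷ []

{-# OPTIONS --safe #-}
module Submission where

-- All twenty shadings leave three boxes free. Up to reverse-complement, in an occurrence (a , b) the point
-- b is the maximum or the last letter of the permutation (in the remaining cases it may be replaced by
-- such a point without changing the number of occurrences); one free box together with a fills a block of
-- consecutive positions and values, and the rest σ of the permutation, b included, avoids that box. The
-- occurrences are nested: deleting the block of the occurrence of rank k leaves a nonempty permutation σ
-- whose occurrences are exactly the k earlier ones, and the block is a together with an arbitrary
-- permutation ρ. Hence
--   #{π ∈ Sₙ : p(π) > k} = Σ_{j=1}^{n-1} s_{j,k}(p) (n-1-j)!,
-- a recurrence that determines s_{n,k}(p) and is the coefficientwise form of both functional equations.

open import Defs
open import Algebra.Properties.CommutativeSemigroup using (interchange)
open import Data.Bool using (Bool; true; false; _∧_; _∨_; _xor_; not; T; if_then_else_)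
open import Data.Bool.ListAction using (all; any; and; or)
open import Data.Bool.Properties using (T-∧; T-∨; T-not-≡; T?)
open import Data.Empty using (⊥-elim)
open import Data.Fin as Fin using (Fin; toℕ; fromℕ<)
open import Data.Fin.Properties as Finₚ using (toℕ-injective; toℕ<n; toℕ-fromℕ<)
open import Data.Integer using (ℤ) renaming (+_ to infix 8 ι_)
import Data.Integer as ℤ
import Data.Integer.Properties as ℤₚ
open import Data.Integer.Tactic.RingSolver using (solve-∀)
open import Data.List hiding (sum; all; any; lookup; and; or; find)
open import Data.List.Membership.Propositional using (_∈_; _∉_; find; lose)
open import Data.List.Membership.Propositional.Properties
open import Data.List.Properties
open import Data.List.Relation.Binary.Permutation.Propositional using (_↭_; ↭-sym; ↭⇒↭ₛ)
open import Data.List.Relation.Binary.Permutation.Propositional.Properties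
  using (All-resp-↭; ↭-length; ↭-reverse; shift; shifts)
open import Data.List.Relation.Unary.All as All using (All; []; _∷_)
import Data.List.Relation.Unary.All.Properties as Allₚ
open import Data.List.Relation.Unary.AllPairs using ([]; _∷_)
open import Data.List.Relation.Unary.Any as Any using (here; there)
open import Data.List.Relation.Unary.Unique.Propositional using (Unique)
import Data.List.Relation.Unary.Unique.Propositional.Properties as Uniqueₚ
open import Data.Nat
open import Data.Nat.Induction using (<-rec)
open import Data.Nat.ListAction using (sum)
open import Data.Nat.Properties
open import Data.Product using (∃; ∃₂; _×_; _,_; proj₁; proj₂)
open import Data.Sum using (_⊎_; inj₁; inj₂)
open import Data.Vec using (Vec; []; _∷_; lookup)
import Data.Vec.Properties as Vecₚ
open import Function using (_∘_; id; Equivalence)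
open import Relation.Binary.Definitions using (tri<; tri≈; tri>)
open import Relation.Binary.PropositionalEquality
open import Relation.Nullary using (¬_; yes; no; contradiction)
import Data.List.Relation.Binary.Permutation.Setoid.Properties (setoid ℕ) as ↭ₛ

-- One permutation π arises from several pairs (σ , ρ), one for each of its occurrences, so the
-- pairs count permutations only after an occurrence has been singled out. Since `b` is fixed by the
-- permutation, an occurrence is given by its lower point `a`, and occurrences can be ranked by the
-- position of `a`. The block always lands inside the free box of every occurrence of σ. It
-- therefore destroys none of them, and the new `a` receives as its rank the number of occurrences
-- of σ, whatever ρ is; this is where the factorial comes from. Having an occurrence of rank k means
-- having more than k occurrences, which is why the left side counts p(π) > k rather than p(π) = k.
-- Let E(x,q) be the sum of xⁿ qᵏ #{π ∈ Sₙ : p(π) > k}. The count says E = x (F(x,q) - 1) F(x), with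
-- 1 subtracted because σ is nonempty, and summation by parts gives (1 - q) E + F(x,q) = F(x).
-- Eliminating E yields the formula for F(x,q), and q = 0 yields the one for A(x).

private variable
  A B : Set

-- Comparing finite counts through relations

remove-middle : ∀ {x y : A} ys {zs} → x ∈ ys ++ y ∷ zs → x ≢ y → x ∈ ys ++ zs
remove-middle ys x∈ x≢y with ∈-++⁻ ys x∈
... | inj₁ p           = ∈-++⁺ˡ p
... | inj₂ (here x≡y)  = contradiction x≡y x≢y
... | inj₂ (there p)   = ∈-++⁺ʳ ys p

-- A partner of the first `x` is removed from `ys`; injectivity guarantees that the partners of the
-- other elements survive. `R` need not be a function, so one relation, used in both directions,
-- gives an equality of counts without inverse maps.
length-≤-by : (R : A → B → Set) {xs : List A} {ys : List B} → Unique xs →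
  (∀ {x} → x ∈ xs → ∃ λ y → y ∈ ys × R x y) →
  (∀ {x x′ y} → x ∈ xs → x′ ∈ xs → R x y → R x′ y → x ≡ x′) →
  length xs ≤ length ys
length-≤-by R {[]} _ _ _ = z≤n
length-≤-by R {x ∷ xs} (x∉xs ∷ u) total inj with total (here refl)
... | y , y∈ys , Rxy with ∈-∃++ y∈ys
... | ps , qs , refl = begin
  suc (length xs)          ≤⟨ s≤s (length-≤-by R u total′ (λ p q → inj (there p) (there q))) ⟩
  suc (length (ps ++ qs))  ≡⟨ length-++-sucʳ ps y qs ⟨
  length (ps ++ y ∷ qs)    ∎
  where
  open ≤-Reasoning
  total′ : ∀ {x′} → x′ ∈ xs → ∃ λ y′ → y′ ∈ ps ++ qs × R x′ y′
  total′ x′∈ with total (there x′∈)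
  ... | y′ , y′∈ , Rx′y′ = y′ , remove-middle ps y′∈ y′≢y , Rx′y′
    where
    y′≢y : y′ ≢ y
    y′≢y refl = All.lookup x∉xs x′∈ (inj (here refl) (there x′∈) Rxy Rx′y′)

-- Boolean filters, and permutations as words of natural numbers

T⇒≡ : ∀ {b} → T b → b ≡ true
T⇒≡ {true} _ = refl

∈-filterᵇ⁻ : (p : A → Bool) {x : A} (xs : List A) → x ∈ filterᵇ p xs → x ∈ xs × T (p x)
∈-filterᵇ⁻ p xs = ∈-filter⁻ (T? ∘ p) {xs = xs}

∈-filterᵇ⁺ : (p : A → Bool) {x : A} {xs : List A} → x ∈ xs → T (p x) → x ∈ filterᵇ p xs
∈-filterᵇ⁺ p = ∈-filter⁺ (T? ∘ p)

Unique-filterᵇ : (p : A → Bool) {xs : List A} → Unique xs → Unique (filterᵇ p xs)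
Unique-filterᵇ p = Uniqueₚ.filter⁺ (T? ∘ p)

filterᵇ-cong : {p q : A → Bool} (xs : List A) → (∀ {x} → x ∈ xs → p x ≡ q x) →
  filterᵇ p xs ≡ filterᵇ q xs
filterᵇ-cong [] _ = refl
filterᵇ-cong {p = p} {q} (x ∷ xs) eq with p x | q x | eq (here refl)
... | true  | _ | refl = cong (x ∷_) (filterᵇ-cong xs (eq ∘ there))
... | false | _ | refl = filterᵇ-cong xs (eq ∘ there)

-- Plain lists of numbers from 0 to `n - 1`, so that letters can be deleted and inserted without a
-- change of type. That every value occurs is derived by counting in `perm-surjective`.
record IsPerm (n : ℕ) (w : List ℕ) : Set where
  constructor isPerm
  field
    len      : length w ≡ n
    bounded  : All (_< n) w
    distinct : Unique w
open IsPerm public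

word : ∀ {m n} → Vec (Fin m) n → List ℕ
word []      = []
word (a ∷ v) = toℕ a ∷ word v

words : ℕ → List (List ℕ)
words n = map word (Perms n)

word-injective : ∀ {m n} {u v : Vec (Fin m) n} → word u ≡ word v → u ≡ v
word-injective {u = []}    {[]}    _  = refl
word-injective {u = a ∷ u} {b ∷ v} eq =
  cong₂ _∷_ (toℕ-injective (∷-injectiveˡ eq)) (word-injective (∷-injectiveʳ eq))

word-length : ∀ {m n} (v : Vec (Fin m) n) → length (word v) ≡ n
word-length []      = refl
word-length (_ ∷ v) = cong suc (word-length v)

word-bounded : ∀ {m n} (v : Vec (Fin m) n) → All (_< m) (word v)
word-bounded []      = []
word-bounded (a ∷ v) = toℕ<n a ∷ word-bounded v

word-surjective : ∀ {m n} (w : List ℕ) → length w ≡ n → All (_< m) w → ∃ λ (v : Vec (Fin m) n) → word v ≡ w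
word-surjective [] refl [] = [] , refl
word-surjective (x ∷ w) refl (x<m ∷ bd) with word-surjective w refl bd
... | v , eq = fromℕ< x<m ∷ v , cong₂ _∷_ (toℕ-fromℕ< x<m) eq

∈-word⁻ : ∀ {m n x} (v : Vec (Fin m) n) → x ∈ word v → ∃ λ i → toℕ (lookup v i) ≡ x
∈-word⁻ (a ∷ v) (here refl) = Fin.zero , refl
∈-word⁻ (a ∷ v) (there p) with ∈-word⁻ v p
... | i , eq = Fin.suc i , eq

∈-word⁺ : ∀ {m n} (v : Vec (Fin m) n) i → toℕ (lookup v i) ∈ word v
∈-word⁺ (a ∷ v) Fin.zero    = here refl
∈-word⁺ (a ∷ v) (Fin.suc i) = there (∈-word⁺ v i)

injective⇒Unique : ∀ {m n} (v : Vec (Fin m) n) →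
  (∀ i j → toℕ (lookup v i) ≡ toℕ (lookup v j) → i ≡ j) → Unique (word v)
injective⇒Unique []      _   = []
injective⇒Unique (a ∷ v) inj =
  All.tabulate (λ {x} x∈ a≡x → let i , eq = ∈-word⁻ v x∈ in
                  Finₚ.0≢1+n (inj Fin.zero (Fin.suc i) (trans a≡x (sym eq))))
  ∷ injective⇒Unique v (λ i j eq → Finₚ.suc-injective (inj (Fin.suc i) (Fin.suc j) eq))

Unique⇒injective : ∀ {m n} (v : Vec (Fin m) n) → Unique (word v) →
  ∀ i j → toℕ (lookup v i) ≡ toℕ (lookup v j) → i ≡ j
Unique⇒injective (a ∷ v) (a∉ ∷ u) Fin.zero    Fin.zero    eq = refl
Unique⇒injective (a ∷ v) (a∉ ∷ u) Fin.zero    (Fin.suc j) eq = contradiction eq (All.lookup a∉ (∈-word⁺ v j))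
Unique⇒injective (a ∷ v) (a∉ ∷ u) (Fin.suc i) Fin.zero    eq = contradiction (sym eq) (All.lookup a∉ (∈-word⁺ v i))
Unique⇒injective (a ∷ v) (a∉ ∷ u) (Fin.suc i) (Fin.suc j) eq = cong Fin.suc (Unique⇒injective v u i j eq)

T-all⁻ : (p : A → Bool) {xs : List A} → T (all p xs) → All (T ∘ p) xs
T-all⁻ p {[]}     _ = []
T-all⁻ p {x ∷ xs} t = let px , t′ = Equivalence.to T-∧ t in px ∷ T-all⁻ p t′

T-all⁺ : (p : A → Bool) {xs : List A} → All (T ∘ p) xs → T (all p xs)
T-all⁺ p []         = _
T-all⁺ p (px ∷ pxs) = Equivalence.from T-∧ (px , T-all⁺ p pxs)

distinctAt : ∀ {m n} → Vec (Fin m) n → Fin n → Fin n → Bool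
distinctAt v i j = (toℕ i ≡ᵇ toℕ j) ∨ not (toℕ (lookup v i) ≡ᵇ toℕ (lookup v j))

injectiveᵇ⁻ : ∀ {n} (v : Vec (Fin n) n) → T (injectiveᵇ v) →
  ∀ i j → toℕ (lookup v i) ≡ toℕ (lookup v j) → i ≡ j
injectiveᵇ⁻ {n} v t i j eq
  with Equivalence.to T-∨ (All.lookup (T-all⁻ (distinctAt v i) {allFin n}
         (All.lookup (T-all⁻ (λ i → all (distinctAt v i) (allFin n)) {allFin n} t) (∈-allFin i))) (∈-allFin j))
... | inj₁ i≡j = toℕ-injective (≡ᵇ⇒≡ _ _ i≡j)
... | inj₂ ne  = ⊥-elim (subst T (Equivalence.to T-not-≡ ne) (≡⇒≡ᵇ (toℕ (lookup v i)) _ eq))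

T-not⁺ : ∀ {b} → ¬ T b → T (not b)
T-not⁺ {true}  ¬t = ¬t _
T-not⁺ {false} _  = _

T-not⁻ : ∀ {b} → T (not b) → ¬ T b
T-not⁻ {false} _ ()

injectiveᵇ⁺ : ∀ {n} (v : Vec (Fin n) n) →
  (∀ i j → toℕ (lookup v i) ≡ toℕ (lookup v j) → i ≡ j) → T (injectiveᵇ v)
injectiveᵇ⁺ {n} v inj =
  T-all⁺ (λ i → all (distinctAt v i) (allFin n)) {allFin n} (All.tabulate λ {i} _ →
    T-all⁺ (distinctAt v i) {allFin n} (All.tabulate λ {j} _ → entry i j))
  where
  entry : ∀ i j → T (distinctAt v i j)
  entry i j with i Finₚ.≟ j
  ... | yes refl = Equivalence.from T-∨ (inj₁ (≡⇒≡ᵇ (toℕ i) _ refl))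
  ... | no i≢j   = Equivalence.from T-∨ (inj₂ (T-not⁺ (λ eq → i≢j (inj i j (≡ᵇ⇒≡ (toℕ (lookup v i)) _ eq)))))

-- In this form the general facts on uniqueness and membership for Cartesian products apply.
allWords-∷ : ∀ m n → allWords m (suc n) ≡ cartesianProductWith (λ v a → a ∷ v) (allWords m n) (allFin m)
allWords-∷ m n = go (allWords m n)
  where
  go : ∀ vs → concatMap (λ v → map (λ a → a ∷ v) (allFin m)) vs ≡ cartesianProductWith (λ v a → a ∷ v) vs (allFin m)
  go []       = refl
  go (v ∷ vs) = cong (map (λ a → a ∷ v) (allFin m) ++_) (go vs)

Unique-allWords : ∀ m n → Unique (allWords m n)
Unique-allWords m zero    = [] ∷ []
Unique-allWords m (suc n) rewrite allWords-∷ m n =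
  Uniqueₚ.cartesianProductWith⁺ _ (λ eq → Vecₚ.∷-injectiveʳ eq , Vecₚ.∷-injectiveˡ eq)
    (Unique-allWords m n) (Uniqueₚ.allFin⁺ m)

∈-allWords : ∀ {m n} (v : Vec (Fin m) n) → v ∈ allWords m n
∈-allWords []                      = here refl
∈-allWords {m} {suc n} (a ∷ v) rewrite allWords-∷ m n =
  ∈-cartesianProductWith⁺ _ (∈-allWords v) (∈-allFin a)

Unique-Perms : ∀ n → Unique (Perms n)
Unique-Perms n = Unique-filterᵇ injectiveᵇ (Unique-allWords n n)

∈-Perms⇒IsPerm : ∀ {n} {v : Vec (Fin n) n} → v ∈ Perms n → IsPerm n (word v)
∈-Perms⇒IsPerm {n} {v} v∈ = isPerm (word-length v) (word-bounded v)
  (injective⇒Unique v (injectiveᵇ⁻ v (proj₂ (∈-filterᵇ⁻ injectiveᵇ (allWords n n) v∈))))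

Unique-words : ∀ n → Unique (words n)
Unique-words n = Uniqueₚ.map⁺ word-injective (Unique-Perms n)

∈-words⁻ : ∀ {n w} → w ∈ words n → IsPerm n w
∈-words⁻ w∈ with ∈-map⁻ word w∈
... | v , v∈ , refl = ∈-Perms⇒IsPerm v∈

∈-words⁺ : ∀ {n w} → IsPerm n w → w ∈ words n
∈-words⁺ {n} (isPerm l b u) with word-surjective _ l b
... | v , refl = ∈-map⁺ word (∈-filterᵇ⁺ injectiveᵇ (∈-allWords v) (injectiveᵇ⁺ v (Unique⇒injective v u)))

-- Mesh pattern occurrences as factorisations of a word

ind : Bool → ℕ
ind true  = 1
ind false = 0

-- A cut of a word w is a factorisation w = L ++ a ∷ R.
cutSum : (List ℕ → ℕ → List ℕ → ℕ) → List ℕ → ℕ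
cutSum f []      = 0
cutSum f (a ∷ R) = f [] a R + cutSum (λ L → f (a ∷ L)) R

cutSum-++ : ∀ f L w → cutSum f (L ++ w) ≡ cutSum (λ L₁ a R → f L₁ a (R ++ w)) L + cutSum (λ L₁ → f (L ++ L₁)) w
cutSum-++ f []      w = refl
cutSum-++ f (a ∷ L) w =
  trans (cong (f [] a (L ++ w) +_) (cutSum-++ (λ L₁ → f (a ∷ L₁)) L w)) (sym (+-assoc (f [] a (L ++ w)) _ _))

cutSum-cong : ∀ {f g} w → (∀ L a R → w ≡ L ++ a ∷ R → f L a R ≡ g L a R) → cutSum f w ≡ cutSum g w
cutSum-cong []      _  = refl
cutSum-cong (a ∷ w) eq = cong₂ _+_ (eq [] a w refl) (cutSum-cong w (λ L b R e → eq (a ∷ L) b R (cong (a ∷_) e)))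

cutSum-zero : ∀ {f} w → (∀ L a R → w ≡ L ++ a ∷ R → f L a R ≡ 0) → cutSum f w ≡ 0
cutSum-zero []      _ = refl
cutSum-zero (a ∷ w) z = cong₂ _+_ (z [] a w refl) (cutSum-zero w (λ L b R e → z (a ∷ L) b R (cong (a ∷_) e)))

cutSum-map : ∀ f (g : ℕ → ℕ) w → cutSum f (map g w) ≡ cutSum (λ L a R → f (map g L) (g a) (map g R)) w
cutSum-map f g []      = refl
cutSum-map f g (x ∷ w) = cong (f [] (g x) (map g w) +_) (cutSum-map (λ L → f (g x ∷ L)) g w)

T-ext : ∀ {a b} → (T a → T b) → (T b → T a) → a ≡ b
T-ext {true}  {true}  _ _ = refl
T-ext {true}  {false} f _ = ⊥-elim (f _)
T-ext {false} {true}  _ g = ⊥-elim (g _)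
T-ext {false} {false} _ _ = refl

¬T⇒≡ : ∀ {b} → ¬ T b → b ≡ false
¬T⇒≡ {true}  ¬t = ⊥-elim (¬t _)
¬T⇒≡ {false} _  = refl

-- Locates a cut relative to a second factorisation of the same list. The length bound lets
-- `column⁻` exclude the columns to the right of `L`.
cut-split : ∀ {A : Set} {z : A} L₁ {R₁} L {w} → L₁ ++ z ∷ R₁ ≡ L ++ w →
  (z ∈ L × length L₁ < length L) ⊎ (∃ λ L₂ → L₁ ≡ L ++ L₂ × w ≡ L₂ ++ z ∷ R₁)
cut-split L₁       []      eq = inj₂ (L₁ , refl , sym eq)
cut-split []       (x ∷ L) eq = inj₁ (here (∷-injectiveˡ eq) , s≤s z≤n)
cut-split (y ∷ L₁) (x ∷ L) eq with ∷-injective eq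
... | refl , eq′ with cut-split L₁ L eq′
... | inj₁ (z∈ , lt)          = inj₁ (there z∈ , s≤s lt)
... | inj₂ (L₂ , refl , eq″)  = inj₂ (L₂ , refl , eq″)

-- The rows are half-open, unlike the strips of the mesh. On a permutation this makes no difference:
-- a letter at another position equals neither `a` nor `b`.
row : ℕ → ℕ → ℕ → ℕ
row a b y = if y <ᵇ a then 0 else if y <ᵇ b then 1 else 2

data Row (a b y : ℕ) : ℕ → Set where
  below   : y < a → Row a b y 0
  between : a ≤ y → y < b → Row a b y 1
  above   : a ≤ y → b ≤ y → Row a b y 2

rowView : ∀ a b y → Row a b y (row a b y)
rowView a b y with y <ᵇ a in eq₁ | y <ᵇ b in eq₂
... | true  | _     = below (<ᵇ⇒< y a (subst T (sym eq₁) _))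
... | false | true  = between (≮⇒≥ λ lt → subst T eq₁ (<⇒<ᵇ lt)) (<ᵇ⇒< y b (subst T (sym eq₂) _))
... | false | false = above (≮⇒≥ λ lt → subst T eq₁ (<⇒<ᵇ lt)) (≮⇒≥ λ lt → subst T eq₂ (<⇒<ᵇ lt))

row-unique : ∀ {a b y r} → a ≤ b → Row a b y r → row a b y ≡ r
row-unique {a} {b} {y} a≤b v = unique (rowView a b y) v
  where
  unique : ∀ {r s} → Row a b y r → Row a b y s → r ≡ s
  unique (below _)     (below _)     = refl
  unique (below p)     (between q _) = contradiction p (≤⇒≯ q)
  unique (below p)     (above q _)   = contradiction p (≤⇒≯ q)
  unique (between q _) (below p)     = contradiction p (≤⇒≯ q)
  unique (between _ _) (between _ _) = refl
  unique (between _ p) (above _ q)   = contradiction p (≤⇒≯ q)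
  unique (above q _)   (below p)     = contradiction p (≤⇒≯ q)
  unique (above _ q)   (between _ p) = contradiction p (≤⇒≯ q)
  unique (above _ _)   (above _ _)   = refl

-- The complement of the shading: box c r holds when column c, row r may contain points.
Boxes : Set
Boxes = ℕ → ℕ → Bool

-- In the word `L ++ a ∷ M ++ b ∷ N` the columns of the mesh are the lists `L`, `M` and `N`, so
-- positions disappear and only rows are computed.
meshᵇ : Boxes → List ℕ → ℕ → List ℕ → ℕ → List ℕ → Bool
meshᵇ box L a M b N =
  (a <ᵇ b) ∧ all (box 0 ∘ row a b) L ∧ all (box 1 ∘ row a b) M ∧ all (box 2 ∘ row a b) N

record Mesh (box : Boxes) (L : List ℕ) (a : ℕ) (M : List ℕ) (b : ℕ) (N : List ℕ) : Set where
  constructor mesh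
  field
    a<b  : a < b
    allL : All (λ y → T (box 0 (row a b y))) L
    allM : All (λ y → T (box 1 (row a b y))) M
    allN : All (λ y → T (box 2 (row a b y))) N

mesh⁻ : ∀ {box L a M b N} → T (meshᵇ box L a M b N) → Mesh box L a M b N
mesh⁻ {a = a} {b = b} t with Equivalence.to T-∧ t
... | t₁ , t′ with Equivalence.to T-∧ t′
... | t₂ , t″ with Equivalence.to T-∧ t″
... | t₃ , t₄ = mesh (<ᵇ⇒< a b t₁) (T-all⁻ _ t₂) (T-all⁻ _ t₃) (T-all⁻ _ t₄)

mesh⁺ : ∀ {box L a M b N} → Mesh box L a M b N → T (meshᵇ box L a M b N)
mesh⁺ (mesh p q r s) =
  Equivalence.from T-∧ (<⇒<ᵇ p , Equivalence.from T-∧ (T-all⁺ _ q , Equivalence.from T-∧ (T-all⁺ _ r , T-all⁺ _ s)))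

meshᵇ-ext : ∀ {box L a M b N box′ L′ a′ M′ b′ N′} → (Mesh box L a M b N → Mesh box′ L′ a′ M′ b′ N′) →
  (Mesh box′ L′ a′ M′ b′ N′ → Mesh box L a M b N) → meshᵇ box L a M b N ≡ meshᵇ box′ L′ a′ M′ b′ N′
meshᵇ-ext {box} {L} {a} {M} {b} {N} {box′} {L′} {a′} {M′} {b′} {N′} f g =
  T-ext (mesh⁺ ∘ f ∘ mesh⁻ {box} {L} {a} {M} {b} {N}) (mesh⁺ ∘ g ∘ mesh⁻ {box′} {L′} {a′} {M′} {b′} {N′})

starts : Boxes → List ℕ → ℕ → List ℕ → ℕ
starts box L a R = cutSum (λ M b N → ind (meshᵇ box L a M b N)) R

occurrences : Boxes → List ℕ → ℕ
occurrences box = cutSum (starts box)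

boxes : MeshR → Boxes
boxes R c r = not (any (λ { (c′ , r′) → (c ≡ᵇ c′) ∧ (r ≡ᵇ r′) }) R)

T-any⁻ : (p : A → Bool) {xs : List A} → T (any p xs) → ∃ λ x → x ∈ xs × T (p x)
T-any⁻ p {x ∷ xs} t with Equivalence.to T-∨ t
... | inj₁ px = x , here refl , px
... | inj₂ t′ with T-any⁻ p t′
... | y , y∈ , py = y , there y∈ , py

T-any⁺ : (p : A → Bool) {x : A} {xs : List A} → x ∈ xs → T (p x) → T (any p xs)
T-any⁺ p (here refl) px = Equivalence.from T-∨ (inj₁ px)
T-any⁺ p {xs = y ∷ _} (there x∈)  px = Equivalence.from (T-∨ {p y}) (inj₂ (T-any⁺ p x∈ px))

boxes⁻ : ∀ {R c r} → T (boxes R c r) → (c , r) ∉ R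
boxes⁻ {R} {c} {r} t cr∈ =
  T-not⁻ t (T-any⁺ _ cr∈ (Equivalence.from (T-∧ {c ≡ᵇ c}) (≡⇒≡ᵇ c c refl , ≡⇒≡ᵇ r r refl)))

boxes⁺ : ∀ {R c r} → (c , r) ∉ R → T (boxes R c r)
boxes⁺ {R} {c} {r} ∉R = T-not⁺ λ t → let (c′ , r′) , ∈R , eq = T-any⁻ _ {R} t
                                         eqc , eqr = Equivalence.to (T-∧ {c ≡ᵇ c′}) eq
  in ∉R (subst₂ (λ c r → (c , r) ∈ R) (sym (≡ᵇ⇒≡ c c′ eqc)) (sym (≡ᵇ⇒≡ r r′ eqr)) ∈R)

-- Agreement with the definition by positions and values

inStrip : ℕ → ℕ → ℕ → ℕ → ℕ → Bool
inStrip u v n c k = strictlyBetween (gridLine (suc u) (suc v) n c) (suc k) (gridLine (suc u) (suc v) n (suc c))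

data Strip (u v n k : ℕ) : ℕ → Set where
  first  : k < u → Strip u v n k 0
  second : u < k → k < v → Strip u v n k 1
  third  : v < k → k < n → Strip u v n k 2

strip⁻ : ∀ {u v n k} c → T (inStrip u v n c k) → Strip u v n k c
strip⁻ {u} {v} {n} {k} 0 t = first (<ᵇ⇒< k u t)
strip⁻ {u} {v} {n} {k} 1 t = let p , q = Equivalence.to (T-∧ {u <ᵇ k}) t in second (<ᵇ⇒< u k p) (<ᵇ⇒< k v q)
strip⁻ {u} {v} {n} {k} 2 t = let p , q = Equivalence.to (T-∧ {v <ᵇ k}) t in third (<ᵇ⇒< v k p) (<ᵇ⇒< k n q)
-- From index 3 on both grid lines are `suc n` and the strip is empty; a shaded box outside the 3 by
-- 3 grid would forbid nothing.
strip⁻ {u} {v} {n} {k} (suc (suc (suc c))) t =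
  let p , q = Equivalence.to (T-∧ {n <ᵇ k}) t in contradiction (<ᵇ⇒< k n q) (<⇒≯ (<ᵇ⇒< n k p))

strip⁺ : ∀ {u v n k c} → Strip u v n k c → T (inStrip u v n c k)
strip⁺ (first p)    = <⇒<ᵇ p
strip⁺ {u} {k = k} (second p q) = Equivalence.from (T-∧ {u <ᵇ k}) (<⇒<ᵇ p , <⇒<ᵇ q)
strip⁺ {v = v} {k = k} (third p q)  = Equivalence.from (T-∧ {v <ᵇ k}) (<⇒<ᵇ p , <⇒<ᵇ q)

strip⇒row : ∀ {a b n y r} → a < b → Strip a b n y r → row a b y ≡ r
strip⇒row a<b (first p)    = row-unique (<⇒≤ a<b) (below p)
strip⇒row a<b (second p q) = row-unique (<⇒≤ a<b) (between (<⇒≤ p) q)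
strip⇒row a<b (third p q)  = row-unique (<⇒≤ a<b) (above (<⇒≤ (<-trans a<b p)) (<⇒≤ p))

row⇒strip : ∀ {a b n y} → y < n → y ≢ a → y ≢ b → Strip a b n y (row a b y)
row⇒strip {a} {b} {n} {y} y<n y≢a y≢b with row a b y | rowView a b y
... | _ | below p     = first p
... | _ | between p q = second (≤∧≢⇒< p (y≢a ∘ sym)) q
... | _ | above _ q   = third (≤∧≢⇒< q (y≢b ∘ sym)) y<n

anyIdx : (ℕ → ℕ → Bool) → List ℕ → Bool
anyIdx h []      = false
anyIdx h (z ∷ w) = h 0 z ∨ anyIdx (h ∘ suc) w

anyIdx⁻ : ∀ h w → T (anyIdx h w) → ∃ λ L → ∃₂ λ z R → w ≡ L ++ z ∷ R × T (h (length L) z)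
anyIdx⁻ h (z ∷ w) t with Equivalence.to (T-∨ {h 0 z}) t
... | inj₁ hz = [] , z , w , refl , hz
... | inj₂ t′ with anyIdx⁻ (h ∘ suc) w t′
... | L , y , R , refl , hy = z ∷ L , y , R , refl , hy

anyIdx⁺ : ∀ h L z R → T (h (length L) z) → T (anyIdx h (L ++ z ∷ R))
anyIdx⁺ h []      z R t = Equivalence.from (T-∨ {h 0 z}) (inj₁ t)
anyIdx⁺ h (x ∷ L) z R t = Equivalence.from (T-∨ {h 0 x}) (inj₂ (anyIdx⁺ (h ∘ suc) L z R t))

map-tabulate-suc : ∀ {n} (f : Fin (suc n) → A) → map f (tabulate Fin.suc) ≡ map (f ∘ Fin.suc) (allFin n)
map-tabulate-suc f = trans (map-tabulate Fin.suc f) (sym (map-tabulate id (f ∘ Fin.suc)))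

anyIdx-Fin : ∀ {m n} (h : ℕ → ℕ → Bool) (v : Vec (Fin m) n) →
  any (λ k → h (toℕ k) (toℕ (lookup v k))) (allFin n) ≡ anyIdx h (word v)
anyIdx-Fin {n = zero}  h []      = refl
anyIdx-Fin {n = suc n} h (a ∷ v) = cong (h 0 (toℕ a) ∨_)
  (trans (cong or (map-tabulate-suc (λ k → h (toℕ k) (toℕ (lookup (a ∷ v) k))))) (anyIdx-Fin (h ∘ suc) v))

cutSum-Fin : ∀ {m n} (F : ℕ → ℕ → ℕ) (v : Vec (Fin m) n) →
  sum (map (λ k → F (toℕ k) (toℕ (lookup v k))) (allFin n)) ≡ cutSum (λ L a _ → F (length L) a) (word v)
cutSum-Fin {n = zero}  F []      = refl
cutSum-Fin {n = suc n} F (a ∷ v) = cong (F 0 (toℕ a) +_)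
  (trans (cong sum (map-tabulate-suc (λ k → F (toℕ k) (toℕ (lookup (a ∷ v) k))))) (cutSum-Fin (F ∘ suc) v))

meshAt : ℕ → MeshR → List ℕ → ℕ → ℕ → ℕ → ℕ → Bool
meshAt n R w i a j b = (suc i <ᵇ suc j) ∧ (suc a <ᵇ suc b) ∧
  all (λ (c , r) → not (anyIdx (λ k y → inStrip i j n c k ∧ inStrip a b n r y) w)) R

all-cong : {p q : A → Bool} → (∀ x → p x ≡ q x) → ∀ xs → all p xs ≡ all q xs
all-cong eq xs = cong and (map-cong eq xs)

isOccᵇ≡meshAt : ∀ {n} R (π : Vec (Fin n) n) i j →
  isOccᵇ R π i j ≡ meshAt n R (word π) (toℕ i) (toℕ (lookup π i)) (toℕ j) (toℕ (lookup π j))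
isOccᵇ≡meshAt {n} R π i j =
  cong (λ t → (pos i <ᵇ pos j) ∧ (val π i <ᵇ val π j) ∧ t)
    (all-cong (λ (c , r) → cong not
       (anyIdx-Fin (λ k y → inStrip (toℕ i) (toℕ j) n c k ∧ inStrip (toℕ (lookup π i)) (toℕ (lookup π j)) n r y) π)) R)

length-filterᵇ : (p : A → Bool) (xs : List A) → length (filterᵇ p xs) ≡ sum (map (ind ∘ p) xs)
length-filterᵇ p []       = refl
length-filterᵇ p (x ∷ xs) with p x
... | true  = cong suc (length-filterᵇ p xs)
... | false = length-filterᵇ p xs

length-concatMap : (f : A → List B) (xs : List A) → length (concatMap f xs) ≡ sum (map (length ∘ f) xs)
length-concatMap f []       = refl
length-concatMap f (x ∷ xs) = trans (length-++ (f x)) (cong (length (f x) +_) (length-concatMap f xs))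

occ≡double : ∀ {n} R (π : Vec (Fin n) n) →
  occ R π ≡ cutSum (λ L a _ → cutSum (λ L′ b _ → ind (meshAt n R (word π) (length L) a (length L′) b)) (word π)) (word π)
occ≡double {n} R π = begin
  occ R π
    ≡⟨ length-concatMap _ (allFin n) ⟩
  sum (map (λ i → length (filterᵇ (isOccᵇ R π i) (allFin n))) (allFin n))
    ≡⟨ cong sum (map-cong (λ i → trans (length-filterᵇ _ (allFin n))
         (trans (cong sum (map-cong (λ j → cong ind (isOccᵇ≡meshAt R π i j)) (allFin n)))
                (cutSum-Fin (λ j b → ind (meshAt n R (word π) (toℕ i) (toℕ (lookup π i)) j b)) π))) (allFin n)) ⟩
  sum (map (λ i → cutSum (λ L′ b _ → ind (meshAt n R (word π) (toℕ i) (toℕ (lookup π i)) (length L′) b)) (word π)) (allFin n))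
    ≡⟨ cutSum-Fin (λ i a → cutSum (λ L′ b _ → ind (meshAt n R (word π) i a (length L′) b)) (word π)) π ⟩
  cutSum (λ L a _ → cutSum (λ L′ b _ → ind (meshAt n R (word π) (length L) a (length L′) b)) (word π)) (word π) ∎
  where open ≡-Reasoning

cut-distinct : ∀ {A : Set} {z a : A} L {R} → Unique (L ++ a ∷ R) → z ∈ L ++ R → z ≢ a
cut-distinct []      (a∉ ∷ _) z∈ refl = All.lookup a∉ z∈ refl
cut-distinct (x ∷ L) (x∉ ∷ u) (here refl) z≡a = All.lookup x∉ (∈-insert L) z≡a
cut-distinct (x ∷ L) (x∉ ∷ u) (there z∈)  z≡a = cut-distinct L u z∈ z≡a

module _ {n : ℕ} {R : MeshR} {L M N : List ℕ} {a b : ℕ} (perm : IsPerm n (L ++ a ∷ M ++ b ∷ N)) where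

  private
    w = L ++ a ∷ M ++ b ∷ N
    i = length L
    j = length (L ++ a ∷ M)

    w-assoc : (L ++ a ∷ M) ++ b ∷ N ≡ w
    w-assoc = ++-assoc L (a ∷ M) (b ∷ N)

    j≡ : j ≡ i + suc (length M)
    j≡ = length-++ L

    i<j : i < j
    i<j = subst (i <_) (sym j≡) (m<m+n i (s≤s z≤n))

    j<n : j < n
    j<n = subst (j <_) (trans (sym (length-++ (L ++ a ∷ M))) (trans (cong length w-assoc) (len perm)))
            (m<m+n j (s≤s z≤n))

    ≢a : ∀ {z} → z ∈ L ++ M ++ b ∷ N → z ≢ a
    ≢a = cut-distinct L (distinct perm)

    ≢b : ∀ {z} → z ∈ (L ++ a ∷ M) ++ N → z ≢ b
    ≢b = cut-distinct (L ++ a ∷ M) (subst Unique (sym w-assoc) (distinct perm))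

    cell : ℕ → ℕ → ℕ → ℕ → Bool
    cell c r k y = inStrip i j n c k ∧ inStrip a b n r y

    occupied : ∀ {c z} L₁ {R₁} → w ≡ L₁ ++ z ∷ R₁ → z ≢ a → z ≢ b →
      Strip i j n (length L₁) c → T (anyIdx (cell c (row a b z)) w)
    occupied {c} {z} L₁ {R₁} eq z≢a z≢b column = subst (T ∘ anyIdx (cell c (row a b z))) (sym eq)
      (anyIdx⁺ (cell c (row a b z)) L₁ z R₁
        (Equivalence.from (T-∧ {inStrip i j n c (length L₁)}) (strip⁺ column ,
           strip⁺ (row⇒strip (All.lookup (bounded perm) (subst (z ∈_) (sym eq) (∈-insert L₁))) z≢a z≢b))))

    inColumn : ℕ → List ℕ
    inColumn 0 = L
    inColumn 1 = M
    inColumn 2 = N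
    inColumn _ = []

    -- Along with the position come the inequalities `z ≢ a` and `z ≢ b`, which `row⇒strip` needs to
    -- pass from half-open rows to open strips.
    column⁺ : ∀ {z c} → z ∈ inColumn c → (∃ λ L₁ → ∃ λ R₁ → w ≡ L₁ ++ z ∷ R₁ × Strip i j n (length L₁) c) × z ≢ a × z ≢ b
    column⁺ {z} {0} z∈ with ∈-∃++ z∈
    ... | L₁ , L₂ , refl = (L₁ , L₂ ++ a ∷ M ++ b ∷ N , ++-assoc L₁ (z ∷ L₂) _ ,
                            first (subst (length L₁ <_) (sym (length-++ L₁)) (m<m+n _ (s≤s z≤n))))
                         , ≢a (∈-++⁺ˡ z∈) , ≢b (∈-++⁺ˡ (∈-++⁺ˡ z∈))
    column⁺ {z} {1} z∈ with ∈-∃++ z∈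
    ... | M₁ , M₂ , refl =
      (L ++ a ∷ M₁ , M₂ ++ b ∷ N
        , trans (cong (λ t → L ++ a ∷ t) (++-assoc M₁ (z ∷ M₂) _)) (sym (++-assoc L (a ∷ M₁) _))
        , second (subst (i <_) (sym (length-++ L)) (m<m+n i (s≤s z≤n)))
                 (subst₂ _<_ (sym (length-++ L)) (sym (trans j≡ (cong (λ t → i + suc t) (length-++ M₁))))
                    (+-monoʳ-< i (s≤s (m<m+n _ (s≤s z≤n))))))
      , ≢a (∈-++⁺ʳ L (∈-++⁺ˡ z∈)) , ≢b (∈-++⁺ˡ (∈-++⁺ʳ L (there z∈)))
    column⁺ {z} {2} z∈ with ∈-∃++ z∈
    ... | N₁ , N₂ , refl =
      ((L ++ a ∷ M) ++ b ∷ N₁ , N₂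
        , trans (sym w-assoc) (sym (++-assoc (L ++ a ∷ M) (b ∷ N₁) (z ∷ N₂)))
        , third (subst (j <_) (sym (length-++ (L ++ a ∷ M))) (m<m+n j (s≤s z≤n)))
                (subst (length ((L ++ a ∷ M) ++ b ∷ N₁) <_)
                   (trans (sym (length-++ ((L ++ a ∷ M) ++ b ∷ N₁)))
                     (trans (cong length (trans (++-assoc (L ++ a ∷ M) (b ∷ N₁) (z ∷ N₂)) w-assoc)) (len perm)))
                   (m<m+n _ (s≤s z≤n))))
      , ≢a (∈-++⁺ʳ L (∈-++⁺ʳ M (there z∈))) , ≢b (∈-++⁺ʳ (L ++ a ∷ M) z∈)

    -- A cut of `w` falls inside `L`, at `a`, inside `M`, at `b` or inside `N`. The cuts at `a` and
    -- `b` lie on grid lines and hence in no strip; comparing lengths settles the rest.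
    column⁻ : ∀ {z c} L₁ {R₁} → w ≡ L₁ ++ z ∷ R₁ → Strip i j n (length L₁) c → z ∈ inColumn c
    column⁻ {z} L₁ {R₁} eq s with cut-split L₁ L (sym eq)
    ... | inj₁ (z∈ , lt) = inL s
      where
      inL : ∀ {c} → Strip i j n (length L₁) c → z ∈ inColumn c
      inL (first _)    = z∈
      inL (second p _) = contradiction p (<⇒≯ lt)
      inL (third p _)  = contradiction (<-trans i<j p) (<⇒≯ lt)
    ... | inj₂ ([] , refl , _) = atA s
      where
      atA : ∀ {c} → Strip i j n (length (L ++ [])) c → z ∈ inColumn c
      atA s rewrite ++-identityʳ L with s
      ... | first p    = contradiction p (<-irrefl refl)
      ... | second p _ = contradiction p (<-irrefl refl)
      ... | third p _  = contradiction i<j (<⇒≯ p)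
    ... | inj₂ (x ∷ L₂ , refl , eq₂) with ∷-injective eq₂
    ... | refl , eq₃ with cut-split L₂ M (sym eq₃)
    ... | inj₁ (z∈ , lt) = inM s
      where
      i<x : i < length (L ++ a ∷ L₂)
      i<x = subst (i <_) (sym (length-++ L)) (m<m+n i (s≤s z≤n))
      x<j : length (L ++ a ∷ L₂) < j
      x<j = subst₂ _<_ (sym (length-++ L)) (sym j≡) (+-monoʳ-< i (s≤s lt))
      inM : ∀ {c} → Strip i j n (length (L ++ a ∷ L₂)) c → z ∈ inColumn c
      inM (first p)    = contradiction p (<⇒≯ i<x)
      inM (second _ _) = z∈
      inM (third p _)  = contradiction p (<⇒≯ x<j)
    ... | inj₂ (L₃ , refl , eq₄) = afterM L₃ eq₄ s
      where
      afterM : ∀ {c} L₃ → b ∷ N ≡ L₃ ++ z ∷ R₁ → Strip i j n (length (L ++ a ∷ M ++ L₃)) c → z ∈ inColumn c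
      afterM L₃ eq s rewrite sym (++-assoc L (a ∷ M) L₃) | length-++ (L ++ a ∷ M) {L₃} with L₃ | eq | s
      ... | _      | _    | first p    = contradiction (<-≤-trans p (<⇒≤ i<j)) (≤⇒≯ (m≤m+n j _))
      ... | _      | _    | second _ p = contradiction p (≤⇒≯ (m≤m+n j _))
      ... | []     | _    | third p _  = contradiction p (≤⇒≯ (≤-reflexive (+-identityʳ j)))
      ... | _ ∷ L₄ | refl | third _ _  = ∈-insert L₄

  meshAt≡meshᵇ : meshAt n R w (length L) a (length (L ++ a ∷ M)) b ≡ meshᵇ (boxes R) L a M b N
  meshAt≡meshᵇ = T-ext to from
    where
    empty : ℕ × ℕ → Bool
    empty (c , r) = not (anyIdx (cell c r) w)

    to : T (meshAt n R w i a j b) → T (meshᵇ (boxes R) L a M b N)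
    to t with Equivalence.to (T-∧ {i <ᵇ j}) t
    ... | _ , t′ with Equivalence.to (T-∧ {a <ᵇ b}) t′
    ... | a<b , t″ = mesh⁺ {boxes R} (mesh (<ᵇ⇒< a b a<b) (allowed {0}) (allowed {1}) (allowed {2}))
      where
      allowed : ∀ {c} → All (λ y → T (boxes R c (row a b y))) (inColumn c)
      allowed {c} = All.tabulate λ {z} z∈ → boxes⁺ {R} {c} {row a b z} λ cr∈ →
        let (L₁ , _ , eq , column) , z≢a , z≢b = column⁺ {c = c} z∈
        in T-not⁻ (All.lookup (T-all⁻ empty t″) cr∈) (occupied {c} L₁ eq z≢a z≢b column)

    from : T (meshᵇ (boxes R) L a M b N) → T (meshAt n R w i a j b)
    from t with mesh⁻ {boxes R} {L} {a} {M} {b} {N} t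
    ... | mesh a<b allL allM allN = Equivalence.from (T-∧ {i <ᵇ j}) (<⇒<ᵇ i<j ,
      Equivalence.from (T-∧ {a <ᵇ b}) (<⇒<ᵇ a<b , T-all⁺ empty (All.tabulate λ {(c , r)} cr∈ → T-not⁺ (unoccupied cr∈))))
      where
      allowed : ∀ c → All (λ y → T (boxes R c (row a b y))) (inColumn c)
      allowed 0 = allL
      allowed 1 = allM
      allowed 2 = allN
      allowed (suc (suc (suc _))) = []

      unoccupied : ∀ {c r} → (c , r) ∈ R → ¬ T (anyIdx (cell c r) w)
      unoccupied {c} {r} cr∈ t₁ with anyIdx⁻ (cell c r) w t₁
      ... | L₁ , z , R₁ , eq , t₂ with Equivalence.to (T-∧ {inStrip i j n c (length L₁)}) t₂
      ... | column , inRow = boxes⁻ {R} {c} (All.lookup (allowed c) (column⁻ L₁ eq (strip⁻ c column)))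
        (subst (λ r → (c , r) ∈ R) (sym (strip⇒row a<b (strip⁻ r inRow))) cr∈)

-- The definition sums over all pairs of positions. Splitting the inner sum at the position of `a`
-- isolates the pairs whose second position does not come later, and these vanish by the first test
-- of `meshAt`.
occ≡occurrences : ∀ {n} R {π : Vec (Fin n) n} → π ∈ Perms n → occ R π ≡ occurrences (boxes R) (word π)
occ≡occurrences {n} R {π} π∈ = trans (occ≡double R π) (cutSum-cong (word π) inner)
  where
  perm = ∈-Perms⇒IsPerm π∈
  inner : ∀ L a R′ → word π ≡ L ++ a ∷ R′ →
    cutSum (λ L′ b _ → ind (meshAt n R (word π) (length L) a (length L′) b)) (word π) ≡ starts (boxes R) L a R′
  inner L a R′ eq = begin
    cutSum f (word π)                       ≡⟨ cong (cutSum f) eq ⟩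
    cutSum f (L ++ a ∷ R′)                  ≡⟨ cutSum-++ f L (a ∷ R′) ⟩
    cutSum (λ L₁ b R₁ → f L₁ b (R₁ ++ a ∷ R′)) L + (f (L ++ []) a R′ + cutSum (λ M → f (L ++ a ∷ M)) R′)
      ≡⟨ cong₂ _+_ (cutSum-zero L before)
           (cong₂ _+_ (vanish (L ++ []) a (λ lt → <-irrefl refl (subst (λ t → length L < length t) (++-identityʳ L) lt)))
                      (cutSum-cong R′ after)) ⟩
    starts (boxes R) L a R′                 ∎
    where
    open ≡-Reasoning
    f : List ℕ → ℕ → List ℕ → ℕ
    f L′ b _ = ind (meshAt n R (word π) (length L) a (length L′) b)
    vanish : ∀ L′ b → ¬ (length L < length L′) → ind (meshAt n R (word π) (length L) a (length L′) b) ≡ 0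
    vanish L′ b ≮ = cong ind (¬T⇒≡ {meshAt n R (word π) (length L) a (length L′) b} λ t →
      ≮ (<ᵇ⇒< (length L) (length L′) (proj₁ (Equivalence.to (T-∧ {length L <ᵇ length L′}) t))))
    before : ∀ L₁ b R₁ → L ≡ L₁ ++ b ∷ R₁ → f L₁ b (R₁ ++ a ∷ R′) ≡ 0
    before L₁ b R₁ refl = vanish L₁ b (≤⇒≯ (subst (length L₁ ≤_) (sym (length-++ L₁)) (m≤m+n _ _)))
    after : ∀ M b N → R′ ≡ M ++ b ∷ N → f (L ++ a ∷ M) b N ≡ ind (meshᵇ (boxes R) L a M b N)
    after M b N refl rewrite eq = cong ind (meshAt≡meshᵇ {R = R} (subst (IsPerm n) eq perm))

distribution : Boxes → ℕ → ℕ → ℕ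
distribution box n k = length (filterᵇ (λ w → occurrences box w ≡ᵇ k) (words n))

length-filterᵇ-map : ∀ {A B : Set} (p : B → Bool) (f : A → B) xs → length (filterᵇ p (map f xs)) ≡ length (filterᵇ (p ∘ f) xs)
length-filterᵇ-map p f xs = trans (length-filterᵇ p (map f xs))
  (trans (cong sum (sym (map-∘ xs))) (sym (length-filterᵇ (p ∘ f) xs)))

s≡distribution : ∀ R n k → s R n k ≡ distribution (boxes R) n k
s≡distribution R n k = trans
  (cong length (filterᵇ-cong (Perms n) (λ π∈ → cong (_≡ᵇ k) (occ≡occurrences R π∈))))
  (sym (length-filterᵇ-map _ word (Perms n)))

-- Ranking occurrences, and inserting a block of values

-- Counts the contributing cuts to the left of the given one, or to its right. The direction is the
-- one in which the letters of σ lie as seen from the block: on its left if the block stands just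
-- before the marker, on its right if it stands at the front.
rank : Bool → (List ℕ → ℕ → List ℕ → ℕ) → List ℕ → ℕ → List ℕ → ℕ
rank true  f L a M = cutSum (λ L₁ b R₁ → f L₁ b (R₁ ++ a ∷ M)) L
rank false f L a M = cutSum (λ M₁ → f (L ++ a ∷ M₁)) M

-- Each cut contributes at most one, so the running count skips no value below the total.
exists-rank : ∀ α {f k} w → (∀ L a M → f L a M ≤ 1) → k < cutSum f w →
  ∃ λ L → ∃₂ λ a M → w ≡ L ++ a ∷ M × f L a M ≡ 1 × rank α f L a M ≡ k
exists-rank true {f} {k} (x ∷ w) f≤1 k< with f [] x w in eq | f≤1 [] x w
... | 0 | _ = let L , a , M , e , v , r = exists-rank true w (λ L → f≤1 (x ∷ L)) k<
              in x ∷ L , a , M , cong (x ∷_) e , v , cong₂ _+_ (trans (cong (f [] x) (sym e)) eq) r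
... | suc (suc _) | s≤s ()
... | 1 | _ with k
... | 0     = [] , x , w , refl , eq , refl
... | suc k = let L , a , M , e , v , r = exists-rank true w (λ L → f≤1 (x ∷ L)) (s≤s⁻¹ k<)
              in x ∷ L , a , M , cong (x ∷_) e , v , cong₂ _+_ (trans (cong (f [] x) (sym e)) eq) r
exists-rank false {f} {k} (x ∷ w) f≤1 k< with k <? cutSum (λ L → f (x ∷ L)) w
... | yes k<′ = let L , a , M , e , v , r = exists-rank false w (λ L → f≤1 (x ∷ L)) k<′
                in x ∷ L , a , M , cong (x ∷_) e , v , r
... | no k≮ with f [] x w in eq | f≤1 [] x w
... | 0 | _ = contradiction k< k≮
... | suc (suc _) | s≤s ()
... | 1 | _ = [] , x , w , refl , eq , ≤-antisym (≮⇒≥ k≮) (s≤s⁻¹ k<)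

rank-< : ∀ α f L a M → f L a M ≡ 1 → rank α f L a M < cutSum f (L ++ a ∷ M)
rank-< true f L a M v = begin-strict
  rank true f L a M                                ≡⟨ +-identityʳ _ ⟨
  rank true f L a M + 0                            <⟨ +-monoʳ-< (rank true f L a M) (s≤s z≤n) ⟩
  rank true f L a M + (1 + rank false f L a M)     ≡⟨ cong (λ t → rank true f L a M + (t + rank false f L a M)) (trans (cong (λ t → f t a M) (++-identityʳ L)) v) ⟨
  rank true f L a M + (f (L ++ []) a M + rank false f L a M) ≡⟨ cutSum-++ f L (a ∷ M) ⟨
  cutSum f (L ++ a ∷ M)                            ∎
  where open ≤-Reasoning
rank-< false f L a M v = begin-strict
  rank false f L a M                               <⟨ n<1+n _ ⟩
  1 + rank false f L a M                           ≡⟨ cong (_+ rank false f L a M) (trans (cong (λ t → f t a M) (++-identityʳ L)) v) ⟨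
  f (L ++ []) a M + rank false f L a M             ≤⟨ m≤n+m _ (rank true f L a M) ⟩
  rank true f L a M + (f (L ++ []) a M + rank false f L a M) ≡⟨ cutSum-++ f L (a ∷ M) ⟨
  cutSum f (L ++ a ∷ M)                            ∎
  where open ≤-Reasoning

-- The running count increases strictly at every contributing cut, so no two of them share a rank.
rank-unique : ∀ α f L {a M} L′ {a′ M′} → L ++ a ∷ M ≡ L′ ++ a′ ∷ M′ → f L a M ≡ 1 → f L′ a′ M′ ≡ 1 →
  rank α f L a M ≡ rank α f L′ a′ M′ → L ≡ L′
rank-unique α     f []      []       _ _ _ _ = refl
rank-unique true  f []      (y ∷ L′) eq v _ r with ∷-injective eq
... | refl , refl rewrite v = contradiction r λ ()
rank-unique true  f (x ∷ L) []       eq _ v r with ∷-injective eq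
... | refl , refl rewrite v = contradiction r λ ()
rank-unique true  f (x ∷ L) {a} {M} (y ∷ L′) {a′} {M′} eq v v′ r with ∷-injective eq
... | refl , eq′ = cong (x ∷_) (rank-unique true (λ L → f (x ∷ L)) L L′ eq′ v v′
        (+-cancelˡ-≡ (f [] x (L ++ a ∷ M)) _ _ (trans r (cong (λ t → f [] x t + rank true (λ L → f (x ∷ L)) L′ a′ M′) (sym eq′)))))
rank-unique false f [] (y ∷ L′) {a′} {M′} eq _ v r with ∷-injective eq
... | refl , refl = contradiction (rank-< false (λ L → f (y ∷ L)) L′ a′ M′ v) (<-irrefl (sym r))
rank-unique false f (x ∷ L) {a} {M} [] eq v _ r with ∷-injective eq
... | refl , refl = contradiction (rank-< false (λ L → f (x ∷ L)) L a M v) (<-irrefl r)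
rank-unique false f (x ∷ L) (y ∷ L′) eq v v′ r with ∷-injective eq
... | refl , eq′ = cong (x ∷_) (rank-unique false (λ L → f (x ∷ L)) L L′ eq′ v v′ r)

-- Pigeonhole: a missing value put in front of `w` would give `suc n` distinct numbers below `n`.
perm-surjective : ∀ {n w v} → IsPerm n w → v < n → v ∈ w
perm-surjective {n} {w} {v} perm v<n with Any.any? (v ≟_) w
... | yes v∈ = v∈
... | no  v∉ = contradiction
  (subst₂ _≤_ (cong suc (len perm)) (length-upTo n)
    (length-≤-by _≡_ (All.tabulate (λ {x} x∈ v≡x → v∉ (subst (_∈ w) (sym v≡x) x∈)) ∷ distinct perm)
      (λ { (here refl) → v , ∈-upTo⁺ v<n , refl ; {x} (there x∈) → x , ∈-upTo⁺ (All.lookup (bounded perm) x∈) , refl })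
      (λ _ _ → λ { refl refl → refl })))
  (<-irrefl refl)

-- Serves to read off the size of a block from the values it occupies. The translation by `lo`
-- matches the letters with the numbers below `m`, in both directions.
interval-length : ∀ {lo m w} → Unique w → All (λ v → lo ≤ v × v < lo + m) w → (∀ v → v < m → lo + v ∈ w) → length w ≡ m
interval-length {lo} {m} {w} uniq inside covers = ≤-antisym
  (subst (length w ≤_) (length-upTo m) (length-≤-by (λ x y → x ≡ lo + y) uniq
    (λ {x} x∈ → let lo≤x , x< = All.lookup inside x∈ in
       x ∸ lo , ∈-upTo⁺ (+-cancelˡ-< lo _ _ (subst (_< lo + m) (sym (m+[n∸m]≡n lo≤x)) x<)) , sym (m+[n∸m]≡n lo≤x))
    (λ _ _ e e′ → trans e (sym e′))))
  (subst (_≤ length w) (length-upTo m) (length-≤-by (λ y x → x ≡ lo + y) (Uniqueₚ.upTo⁺ m)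
    (λ {y} y∈ → lo + y , covers y (∈-upTo⁻ y∈) , refl)
    (λ _ _ e e′ → +-cancelˡ-≡ lo _ _ (trans (sym e) e′))))

-- The increasing map that opens a gap of `m` values at `V`; `Outside V m` describes its image.
lift : ℕ → ℕ → ℕ → ℕ
lift V m v = if v <ᵇ V then v else m + v

data Lift (V m v : ℕ) : ℕ → Set where
  low  : v < V → Lift V m v v
  high : V ≤ v → Lift V m v (m + v)

liftView : ∀ V m v → Lift V m v (lift V m v)
liftView V m v with v <ᵇ V in eq
... | true  = low (<ᵇ⇒< v V (subst T (sym eq) _))
... | false = high (≮⇒≥ λ lt → subst T eq (<⇒<ᵇ lt))

lift-mono-< : ∀ V m {u v} → u < v → lift V m u < lift V m v
lift-mono-< V m {u} {v} u<v with lift V m u | liftView V m u | lift V m v | liftView V m v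
... | _ | low _  | _ | low _  = u<v
... | _ | low _  | _ | high _ = <-≤-trans u<v (m≤n+m v m)
... | _ | high p | _ | low q  = contradiction (<-trans u<v q) (≤⇒≯ p)
... | _ | high _ | _ | high _ = +-monoʳ-< m u<v

lift-mono-≤ : ∀ V m {u v} → u ≤ v → lift V m u ≤ lift V m v
lift-mono-≤ V m u≤v with m≤n⇒m<n∨m≡n u≤v
... | inj₁ u<v  = <⇒≤ (lift-mono-< V m u<v)
... | inj₂ refl = ≤-refl

lift-cancel-< : ∀ V m {u v} → lift V m u < lift V m v → u < v
lift-cancel-< V m lt = ≰⇒> λ v≤u → contradiction (lift-mono-≤ V m v≤u) (<⇒≱ lt)

lift-injective : ∀ V m {u v} → lift V m u ≡ lift V m v → u ≡ v
lift-injective V m eq = ≤-antisym (≮⇒≥ λ lt → <-irrefl (sym eq) (lift-mono-< V m lt))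
                                  (≮⇒≥ λ lt → <-irrefl eq (lift-mono-< V m lt))

-- Rows depend on such comparisons alone. Hence inserting values does not move the remaining letters
-- to other boxes.
lift-<ᵇ : ∀ V m u v → (lift V m u <ᵇ lift V m v) ≡ (u <ᵇ v)
lift-<ᵇ V m u v = T-ext (λ t → <⇒<ᵇ (lift-cancel-< V m (<ᵇ⇒< _ _ t))) (λ t → <⇒<ᵇ (lift-mono-< V m (<ᵇ⇒< _ _ t)))

row-lift : ∀ V m a b y → row (lift V m a) (lift V m b) (lift V m y) ≡ row a b y
row-lift V m a b y = cong₂ (λ p q → if p then 0 else if q then 1 else 2) (lift-<ᵇ V m y a) (lift-<ᵇ V m y b)

Outside : ℕ → ℕ → ℕ → Set
Outside V m v = v < V ⊎ V + m ≤ v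

unlift : ℕ → ℕ → ℕ → ℕ
unlift V m v = if v <ᵇ V then v else v ∸ m

lift-unlift : ∀ {V m v} → Outside V m v → lift V m (unlift V m v) ≡ v
lift-unlift {V} {m} {v} (inj₁ v<V) rewrite T⇒≡ (<⇒<ᵇ v<V) | T⇒≡ (<⇒<ᵇ v<V) = refl
lift-unlift {V} {m} {v} (inj₂ V+m≤v)
  rewrite ¬T⇒≡ {v <ᵇ V} (λ t → ≤⇒≯ (≤-trans (m≤m+n V m) V+m≤v) (<ᵇ⇒< v V t))
        | ¬T⇒≡ {v ∸ m <ᵇ V} (λ t → ≤⇒≯ (subst (_≤ v ∸ m) (m+n∸n≡m V m) (∸-monoˡ-≤ m V+m≤v)) (<ᵇ⇒< _ V t))
  = m+[n∸m]≡n (≤-trans (m≤n+m m V) V+m≤v)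

lift-outside : ∀ V m v → Outside V m (lift V m v)
lift-outside V m v with lift V m v | liftView V m v
... | _ | low p  = inj₁ p
... | _ | high p = inj₂ (subst (V + m ≤_) (+-comm v m) (+-monoˡ-≤ m p))

-- Being a permutation does not depend on the order of the letters, so the block stands in front
-- here whatever its true place; `glue-↭` makes up the difference. With the block `0 ∷ []` the same
-- operation prepends a single letter, as in the count of all permutations.
inflate : ℕ → ℕ → List ℕ → List ℕ → List ℕ
inflate V m block σ = map (V +_) block ++ map (lift V m) σ

inflate-perm : ∀ {V m j block σ} → V ≤ j → IsPerm m block → IsPerm j σ → IsPerm (m + j) (inflate V m block σ)
inflate-perm {V} {m} {j} {block} {σ} V≤j pb pσ = isPerm
  (trans (length-++ (map (V +_) block)) (cong₂ _+_ (trans (length-map _ block) (len pb)) (trans (length-map _ σ) (len pσ))))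
  (Allₚ.++⁺ (Allₚ.map⁺ (All.map (λ {x} x<m → subst (V + x <_) (+-comm j m) (+-mono-≤-< V≤j x<m)) (bounded pb)))
            (Allₚ.map⁺ (All.map lift-< (bounded pσ))))
  (Uniqueₚ.++⁺ (Uniqueₚ.map⁺ (+-cancelˡ-≡ V _ _) (distinct pb)) (Uniqueₚ.map⁺ (lift-injective V m) (distinct pσ)) disjoint)
  where
  lift-< : ∀ {v} → v < j → lift V m v < m + j
  lift-< {v} v<j with lift V m v | liftView V m v
  ... | _ | low _  = <-≤-trans v<j (m≤n+m j m)
  ... | _ | high _ = +-monoʳ-< m v<j
  disjoint : ∀ {v} → ¬ (v ∈ map (V +_) block × v ∈ map (lift V m) σ)
  disjoint (p , q) with ∈-map⁻ _ p | ∈-map⁻ _ q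
  ... | x , x∈ , refl | y , y∈ , eq with lift-outside V m y
  ... | inj₁ lt = contradiction (subst (_< V) (sym eq) lt) (≤⇒≯ (m≤m+n V x))
  ... | inj₂ ge = contradiction (subst (V + m ≤_) (sym eq) ge) (<⇒≱ (+-monoʳ-< V (All.lookup (bounded pb) x∈)))

Unique-++ˡ : ∀ (xs : List A) {ys} → Unique (xs ++ ys) → Unique xs
Unique-++ˡ []       _       = []
Unique-++ˡ (x ∷ xs) (p ∷ u) = Allₚ.++⁻ˡ xs p ∷ Unique-++ˡ xs u

Unique-++ʳ : ∀ (xs : List A) {ys} → Unique (xs ++ ys) → Unique ys
Unique-++ʳ []       u       = u
Unique-++ʳ (x ∷ xs) (_ ∷ u) = Unique-++ʳ xs u

inflate-perm⁻ : ∀ {V m j block σ} → V ≤ j → length block ≡ m → All (_< m) block →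
  IsPerm (m + j) (inflate V m block σ) → IsPerm m block × IsPerm j σ
inflate-perm⁻ {V} {m} {j} {block} {σ} V≤j refl block<m perm =
  isPerm refl block<m (Uniqueₚ.map⁻ (Unique-++ˡ (map (V +_) block) (distinct perm))) ,
  isPerm (+-cancelˡ-≡ m _ _ (trans (sym (trans (length-++ (map (V +_) block)) (cong₂ _+_ (length-map _ block) (length-map _ σ)))) (len perm)))
         (All.map lift-<⁻ (Allₚ.map⁻ (Allₚ.++⁻ʳ (map (V +_) block) (bounded perm))))
         (Uniqueₚ.map⁻ (Unique-++ʳ (map (V +_) block) (distinct perm)))
  where
  lift-<⁻ : ∀ {v} → lift V m v < m + j → v < j
  lift-<⁻ {v} lt with lift V m v | liftView V m v
  ... | _ | low p  = <-≤-trans p V≤j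
  ... | _ | high _ = +-cancelˡ-< m _ _ lt

IsPerm-resp-↭ : ∀ {n w w′} → w ↭ w′ → IsPerm n w → IsPerm n w′
IsPerm-resp-↭ p (isPerm l b u) = isPerm (trans (sym (↭-length p)) l) (All-resp-↭ p b) (↭ₛ.Unique-resp-↭ (↭⇒↭ₛ p) u)

-- The shadings up to reverse-complement

data Marker : Set where
  atMax atEnd : Marker

Marked : Marker → List ℕ → ℕ → List ℕ → Set
Marked atMax W d N = All (_< d) W × All (_< d) N
Marked atEnd W d N = N ≡ []

-- A shaded top row forces `b` to be the maximum, a shaded right column forces it to be the last
-- letter.
unmarked : Marker → ℕ → ℕ → Bool
unmarked atMax c r = not (r ≡ᵇ 2)
unmarked atEnd c r = not (c ≡ᵇ 2)

index : Bool → ℕ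
index true  = 1
index false = 0

-- Box (index α , index β) is the only free one in its column and its row; the upper point b of an
-- occurrence is the maximum, respectively the last letter, of the whole permutation.
allowed : Bool → Bool → Marker → Boxes
allowed α β mk c r = not ((c ≡ᵇ index α) xor (r ≡ᵇ index β)) ∧ unmarked mk c r

-- The free box lies in column 1 or in column 0 according to `α`. Exchanging the lists to the left
-- and right of `a` accordingly lets both cases share one statement.
pick : Bool → A → A → A
pick true  x y = x
pick false x y = y

Zone : Bool → ℕ → ℕ → ℕ → Set
Zone β a b y = T (row a b y ≡ᵇ index β)

-- By the exclusive or in `allowed`, a letter lies in the free column exactly when it lies in the
-- row of the free box. So `a` and the letters inside fill an interval of positions and an interval
-- of values.
record Split (α β : Bool) (mk : Marker) (L : List ℕ) (a : ℕ) (M : List ℕ) (b : ℕ) (N : List ℕ) : Set where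
  constructor split
  field
    a<b      : a < b
    marked   : Marked mk (L ++ a ∷ M) b N
    inside   : All (Zone β a b) (pick α M L)
    outside  : All (¬_ ∘ Zone β a b) (pick α L M)
    outsideN : All (¬_ ∘ Zone β a b) N

allowed-inside⁻ : ∀ α β mk {r} → T (allowed α β mk (index α) r) → T (r ≡ᵇ index β)
allowed-inside⁻ true  true  mk {1}           _ = _
allowed-inside⁻ true  false mk {0}           _ = _
allowed-inside⁻ false true  mk {1}           _ = _
allowed-inside⁻ false false mk {0}           _ = _

allowed-inside⁺ : ∀ α β mk {r} → T (r ≡ᵇ index β) → T (allowed α β mk (index α) r)
allowed-inside⁺ α β mk {r} t rewrite ≡ᵇ⇒≡ r (index β) t = corner-free α β mk
  where
  corner-free : ∀ α β mk → T (allowed α β mk (index α) (index β))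
  corner-free true  true  atMax = _
  corner-free true  true  atEnd = _
  corner-free true  false atMax = _
  corner-free true  false atEnd = _
  corner-free false true  atMax = _
  corner-free false true  atEnd = _
  corner-free false false atMax = _
  corner-free false false atEnd = _

allowed-outside⁻ : ∀ α β mk {c r} → (c ≡ᵇ index α) ≡ false → T (allowed α β mk c r) → ¬ T (r ≡ᵇ index β)
allowed-outside⁻ α β mk {c} {r} c≢ t t′ rewrite c≢ | T⇒≡ t′ = t

allowed-outside⁺ : ∀ α β mk {c r} → (c ≡ᵇ index α) ≡ false → ¬ T (r ≡ᵇ index β) → T (unmarked mk c r) → T (allowed α β mk c r)
allowed-outside⁺ α β mk {c} {r} c≢ ¬t u rewrite c≢ | ¬T⇒≡ ¬t = u

allowed⇒unmarked : ∀ α β mk {c r} → T (allowed α β mk c r) → T (unmarked mk c r)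
allowed⇒unmarked α β mk {c} {r} t = proj₂ (Equivalence.to (T-∧ {not ((c ≡ᵇ index α) xor (r ≡ᵇ index β))}) t)

notTop⁻ : ∀ {a b y} → a < b → T (not (row a b y ≡ᵇ 2)) → y < b
notTop⁻ {a} {b} {y} a<b t with row a b y | rowView a b y
... | _ | below p     = <-trans p a<b
... | _ | between _ p = p

notTop⁺ : ∀ {a b y} → y < b → T (not (row a b y ≡ᵇ 2))
notTop⁺ {a} {b} {y} y<b with row a b y | rowView a b y
... | _ | below _     = _
... | _ | between _ _ = _
... | _ | above _ q   = contradiction y<b (≤⇒≯ q)

mesh⇒marked : ∀ {α β mk L a M b N} → Mesh (allowed α β mk) L a M b N → Marked mk (L ++ a ∷ M) b N
mesh⇒marked {α} {β} {atMax} {L} {a} {M} {b} {N} (mesh a<b p q r) =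
  Allₚ.++⁺ (All.map (λ {y} t → bound 0 y t) p) (a<b ∷ All.map (λ {y} t → bound 1 y t) q) , All.map (λ {y} t → bound 2 y t) r
  where
  bound : ∀ c y → T (allowed α β atMax c (row a b y)) → y < b
  bound c y t = notTop⁻ {a} {b} {y} a<b (allowed⇒unmarked α β atMax {c} {row a b y} t)
mesh⇒marked {mk = atEnd} {N = []} _ = refl
mesh⇒marked {α} {β} {atEnd} {a = a} {b = b} {N = y ∷ N} (mesh _ _ _ (t ∷ _)) =
  ⊥-elim (allowed⇒unmarked α β atEnd {2} {row a b y} t)

mesh⇒split : ∀ {α β mk L a M b N} → Mesh (allowed α β mk) L a M b N → Split α β mk L a M b N
mesh⇒split {true} {β} {mk} {a = a} {b = b} m@(mesh a<b p q r) = split a<b (mesh⇒marked m)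
  (All.map (λ {y} → allowed-inside⁻ true β mk {row a b y}) q)
  (All.map (λ {y} → allowed-outside⁻ true β mk {0} {row a b y} refl) p)
  (All.map (λ {y} → allowed-outside⁻ true β mk {2} {row a b y} refl) r)
mesh⇒split {false} {β} {mk} {a = a} {b = b} m@(mesh a<b p q r) = split a<b (mesh⇒marked m)
  (All.map (λ {y} → allowed-inside⁻ false β mk {row a b y}) p)
  (All.map (λ {y} → allowed-outside⁻ false β mk {1} {row a b y} refl) q)
  (All.map (λ {y} → allowed-outside⁻ false β mk {2} {row a b y} refl) r)

unmarked-row : ∀ mk c {W b N a y} → Marked mk W b N → (c ≢ 2 × y ∈ W) ⊎ y ∈ N → T (unmarked mk c (row a b y))
unmarked-row atMax c {b = b} {a = a} {y} (bW , _) (inj₁ (_ , y∈)) = notTop⁺ {a} {b} {y} (All.lookup bW y∈)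
unmarked-row atMax c {b = b} {a = a} {y} (_ , bN) (inj₂ y∈)       = notTop⁺ {a} {b} {y} (All.lookup bN y∈)
unmarked-row atEnd c refl (inj₁ (c≢2 , _)) = T-not⁺ (λ t → c≢2 (≡ᵇ⇒≡ c 2 t))

split⇒mesh : ∀ {α β mk L a M b N} → Split α β mk L a M b N → Mesh (allowed α β mk) L a M b N
split⇒mesh {true} {β} {mk} {L} {a} {M} {b} (split a<b mrk ins out outN) = mesh a<b
  (All.tabulate λ {y} y∈ → allowed-outside⁺ true β mk {0} {row a b y} refl (All.lookup out y∈)
    (unmarked-row mk 0 {a = a} mrk (inj₁ ((λ ()) , ∈-++⁺ˡ y∈))))
  (All.map (λ {y} → allowed-inside⁺ true β mk {row a b y}) ins)
  (All.tabulate λ {y} y∈ → allowed-outside⁺ true β mk {2} {row a b y} refl (All.lookup outN y∈)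
    (unmarked-row mk 2 {a = a} mrk (inj₂ y∈)))
split⇒mesh {false} {β} {mk} {L} {a} {M} {b} (split a<b mrk ins out outN) = mesh a<b
  (All.map (λ {y} → allowed-inside⁺ false β mk {row a b y}) ins)
  (All.tabulate λ {y} y∈ → allowed-outside⁺ false β mk {1} {row a b y} refl (All.lookup out y∈)
    (unmarked-row mk 1 {a = a} mrk (inj₁ ((λ ()) , ∈-++⁺ʳ L (there y∈)))))
  (All.tabulate λ {y} y∈ → allowed-outside⁺ false β mk {2} {row a b y} refl (All.lookup outN y∈)
    (unmarked-row mk 2 {a = a} mrk (inj₂ y∈)))

-- The marker, and the reduction of occurrences to their lower points

Marked-unique : ∀ mk {W d N W′ d′ N′} → Marked mk W d N → Marked mk W′ d′ N′ → W ++ d ∷ N ≡ W′ ++ d′ ∷ N′ → W ≡ W′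
Marked-unique atEnd {W} {W′ = W′} refl refl eq = ∷ʳ-injectiveˡ W W′ eq
Marked-unique atMax {W} {d} {N} {W′} {d′} {N′} (bW , bN) (bW′ , bN′) eq with cut-split W W′ eq
... | inj₁ (d∈ , _) = contradiction (All.lookup bW′ d∈) (≤⇒≯ d′≤d)
  where
  d′≤d : d′ ≤ d
  d′≤d = All.lookup (Allₚ.++⁺ (All.map <⇒≤ bW) (≤-refl ∷ All.map <⇒≤ bN)) (subst (d′ ∈_) (sym eq) (∈-insert W′))
... | inj₂ ([]    , e    , _)  = trans e (++-identityʳ W′)
... | inj₂ (x ∷ L₂ , refl , e) with ∷-injective e
... | refl , refl = contradiction (All.lookup bW (∈-insert W′)) (≤⇒≯ (<⇒≤ (All.lookup bN′ (∈-insert L₂))))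

Marked-exists : ∀ mk x w → Unique (x ∷ w) → ∃ λ W → ∃₂ λ d N → x ∷ w ≡ W ++ d ∷ N × Marked mk W d N
Marked-exists atEnd x []      _       = [] , x , [] , refl , refl
Marked-exists atEnd x (y ∷ w) (_ ∷ u) with Marked-exists atEnd y w u
... | W , d , N , eq , mrk = x ∷ W , d , N , cong (x ∷_) eq , mrk
Marked-exists atMax x []      _              = [] , x , [] , refl , [] , []
Marked-exists atMax x (y ∷ w) ((x≢y ∷ x∉) ∷ u) with Marked-exists atMax y w u
... | W , d , N , eq , bW , bN with <-cmp x d
... | tri< x<d _ _ = x ∷ W , d , N , cong (x ∷_) eq , x<d ∷ bW , bN
... | tri≈ _ x≡d _ = contradiction x≡d (All.lookup (x≢y ∷ x∉) (subst (d ∈_) (sym eq) (∈-insert W)))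
... | tri> _ _ d<x = [] , x , y ∷ w , refl , [] ,
  subst (All (_< x)) (sym eq) (Allₚ.++⁺ (All.map (λ p → <-trans p d<x) bW) (d<x ∷ All.map (λ p → <-trans p d<x) bN))

ind-false : ∀ {b} → ¬ T b → ind b ≡ 0
ind-false ¬t = cong ind (¬T⇒≡ ¬t)

ind-true : ∀ {b} → ind b ≢ 0 → T b
ind-true {true}  _  = _
ind-true {false} ≢0 = ≢0 refl

++-∷-≢ : ∀ (xs : List ℕ) {y ys} → xs ++ y ∷ ys ≢ xs
++-∷-≢ xs eq = m+1+n≢m (length xs) (trans (sym (length-++ xs)) (cong length eq))

cutSum-single : ∀ f M {b N} →
  (∀ M′ {b′ N′} → M′ ++ b′ ∷ N′ ≡ M ++ b ∷ N → f M′ b′ N′ ≢ 0 → M′ ≡ M) → cutSum f (M ++ b ∷ N) ≡ f M b N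
cutSum-single f M {b} {N} only = begin
  cutSum f (M ++ b ∷ N)
    ≡⟨ cutSum-++ f M (b ∷ N) ⟩
  cutSum (λ M₁ c M₂ → f M₁ c (M₂ ++ b ∷ N)) M + (f (M ++ []) b N + cutSum (λ N₁ → f (M ++ b ∷ N₁)) N)
    ≡⟨ cong₂ _+_ (cutSum-zero M early) (cong₂ _+_ (cong (λ t → f t b N) (++-identityʳ M)) (cutSum-zero N late)) ⟩
  f M b N + 0
    ≡⟨ +-identityʳ _ ⟩
  f M b N ∎
  where
  open ≡-Reasoning
  vanish : ∀ M′ {b′ N′} → M′ ++ b′ ∷ N′ ≡ M ++ b ∷ N → M′ ≢ M → f M′ b′ N′ ≡ 0
  vanish M′ {b′} {N′} eq ne with f M′ b′ N′ ≟ 0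
  ... | yes z = z
  ... | no ≢0 = contradiction (only M′ eq ≢0) ne
  early : ∀ M₁ c M₂ → M ≡ M₁ ++ c ∷ M₂ → f M₁ c (M₂ ++ b ∷ N) ≡ 0
  early M₁ c M₂ refl = vanish M₁ (sym (++-assoc M₁ (c ∷ M₂) (b ∷ N))) (++-∷-≢ M₁ ∘ sym)
  late : ∀ N₁ c N₂ → N ≡ N₁ ++ c ∷ N₂ → f (M ++ b ∷ N₁) c N₂ ≡ 0
  late N₁ c N₂ refl = vanish (M ++ b ∷ N₁) (++-assoc M (b ∷ N₁) (c ∷ N₂)) (++-∷-≢ M)

meshes : Boxes → ℕ → List ℕ → List ℕ → ℕ → List ℕ → ℕ
meshes box d N L a M = ind (meshᵇ box L a M d N)

-- The upper point of every occurrence is the one marked letter of the word, and the lower point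
-- precedes it; the double sum collapses to a sum over `W`.
occurrences-marked : ∀ α β mk {W d N} → Marked mk W d N →
  occurrences (allowed α β mk) (W ++ d ∷ N) ≡ cutSum (meshes (allowed α β mk) d N) W
occurrences-marked α β mk {W} {d} {N} mrk = begin
  occurrences S (W ++ d ∷ N)
    ≡⟨ cutSum-++ (starts S) W (d ∷ N) ⟩
  cutSum (λ L a M → starts S L a (M ++ d ∷ N)) W + cutSum (λ L → starts S (W ++ L)) (d ∷ N)
    ≡⟨ cong₂ _+_ (cutSum-cong W before) (cutSum-zero (d ∷ N) after) ⟩
  cutSum (meshes S d N) W + 0
    ≡⟨ +-identityʳ _ ⟩
  cutSum (meshes S d N) W ∎
  where
  open ≡-Reasoning
  S = allowed α β mk
  at-marker : ∀ {L a M b N′} → L ++ a ∷ M ++ b ∷ N′ ≡ W ++ d ∷ N → T (meshᵇ S L a M b N′) → L ++ a ∷ M ≡ W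
  at-marker {L} {a} {M} {b} {N′} eq t =
    Marked-unique mk (mesh⇒marked {α} (mesh⁻ {S} t)) mrk (trans (++-assoc L (a ∷ M) (b ∷ N′)) eq)
  longer : ∀ (xs L : List ℕ) {y ys} → xs ++ L ++ y ∷ ys ≢ xs
  longer xs []      = ++-∷-≢ xs
  longer xs (_ ∷ L) = ++-∷-≢ xs
  before : ∀ L a M → W ≡ L ++ a ∷ M → starts S L a (M ++ d ∷ N) ≡ meshes S d N L a M
  before L a M refl = cutSum-single (λ M b N → meshes S b N L a M) M λ M′ {b′} {N′} eq ≢0 →
    ∷-injectiveʳ (++-cancelˡ L _ _ (at-marker {L} {a} {M′} {b′} {N′}
      (trans (cong (λ t → L ++ a ∷ t) eq) (sym (++-assoc L (a ∷ M) (d ∷ N)))) (ind-true ≢0)))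
  after : ∀ L a R → d ∷ N ≡ L ++ a ∷ R → starts S (W ++ L) a R ≡ 0
  after L a R eq = cutSum-zero R λ M b N′ e → ind-false λ t → longer W L (trans (sym (++-assoc W L (a ∷ M)))
    (at-marker {W ++ L} {a} {M} (trans (++-assoc W L _) (cong (W ++_) (trans (cong (λ t → L ++ a ∷ t) (sym e)) (sym eq)))) t))

-- Inserting a block into a permutation

-- The block is inserted just before the letter d, or at the very front if α fails, and just below
-- the value d, or at the very bottom if β fails.
base : Bool → ℕ → ℕ
base true  d = d
base false d = 0

-- The value of `a` relative to its block. If the free box lies in row 1, the rest of the block is
-- above `a`, which is then lowest; if in row 0, the rest is below and `a` is highest.
pivot : Bool → ℕ → ℕ
pivot true  m = 0
pivot false m = m

shell : Bool → ℕ → ℕ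
shell true  r = suc r
shell false r = r

core : Bool → List ℕ → List ℕ
core β ρ = pivot β (length ρ) ∷ map (shell β) ρ

-- In position, `a` opens the block if `α` holds and closes it otherwise, since the other letters of
-- the block must lie in column 1 or in column 0.
glue : Bool → Bool → List ℕ → ℕ → List ℕ → List ℕ → List ℕ
glue α β L d N ρ = pick α σL block ++ a ∷ pick α block σL ++ lift V m d ∷ map (lift V m) N
  where
  V = base β d
  m = suc (length ρ)
  a = V + pivot β (length ρ)
  block = map (V +_) (map (shell β) ρ)
  σL = map (lift V m) L

front-↭ : ∀ α (X block : List A) a Y → pick α X block ++ a ∷ pick α block X ++ Y ↭ (a ∷ block) ++ X ++ Y
front-↭ true  X block a Y = shifts X (a ∷ block)
front-↭ false X block a Y = shift a block (X ++ Y)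

core-perm : ∀ β {i ρ} → IsPerm i ρ → IsPerm (suc i) (core β ρ)
core-perm true  {ρ = ρ} (isPerm refl b u) = isPerm (cong suc (length-map suc ρ))
  (s≤s z≤n ∷ Allₚ.map⁺ (All.map s≤s b))
  (Allₚ.map⁺ (All.tabulate λ _ ()) ∷ Uniqueₚ.map⁺ suc-injective u)
core-perm false {ρ = ρ} (isPerm refl b u) rewrite map-id ρ =
  isPerm refl (n<1+n _ ∷ All.map m<n⇒m<1+n b) (All.map (λ lt eq → <-irrefl (sym eq) lt) b ∷ u)

core-perm⁻ : ∀ β {i ρ} → length ρ ≡ i → IsPerm (suc i) (core β ρ) → IsPerm i ρ
core-perm⁻ true  {ρ = ρ} refl (isPerm l (_ ∷ b) (_ ∷ u)) = isPerm refl (All.map s≤s⁻¹ (Allₚ.map⁻ b)) (Uniqueₚ.map⁻ u)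
core-perm⁻ false {ρ = ρ} refl (isPerm l (_ ∷ b) (p ∷ u)) rewrite map-id ρ = isPerm refl
  (All.tabulate λ {x} x∈ → ≤∧≢⇒< (s≤s⁻¹ (All.lookup b x∈)) (λ e → All.lookup p x∈ (sym e))) u

base≤ : ∀ β d → base β d ≤ d
base≤ true  d = ≤-refl
base≤ false d = z≤n

glue-↭ : ∀ α β L d N ρ →
  glue α β L d N ρ ↭ inflate (base β d) (suc (length ρ)) (core β ρ) (L ++ d ∷ N)
glue-↭ α β L d N ρ rewrite map-++ (lift (base β d) (suc (length ρ))) L (d ∷ N) = front-↭ α _ _ _ _

glue-perm : ∀ α β {L d N ρ i j} → IsPerm j (L ++ d ∷ N) → IsPerm i ρ → IsPerm (suc i + j) (glue α β L d N ρ)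
glue-perm α β {L} {d} {N} {ρ} pσ pρ@(isPerm refl _ _) = IsPerm-resp-↭ (↭-sym (glue-↭ α β L d N ρ))
  (inflate-perm (≤-trans (base≤ β d) (<⇒≤ (All.lookup (bounded pσ) (∈-insert L)))) (core-perm β pρ) pσ)

lift-high : ∀ {V m v} → V ≤ v → lift V m v ≡ m + v
lift-high {V} {m} {v} V≤v rewrite ¬T⇒≡ {v <ᵇ V} (λ t → ≤⇒≯ V≤v (<ᵇ⇒< v V t)) = refl

lift-low : ∀ {V m v} → v < V → lift V m v ≡ v
lift-low v<V rewrite T⇒≡ (<⇒<ᵇ v<V) = refl

zone-between : ∀ {a b y} → a ≤ y → y < b → Zone true a b y
zone-between {a} {b} {y} a≤y y<b rewrite row-unique (<⇒≤ (≤-<-trans a≤y y<b)) (between a≤y y<b) = _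

zone-below : ∀ {a b y} → y < a → Zone false a b y
zone-below {a} {b} {y} y<a rewrite T⇒≡ (<⇒<ᵇ y<a) = _

zone-between⁻ : ∀ {a b y} → Zone true a b y → a ≤ y × y < b
zone-between⁻ {a} {b} {y} t with row a b y | rowView a b y
... | _ | between p q = p , q

zone-below⁻ : ∀ {a b y} → Zone false a b y → y < a
zone-below⁻ {a} {b} {y} t with row a b y | rowView a b y
... | _ | below p = p

module _ (α β : Bool) (mk : Marker) {L : List ℕ} {d : ℕ} {N ρ : List ℕ} {i j : ℕ}
         (mrk : Marked mk L d N) (pσ : IsPerm j (L ++ d ∷ N)) (pρ : IsPerm i ρ) where

  private
    V = base β d
    m = suc (length ρ)
    a = V + pivot β (length ρ)
    block = map (V +_) (map (shell β) ρ)
    σL = map (lift V m) L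
    σN = map (lift V m) N
    d↑ = lift V m d
    S = allowed α β mk

    d↑≡ : d↑ ≡ m + d
    d↑≡ = lift-high (base≤ β d)

    block<d↑ : ∀ {y} → y ∈ a ∷ block → y < d↑
    block<d↑ {y} y∈ with ∈-map⁻ (V +_) {xs = core β ρ} y∈
    ... | x , x∈ , refl = subst (V + x <_) (sym d↑≡) (subst (_< m + d) (+-comm x V)
      (+-mono-<-≤ (subst (x <_) (cong suc (sym (len pρ))) (All.lookup (bounded (core-perm β pρ)) x∈)) (base≤ β d)))

    ≢d : ∀ {y} → y ∈ L ++ N → y ≢ d
    ≢d = cut-distinct L (distinct pσ)

    block-zone : All (Zone β a d↑) block
    block-zone = All.tabulate λ {y} y∈ → zone β refl y∈
      where
      zone : ∀ β′ → β ≡ β′ → ∀ {y} → y ∈ block → Zone β a d↑ y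
      zone true  refl {y} y∈ with ∈-map⁻ (d +_) y∈
      ... | x , x∈ , refl = zone-between {a} {d↑} (+-monoʳ-≤ d z≤n) (block<d↑ (there y∈))
      zone false refl y∈ with ∈-map⁻ (0 +_) y∈
      ... | x , x∈ , refl with ∈-map⁻ (shell false) x∈
      ... | r , r∈ , refl = zone-below {length ρ} {d↑} (subst (r <_) (sym (len pρ)) (All.lookup (bounded pρ) r∈))

    rest-outside : ∀ {y} → y ∈ L ++ N → ¬ Zone β a d↑ (lift V m y)
    rest-outside {y} y∈ = outside β refl
      where
      outside : ∀ β′ → β ≡ β′ → ¬ Zone β a d↑ (lift V m y)
      outside true  refl z with zone-between⁻ {a} {d↑} {lift V m y} z
      ... | p , q = ≢d y∈ (≤-antisym (<⇒≤ (lift-cancel-< V m q))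
                      (≮⇒≥ λ y<d → <-irrefl refl (<-≤-trans (subst (_< d) (sym (lift-low {m = m} y<d)) y<d)
                         (subst (_≤ lift V m y) (+-identityʳ d) p))))
      outside false refl z = ≤⇒≯ (m≤n⇒m≤1+n (m≤m+n (length ρ) y)) (zone-below⁻ {length ρ} {d↑} z)

  -- The lifted letters of σ skip the values of the block. These values reach up to the lifted `d`,
  -- or start at 0, so no letter of σ has room left in the row of the free box.
  glue-split : Split α β mk (pick α σL block) a (pick α block σL) d↑ σN
  glue-split = split (block<d↑ (here refl)) (glued-marked mk α mrk)
    (subst (All (Zone β a d↑)) (sym (pick-block α)) block-zone)
    (subst (All (¬_ ∘ Zone β a d↑)) (sym (pick-rest α)) (Allₚ.map⁺ (All.tabulate (rest-outside ∘ ∈-++⁺ˡ))))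
    (Allₚ.map⁺ (All.tabulate (rest-outside ∘ ∈-++⁺ʳ L)))
    where
    pick-block : ∀ α → pick α (pick α block σL) (pick α σL block) ≡ block
    pick-block true  = refl
    pick-block false = refl
    pick-rest : ∀ α → pick α (pick α σL block) (pick α block σL) ≡ σL
    pick-rest true  = refl
    pick-rest false = refl
    glued-marked : ∀ mk α → Marked mk L d N → Marked mk (pick α σL block ++ a ∷ pick α block σL) d↑ σN
    glued-marked atMax α (bL , bN) = left α , Allₚ.map⁺ (All.map (lift-mono-< V m) bN)
      where
      bσ : All (_< d↑) σL
      bσ = Allₚ.map⁺ (All.map (lift-mono-< V m) bL)
      bB : All (_< d↑) block
      bB = All.tabulate (block<d↑ ∘ there)
      left : ∀ α → All (_< d↑) (pick α σL block ++ a ∷ pick α block σL)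
      left true  = Allₚ.++⁺ bσ (block<d↑ (here refl) ∷ bB)
      left false = Allₚ.++⁺ bB (block<d↑ (here refl) ∷ bσ)
    glued-marked atEnd α refl = refl

  private
    -- The nesting of occurrences in terms of values: a block just below `d` lies between any
    -- smaller `a₁` and `d`, and a block at the bottom lies below `a₁`.
    block-below : ∀ {a₁ y} → a₁ < d → y ∈ a ∷ block → Zone β (lift V m a₁) d↑ y
    block-below {a₁} {y} a₁<d y∈ = zone β refl
      where
      zone : ∀ β′ → β ≡ β′ → Zone β (lift V m a₁) d↑ y
      zone true refl = zone-between {lift V m a₁} {d↑} {y}
        (≤-trans (≤-reflexive (lift-low {m = m} a₁<d)) (≤-trans (<⇒≤ a₁<d) (d≤ (∈-map⁻ (d +_) {xs = core true ρ} y∈))))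
        (block<d↑ y∈)
        where
        d≤ : (∃ λ x → x ∈ core true ρ × y ≡ d + x) → d ≤ y
        d≤ (x , _ , refl) = m≤m+n d x
      zone false refl = zone-below {lift 0 m a₁} {d↑} {y} (<-≤-trans (y<m (∈-map⁻ (0 +_) {xs = core false ρ} y∈)) (m≤m+n m a₁))
        where
        y<m : (∃ λ x → x ∈ core false ρ × y ≡ x) → y < m
        y<m (x , x∈ , refl) = subst (x <_) (cong suc (sym (len pρ))) (All.lookup (bounded (core-perm false pρ)) x∈)

    All-lift : ∀ {box : ℕ → Bool} {a₁ W} → All (λ y → T (box (row a₁ d y))) W →
      All (λ y → T (box (row (lift V m a₁) d↑ y))) (map (lift V m) W)
    All-lift {box} {a₁} = Allₚ.map⁺ ∘ All.map (λ {y} → subst (T ∘ box) (sym (row-lift V m a₁ d y)))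

    All-lift⁻ : ∀ {box : ℕ → Bool} {a₁ W} → All (λ y → T (box (row (lift V m a₁) d↑ y))) (map (lift V m) W) →
      All (λ y → T (box (row a₁ d y))) W
    All-lift⁻ {box} {a₁} = All.map (λ {y} → subst (T ∘ box) (row-lift V m a₁ d y)) ∘ Allₚ.map⁻

    block-allowed : ∀ {a₁} → a₁ < d → All (λ y → T (allowed α β mk (index α) (row (lift V m a₁) d↑ y))) (a ∷ block)
    block-allowed {a₁} a₁<d = All.tabulate λ {y} y∈ →
      allowed-inside⁺ α β mk {row (lift V m a₁) d↑ y} (block-below a₁<d y∈)

  -- The cuts counted by the rank are those at letters of σ. For each of them the whole block, `a`
  -- included, lies in the free box, so its insertion neither creates nor destroys such an
  -- occurrence. Lower points inside the block are on the other side of `a` and are not counted.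
  glue-rank : rank α (meshes S d↑ σN) (pick α σL block) a (pick α block σL) ≡ cutSum (meshes S d N) L
  glue-rank = go α refl
    where
    go : ∀ α′ → α ≡ α′ → rank α (meshes S d↑ σN) (pick α σL block) a (pick α block σL) ≡ cutSum (meshes S d N) L
    go true refl = trans (cutSum-map _ (lift V m) L) (cutSum-cong L λ L₁ a₁ M₁ _ → cong ind (meshᵇ-ext (to L₁ a₁ M₁) (from L₁ a₁ M₁)))
      where
      to : ∀ L₁ a₁ M₁ → Mesh S (map (lift V m) L₁) (lift V m a₁) (map (lift V m) M₁ ++ a ∷ block) d↑ σN → Mesh S L₁ a₁ M₁ d N
      to L₁ a₁ M₁ (mesh lt p q r) =
        mesh (lift-cancel-< V m lt) (All-lift⁻ {S 0} p) (All-lift⁻ {S 1} (Allₚ.++⁻ˡ _ q)) (All-lift⁻ {S 2} r)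
      from : ∀ L₁ a₁ M₁ → Mesh S L₁ a₁ M₁ d N → Mesh S (map (lift V m) L₁) (lift V m a₁) (map (lift V m) M₁ ++ a ∷ block) d↑ σN
      from L₁ a₁ M₁ (mesh lt p q r) =
        mesh (lift-mono-< V m lt) (All-lift {S 0} p) (Allₚ.++⁺ (All-lift {S 1} q) (block-allowed lt)) (All-lift {S 2} r)
    go false refl = trans (cutSum-map _ (lift V m) L) (cutSum-cong L λ L₁ a₁ M₁ _ → cong ind (meshᵇ-ext (to L₁ a₁ M₁) (from L₁ a₁ M₁)))
      where
      to : ∀ L₁ a₁ M₁ → Mesh S (block ++ a ∷ map (lift V m) L₁) (lift V m a₁) (map (lift V m) M₁) d↑ σN → Mesh S L₁ a₁ M₁ d N
      to L₁ a₁ M₁ (mesh lt p q r) =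
        mesh (lift-cancel-< V m lt) (All-lift⁻ {S 0} (All.tail (Allₚ.++⁻ʳ block p))) (All-lift⁻ {S 1} q) (All-lift⁻ {S 2} r)
      from : ∀ L₁ a₁ M₁ → Mesh S L₁ a₁ M₁ d N → Mesh S (block ++ a ∷ map (lift V m) L₁) (lift V m a₁) (map (lift V m) M₁) d↑ σN
      from L₁ a₁ M₁ (mesh lt p q r) with block-allowed lt
      ... | pa ∷ pB = mesh (lift-mono-< V m lt) (Allₚ.++⁺ pB (pa ∷ All-lift {S 0} p)) (All-lift {S 1} q) (All-lift {S 2} r)

-- Bijection between permutations with a k-th occurrence and pairs of permutations

-- The rank is not recorded, so π is related to one pair for each of its occurrences. Prescribing
-- the number of occurrences of σ makes the pair unique.
record Glued (α β : Bool) (mk : Marker) (π σ ρ : List ℕ) : Set where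
  constructor glued
  field
    {before} : List ℕ
    {mark}   : ℕ
    {after}  : List ℕ
    isMarked : Marked mk before mark after
    σ≡       : σ ≡ before ++ mark ∷ after
    π≡       : π ≡ glue α β before mark after ρ

pick-pick : ∀ α (X Y : A) → pick α (pick α X Y) (pick α Y X) ≡ X
pick-pick true  X Y = refl
pick-pick false X Y = refl

record Unglued (α β : Bool) (mk : Marker) (n : ℕ) (L : List ℕ) (a : ℕ) (M : List ℕ) (b : ℕ) (N : List ℕ) : Set where
  field
    {L′}   : List ℕ
    {d}    : ℕ
    {N′ ρ} : List ℕ
    isMarked : Marked mk L′ d N′
    permσ  : IsPerm (length (L′ ++ d ∷ N′)) (L′ ++ d ∷ N′)
    permρ  : IsPerm (length ρ) ρ
    size   : suc (length ρ) + length (L′ ++ d ∷ N′) ≡ n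
    L≡     : L ≡ pick α (map (lift (base β d) (suc (length ρ))) L′) (map (base β d +_) (map (shell β) ρ))
    a≡     : a ≡ base β d + pivot β (length ρ)
    M≡     : M ≡ pick α (map (base β d +_) (map (shell β) ρ)) (map (lift (base β d) (suc (length ρ))) L′)
    b≡     : b ≡ lift (base β d) (suc (length ρ)) d
    N≡     : N ≡ map (lift (base β d) (suc (length ρ))) N′

map-lift-unlift : ∀ {V m w} → All (Outside V m) w → map (lift V m) (map (unlift V m) w) ≡ w
map-lift-unlift []       = refl
map-lift-unlift (p ∷ ps) = cong₂ _∷_ (lift-unlift p) (map-lift-unlift ps)

module _ {α β : Bool} {mk : Marker} {n : ℕ} {X Y N : List ℕ} {a b : ℕ}
         (perm : IsPerm n (pick α X Y ++ a ∷ pick α Y X ++ b ∷ N))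
         (mrk : Marked mk (pick α X Y ++ a ∷ pick α Y X) b N) where

  private
    perm′ : IsPerm n ((a ∷ Y) ++ X ++ b ∷ N)
    perm′ = IsPerm-resp-↭ (front-↭ α X Y a (b ∷ N)) perm

    X-below : ∀ α {X Y : List ℕ} → All (_< b) (pick α X Y ++ a ∷ pick α Y X) → All (_< b) X
    X-below true  {X}         p = Allₚ.++⁻ˡ X p
    X-below false {X} {Y} p = All.tail (Allₚ.++⁻ʳ Y p)

  -- The common end of the cases `β` true and `β` false: once the block is recognised as a shifted
  -- `core β ρ` and the other letters avoid its values, the gap can be closed.
  assemble : ∀ d ρ → a ∷ Y ≡ map (base β d +_) (core β ρ) → b ≡ lift (base β d) (suc (length ρ)) d →
    All (_< suc (length ρ)) (core β ρ) →
    All (Outside (base β d) (suc (length ρ))) X → All (Outside (base β d) (suc (length ρ))) N →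
    Unglued α β mk n (pick α X Y) a (pick α Y X) b N
  assemble d ρ eqY eqb small outX outN = record
    { isMarked = marked′ mk mrk
    ; permσ = proj₂ perms
    ; permρ = core-perm⁻ β refl (proj₁ perms)
    ; size = size
    ; L≡ = cong₂ (pick α) (sym X≡) (∷-injectiveʳ eqY)
    ; a≡ = ∷-injectiveˡ eqY
    ; M≡ = cong₂ (pick α) (∷-injectiveʳ eqY) (sym X≡)
    ; b≡ = eqb
    ; N≡ = sym N≡
    }
    where
    V = base β d
    m = suc (length ρ)
    L′ = map (unlift V m) X
    N′ = map (unlift V m) N
    σ = L′ ++ d ∷ N′
    X≡ = map-lift-unlift outX
    N≡ = map-lift-unlift outN
    inflated : inflate V m (core β ρ) σ ≡ (a ∷ Y) ++ X ++ b ∷ N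
    inflated = cong₂ _++_ (sym eqY) (trans (map-++ (lift V m) L′ (d ∷ N′)) (cong₂ _++_ X≡ (cong₂ _∷_ (sym eqb) N≡)))
    length-core : length (core β ρ) ≡ m
    length-core = cong suc (length-map (shell β) ρ)
    size : m + length σ ≡ n
    size = trans (sym (trans (length-++ (map (V +_) (core β ρ)))
      (cong₂ _+_ (trans (length-map (V +_) (core β ρ)) length-core) (length-map (lift V m) σ))))
      (trans (cong length inflated) (len perm′))
    -- `b` is `m + d` and is below `n`, which is `m + length σ`; hence `d` is below `length σ`, and
    -- `V` is at most `d`.
    V≤ : V ≤ length σ
    V≤ = ≤-trans (base≤ β d) (+-cancelˡ-≤ m _ _ (<⇒≤ (subst₂ _<_ (trans eqb (lift-high (base≤ β d))) (sym size)
      (All.lookup (bounded perm′) (∈-++⁺ʳ (a ∷ Y) (∈-insert X))))))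
    perms : IsPerm m (core β ρ) × IsPerm (length σ) σ
    perms = inflate-perm⁻ V≤ length-core small (subst₂ IsPerm (sym size) (sym inflated) perm′)
    lower : ∀ {W} → All (Outside V m) W → All (_< b) W → All (_< d) (map (unlift V m) W)
    lower []       []       = []
    lower (o ∷ os) (p ∷ ps) = lift-cancel-< V m (subst₂ _<_ (sym (lift-unlift o)) eqb p) ∷ lower os ps
    marked′ : ∀ mk → Marked mk (pick α X Y ++ a ∷ pick α Y X) b N → Marked mk L′ d N′
    marked′ atMax (bW , bN) = lower outX (X-below α bW) , lower outN bN
    marked′ atEnd refl      = refl

  private
    ≢a : ∀ {y} → y ∈ Y ++ X ++ b ∷ N → y ≢ a
    ≢a = cut-distinct [] (distinct perm′)

    Y-unique : Unique Y
    Y-unique = Unique-++ˡ Y (Unique-++ʳ (a ∷ []) (distinct perm′))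

    -- Every value below `n` occurs somewhere. A value in the zone of the free box is denied to all
    -- other letters and so occurs in `Y`; thus the block fills its interval without gaps.
    in-Y : ∀ {v} → v < n → v ≢ a → v ≢ b → (∀ {y} → y ∈ X ⊎ y ∈ N → y ≢ v) → v ∈ Y
    in-Y v<n v≢a v≢b not-rest with perm-surjective perm′ v<n
    ... | here v≡a = contradiction v≡a v≢a
    ... | there v∈ with ∈-++⁻ Y v∈
    ... | inj₁ v∈Y = v∈Y
    ... | inj₂ v∈′ with ∈-++⁻ X v∈′
    ... | inj₁ v∈X           = contradiction refl (not-rest (inj₁ v∈X))
    ... | inj₂ (here v≡b)    = contradiction v≡b v≢b
    ... | inj₂ (there v∈N)   = contradiction refl (not-rest (inj₂ v∈N))

    b<n : b < n
    b<n = All.lookup (bounded perm′) (∈-++⁺ʳ (a ∷ Y) (∈-insert X))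

    rest-∈ : ∀ {y} → y ∈ X ⊎ y ∈ N → y ∈ Y ++ X ++ b ∷ N
    rest-∈ (inj₁ y∈) = ∈-++⁺ʳ Y (∈-++⁺ˡ y∈)
    rest-∈ (inj₂ y∈) = ∈-++⁺ʳ Y (∈-++⁺ʳ X (there y∈))

  disassemble : a < b → All (Zone β a b) Y → All (¬_ ∘ Zone β a b) X → All (¬_ ∘ Zone β a b) N →
    Unglued α β mk n (pick α X Y) a (pick α Y X) b N
  disassemble a<b zoneY zoneX zoneN = go β refl
    where
    notZone : ∀ {y} → y ∈ X ⊎ y ∈ N → ¬ Zone β a b y
    notZone (inj₁ y∈) = All.lookup zoneX y∈
    notZone (inj₂ y∈) = All.lookup zoneN y∈
    go : ∀ β′ → β ≡ β′ → Unglued α β mk n (pick α X Y) a (pick α Y X) b N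
    -- Deleting the values from `a` up to `b - 1` lowers the marker `b` to `a`, so `d` is `a`.
    go true refl = assemble a ρ (cong₂ _∷_ (sym (+-identityʳ a)) (sym ρ↑)) (trans b≡′ (sym (lift-high {a} {suc (length ρ)} ≤-refl)))
        (s≤s z≤n ∷ Allₚ.map⁺ (Allₚ.map⁺ (All.tabulate λ {y} y∈ → s≤s (small y∈))))
        (All.tabulate (out ∘ inj₁)) (All.tabulate (out ∘ inj₂))
      where
      ρ = map (_∸ suc a) Y
      within : ∀ {y} → y ∈ Y → suc a ≤ y × y < b
      within y∈ with zone-between⁻ {a} {b} (All.lookup zoneY y∈)
      ... | p , q = ≤∧≢⇒< p (≢a (∈-++⁺ˡ y∈) ∘ sym) , q
      b-eq : suc a + (b ∸ suc a) ≡ b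
      b-eq = m+[n∸m]≡n a<b
      length-Y : length Y ≡ b ∸ suc a
      length-Y = interval-length {suc a} Y-unique
        (All.tabulate λ y∈ → proj₁ (within y∈) , subst (_ <_) (sym b-eq) (proj₂ (within y∈)))
        λ v v< → let v<b = subst (suc a + v <_) b-eq (+-monoʳ-< (suc a) v<) in
          in-Y (<-trans v<b b<n) (λ e → <-irrefl (sym e) (s≤s (m≤m+n a v))) (<⇒≢ v<b)
            (λ {y} y∈ e → notZone y∈ (subst (Zone true a b) (sym e) (zone-between {a} {b} (m≤n⇒m≤1+n (m≤m+n a v)) v<b)))
      b≡′ : b ≡ suc (length ρ) + a
      b≡′ = trans (sym b-eq) (trans (cong (suc a +_) (trans (sym length-Y) (sym (length-map _ Y)))) (cong suc (+-comm a (length ρ))))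
      map-∸ : ∀ {W} → (∀ {y} → y ∈ W → suc a ≤ y) → map (a +_) (map suc (map (_∸ suc a) W)) ≡ W
      map-∸ {[]}    _ = refl
      map-∸ {y ∷ W} p = cong₂ _∷_ (trans (+-suc a _) (m+[n∸m]≡n (p (here refl)))) (map-∸ (p ∘ there))
      ρ↑ : map (a +_) (map suc ρ) ≡ Y
      ρ↑ = map-∸ (proj₁ ∘ within)
      small : ∀ {y} → y ∈ Y → y ∸ suc a < length ρ
      small {y} y∈ = subst (y ∸ suc a <_) (sym (trans (length-map _ Y) length-Y)) (∸-monoˡ-< (proj₂ (within y∈)) (proj₁ (within y∈)))
      out : ∀ {y} → y ∈ X ⊎ y ∈ N → Outside a (suc (length ρ)) y
      out {y} y∈ with y <? a | y <? b
      ... | yes p | _     = inj₁ p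
      ... | no _  | no q  = inj₂ (subst (_≤ y) (trans b≡′ (+-comm (suc (length ρ)) a)) (≮⇒≥ q))
      ... | no p  | yes q = contradiction (zone-between {a} {b} (≮⇒≥ p) q) (notZone y∈)
    -- Here the deleted values are those from 0 to `a`, and the marker drops by `suc a`.
    go false refl = assemble (b ∸ suc a) Y (cong₂ _∷_ (sym length-Y) (sym (trans (map-id _) (map-id Y))))
        (trans (sym (m+[n∸m]≡n a<b)) (cong (λ t → suc t + (b ∸ suc a)) (sym length-Y)))
        (n<1+n _ ∷ Allₚ.map⁺ (All.tabulate λ {y} y∈ → m<n⇒m<1+n (subst (y <_) (sym length-Y) (below-a y∈))))
        (All.tabulate (out ∘ inj₁)) (All.tabulate (out ∘ inj₂))
      where
      below-a : ∀ {y} → y ∈ Y → y < a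
      below-a y∈ = zone-below⁻ {a} {b} (All.lookup zoneY y∈)
      length-Y : length Y ≡ a
      length-Y = interval-length {0} Y-unique (All.tabulate λ y∈ → z≤n , below-a y∈)
        λ v v<a → in-Y (<-trans v<a (<-trans a<b b<n)) (<⇒≢ v<a) (<⇒≢ (<-trans v<a a<b))
          (λ {y} y∈ e → notZone y∈ (subst (Zone false a b) (sym e) (zone-below {a} {b} v<a)))
      out : ∀ {y} → y ∈ X ⊎ y ∈ N → Outside 0 (suc (length Y)) y
      out {y} y∈ = inj₂ (subst (λ t → suc t ≤ y) (sym length-Y)
        (≤∧≢⇒< (≮⇒≥ (λ lt → notZone y∈ (zone-below {a} {b} lt))) (≢a (rest-∈ y∈) ∘ sym)))

unglue : ∀ {α β mk n L a M b N} → IsPerm n (L ++ a ∷ M ++ b ∷ N) → Split α β mk L a M b N → Unglued α β mk n L a M b N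
unglue {true}  perm (split a<b mrk ins out outN) = disassemble {true} perm mrk a<b ins out outN
unglue {false} perm (split a<b mrk ins out outN) = disassemble {false} perm mrk a<b ins out outN

Unique-concatMap : (f : A → List B) {xs : List A} → Unique xs → (∀ {x} → x ∈ xs → Unique (f x)) →
  (∀ {x y z} → z ∈ f x → z ∈ f y → x ≡ y) → Unique (concatMap f xs)
Unique-concatMap f {[]}     _        _  _ = []
Unique-concatMap f {x ∷ xs} (x∉ ∷ u) uf same = Uniqueₚ.++⁺ (uf (here refl)) (Unique-concatMap f u (uf ∘ there) same)
  λ (p , q) → let y , y∈ , z∈ = find (∈-concatMap⁻ f {xs = xs} q) in All.lookup x∉ y∈ (same p z∈)

length-cartesianProduct : (xs : List A) (ys : List B) → length (cartesianProduct xs ys) ≡ length xs * length ys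
length-cartesianProduct []       ys = refl
length-cartesianProduct (x ∷ xs) ys =
  trans (length-++ (map (x ,_) ys)) (cong₂ _+_ (length-map (x ,_) ys) (length-cartesianProduct xs ys))

-- The marker of σ is unique, hence so is the place where the block is inserted.
Glued-functional : ∀ {α β mk π π′ σ ρ} → Glued α β mk π σ ρ → Glued α β mk π′ σ ρ → π ≡ π′
Glued-functional {mk = mk} (glued {before = L} m refl refl) (glued {before = L′} m′ e refl)
  with Marked-unique mk m m′ e
... | refl with ++-cancelˡ L _ _ e
... | refl = refl

module _ (α β : Bool) (mk : Marker) where

  private
    S = allowed α β mk

    meshes≤1 : ∀ d N L a M → meshes S d N L a M ≤ 1
    meshes≤1 d N L a M with meshᵇ S L a M d N
    ... | true  = ≤-refl
    ... | false = z≤n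

    meshes≡1⁻ : ∀ {d N L a M} → meshes S d N L a M ≡ 1 → Mesh S L a M d N
    meshes≡1⁻ {d} {N} {L} {a} {M} eq with meshᵇ S L a M d N in eqᵇ
    ... | true = mesh⁻ (subst T (sym eqᵇ) _)

    meshes≡1⁺ : ∀ {d N L a M} → Mesh S L a M d N → meshes S d N L a M ≡ 1
    meshes≡1⁺ {d} {N} {L} {a} {M} m = cong ind (T⇒≡ {meshᵇ S L a M d N} (mesh⁺ m))

  -- The block deleted is that of the occurrence of rank `k`; by `glue-rank` this rank is the number
  -- of occurrences left in σ.
  decompose : ∀ {n k π} → IsPerm n π → k < occurrences S π → ∃ λ σ → ∃ λ ρ →
    Glued α β mk π σ ρ × IsPerm (length σ) σ × IsPerm (length ρ) ρ × suc (length ρ) + length σ ≡ n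
      × 0 < length σ × occurrences S σ ≡ k
  decompose {n} {k} {x ∷ w} perm k< with Marked-exists mk x w (distinct perm)
  ... | W , d↑ , N↑ , eq , mrk
    with exists-rank α W (meshes≤1 d↑ N↑)
           (subst (k <_) (trans (cong (occurrences S) eq) (occurrences-marked α β mk mrk)) k<)
  ... | L , a , M , refl , v , r
    with unglue {α} {β} {mk} (subst (IsPerm n) (trans eq (++-assoc L (a ∷ M) (d↑ ∷ N↑))) perm)
           (mesh⇒split {α} {β} {mk} (meshes≡1⁻ {d↑} {N↑} {L} {a} {M} v))
  ... | record { L′ = L′ ; d = d ; N′ = N′ ; ρ = ρ ; isMarked = m ; permσ = pσ ; permρ = pρ ; size = size
               ; L≡ = refl ; a≡ = refl ; M≡ = refl ; b≡ = refl ; N≡ = refl } =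
    L′ ++ d ∷ N′ , ρ
      , glued m refl (trans eq (++-assoc L (a ∷ M) (d↑ ∷ N↑)))
      , pσ , pρ , size
      , subst (0 <_) (sym (length-++-sucʳ L′ d N′)) (s≤s z≤n)
      , trans (occurrences-marked α β mk m) (trans (sym (glue-rank α β mk m pσ pρ)) r)

  -- The new occurrence has as rank the number of occurrences of σ, and the rank of an occurrence
  -- lies strictly below the total.
  compose : ∀ {i j σ ρ} → IsPerm (suc j) σ → IsPerm i ρ →
    ∃ λ π → Glued α β mk π σ ρ × IsPerm (suc i + suc j) π × occurrences S σ < occurrences S π
  compose {i} {j} {x ∷ σ} {ρ} pσ pρ with Marked-exists mk x σ (distinct pσ)
  ... | L , d , N , eq , m = glue α β L d N ρ , glued m eq refl , glue-perm α β pσ′ pρ , more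
    where
    open ≤-Reasoning
    pσ′ = subst (IsPerm (suc j)) eq pσ
    sp = glue-split α β mk m pσ′ pρ
    V = base β d
    σL = map (lift V (suc (length ρ))) L
    block = map (V +_) (map (shell β) ρ)
    a = V + pivot β (length ρ)
    d↑ = lift V (suc (length ρ)) d
    N↑ = map (lift V (suc (length ρ))) N
    more : occurrences S (x ∷ σ) < occurrences S (glue α β L d N ρ)
    more = begin-strict
      occurrences S (x ∷ σ)                   ≡⟨ cong (occurrences S) eq ⟩
      occurrences S (L ++ d ∷ N)              ≡⟨ occurrences-marked α β mk m ⟩
      cutSum (meshes S d N) L                 ≡⟨ glue-rank α β mk m pσ′ pρ ⟨
      rank α (meshes S d↑ N↑) (pick α σL block) a (pick α block σL)
        <⟨ rank-< α (meshes S d↑ N↑) (pick α σL block) a (pick α block σL)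
             (meshes≡1⁺ (split⇒mesh {α} {β} {mk} sp)) ⟩
      cutSum (meshes S d↑ N↑) (pick α σL block ++ a ∷ pick α block σL)
        ≡⟨ occurrences-marked α β mk (Split.marked sp) ⟨
      occurrences S ((pick α σL block ++ a ∷ pick α block σL) ++ d↑ ∷ N↑)
        ≡⟨ cong (occurrences S) (++-assoc (pick α σL block) _ _) ⟩
      occurrences S (glue α β L d N ρ) ∎

  -- Equal numbers of occurrences in σ and σ′ mean equal ranks in π, so both pairs come from the
  -- same occurrence. Its position separates the block from the rest, and the size of the block then
  -- determines how far the remaining values were lifted.
  Glued-injective : ∀ {π σ ρ σ′ ρ′ i j i′ j′} → Glued α β mk π σ ρ → Glued α β mk π σ′ ρ′ →
    IsPerm j σ → IsPerm i ρ → IsPerm j′ σ′ → IsPerm i′ ρ′ →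
    occurrences S σ ≡ occurrences S σ′ → σ ≡ σ′ × ρ ≡ ρ′
  Glued-injective {ρ = ρ} {ρ′ = ρ′} (glued {L} {d} {N} m refl refl) (glued {L′} {d′} {N′} m′ refl π≡) pσ pρ pσ′ pρ′ occ≡ =
    conclude
    where
    module Side {L d N ρ i j} (m : Marked mk L d N) (pσ : IsPerm j (L ++ d ∷ N)) (pρ : IsPerm i ρ) where
      sp = glue-split α β mk m pσ pρ
      V = base β d
      h = suc (length ρ)
      σL = map (lift V h) L
      block = map (V +_) (map (shell β) ρ)
      a = V + pivot β (length ρ)
      d↑ = lift V h d
      N↑ = map (lift V h) N
      left = pick α σL block
      right = pick α block σL
      one : meshes S d↑ N↑ left a right ≡ 1
      one = meshes≡1⁺ (split⇒mesh {α} {β} {mk} sp)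
      rank≡ : rank α (meshes S d↑ N↑) left a right ≡ occurrences S (L ++ d ∷ N)
      rank≡ = trans (glue-rank α β mk m pσ pρ) (sym (occurrences-marked α β mk m))
    module P = Side m pσ pρ
    module Q = Side m′ pσ′ pρ′

    eqπ : (P.left ++ P.a ∷ P.right) ++ P.d↑ ∷ P.N↑ ≡ (Q.left ++ Q.a ∷ Q.right) ++ Q.d↑ ∷ Q.N↑
    eqπ = trans (++-assoc P.left _ _) (trans π≡ (sym (++-assoc Q.left _ _)))
    W≡ : P.left ++ P.a ∷ P.right ≡ Q.left ++ Q.a ∷ Q.right
    W≡ = Marked-unique mk (Split.marked P.sp) (Split.marked Q.sp) eqπ
    tail≡ : P.d↑ ∷ P.N↑ ≡ Q.d↑ ∷ Q.N↑
    tail≡ = ++-cancelˡ (P.left ++ P.a ∷ P.right) _ _ (trans eqπ (cong (_++ Q.d↑ ∷ Q.N↑) (sym W≡)))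
    d↑≡ : P.d↑ ≡ Q.d↑
    d↑≡ = ∷-injectiveˡ tail≡
    N↑≡ : P.N↑ ≡ Q.N↑
    N↑≡ = ∷-injectiveʳ tail≡
    left≡ : P.left ≡ Q.left
    left≡ = rank-unique α (meshes S P.d↑ P.N↑) P.left Q.left W≡ P.one
      (trans (cong₂ (λ d N → meshes S d N Q.left Q.a Q.right) d↑≡ N↑≡) Q.one)
      (trans P.rank≡ (trans occ≡ (trans (sym Q.rank≡)
        (cong₂ (λ d N → rank α (meshes S d N) Q.left Q.a Q.right) (sym d↑≡) (sym N↑≡)))))
    right≡ : P.right ≡ Q.right
    right≡ = ∷-injectiveʳ (++-cancelˡ P.left _ _ (trans W≡ (cong (_++ Q.a ∷ Q.right) (sym left≡))))
    σL≡ : P.σL ≡ Q.σL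
    σL≡ = trans (sym (pick-pick α P.σL P.block)) (trans (cong₂ (pick α) left≡ right≡) (pick-pick α Q.σL Q.block))
    block≡ : P.block ≡ Q.block
    block≡ = trans (sym (pick-pick α P.block P.σL)) (trans (cong₂ (pick α) right≡ left≡) (pick-pick α Q.block Q.σL))
    length-block : ∀ V (ρ : List ℕ) → length (map (V +_) (map (shell β) ρ)) ≡ length ρ
    length-block V ρ = trans (length-map (V +_) (map (shell β) ρ)) (length-map (shell β) ρ)
    h≡ : P.h ≡ Q.h
    h≡ = cong suc (trans (sym (length-block P.V ρ)) (trans (cong length block≡) (length-block Q.V ρ′)))
    d≡ : d ≡ d′
    d≡ = +-cancelˡ-≡ P.h _ _ (trans (sym (lift-high (base≤ β d))) (trans d↑≡
           (trans (lift-high (base≤ β d′)) (cong (_+ d′) (sym h≡)))))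
    same-lift : ∀ {W W′} → map (lift P.V P.h) W ≡ map (lift Q.V Q.h) W′ → W ≡ W′
    same-lift {W′ = W′} e = map-injective (lift-injective P.V P.h)
      (trans e (cong₂ (λ d h → map (lift (base β d) h) W′) (sym d≡) (sym h≡)))
    shell-injective : ∀ β {x y} → shell β x ≡ shell β y → x ≡ y
    shell-injective true  = suc-injective
    shell-injective false = id
    conclude : L ++ d ∷ N ≡ L′ ++ d′ ∷ N′ × ρ ≡ ρ′
    conclude = cong₂ _++_ (same-lift σL≡) (cong₂ _∷_ d≡ (same-lift N↑≡))
      , map-injective (shell-injective β) (map-injective (+-cancelˡ-≡ P.V _ _)
          (trans block≡ (cong (λ d → map (base β d +_) (map (shell β) ρ′)) (sym d≡))))

  -- These pairs belong to the permutations of length `suc n`. The length of σ is `suc j` because σ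
  -- contains the marker; one letter is `a`, which leaves `n ∸ suc j` for ρ.
  pairs : ℕ → ℕ → List (List ℕ × List ℕ)
  pairs n k = concatMap (λ j → cartesianProduct (filterᵇ (λ w → occurrences S w ≡ᵇ k) (words (suc j))) (words (n ∸ suc j))) (upTo n)

  ∈-pairs⁻ : ∀ {n k σ ρ} → (σ , ρ) ∈ pairs n k →
    ∃ λ j → j < n × IsPerm (suc j) σ × occurrences S σ ≡ k × IsPerm (n ∸ suc j) ρ
  ∈-pairs⁻ {n} {k} {σ} {ρ} p∈ with find (∈-concatMap⁻ _ {xs = upTo n} p∈)
  ... | j , j∈ , p∈′ with ∈-cartesianProduct⁻ (filterᵇ (λ w → occurrences S w ≡ᵇ k) (words (suc j))) (words (n ∸ suc j)) p∈′
  ... | σ∈ , ρ∈ with ∈-filterᵇ⁻ (λ w → occurrences S w ≡ᵇ k) (words (suc j)) σ∈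
  ... | σ∈′ , t = j , ∈-upTo⁻ j∈ , ∈-words⁻ σ∈′ , ≡ᵇ⇒≡ _ k t , ∈-words⁻ ρ∈

  ∈-pairs⁺ : ∀ {n j k σ ρ} → j < n → IsPerm (suc j) σ → occurrences S σ ≡ k → IsPerm (n ∸ suc j) ρ → (σ , ρ) ∈ pairs n k
  ∈-pairs⁺ {n} {j} {k} j<n pσ eq pρ = ∈-concatMap⁺ _ (lose (∈-upTo⁺ j<n)
    (∈-cartesianProduct⁺ (∈-filterᵇ⁺ (λ w → occurrences S w ≡ᵇ k) (∈-words⁺ pσ) (≡⇒≡ᵇ _ k eq)) (∈-words⁺ pρ)))

  Unique-pairs : ∀ n k → Unique (pairs n k)
  Unique-pairs n k = Unique-concatMap _ (Uniqueₚ.upTo⁺ n)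
    (λ {j} _ → Uniqueₚ.cartesianProduct⁺ (Unique-filterᵇ _ (Unique-words (suc j))) (Unique-words (n ∸ suc j)))
    (λ p q → suc-injective (trans (sym (size p)) (size q)))
    where
    size : ∀ {j σρ} → σρ ∈ cartesianProduct (filterᵇ (λ w → occurrences S w ≡ᵇ k) (words (suc j))) (words (n ∸ suc j)) →
      length (proj₁ σρ) ≡ suc j
    size {j} p∈ with ∈-cartesianProduct⁻ (filterᵇ (λ w → occurrences S w ≡ᵇ k) (words (suc j))) (words (n ∸ suc j)) p∈
    ... | σ∈ , _ = len (∈-words⁻ (proj₁ (∈-filterᵇ⁻ (λ w → occurrences S w ≡ᵇ k) (words (suc j)) σ∈)))

  length-pairs : ∀ n k → length (pairs n k) ≡ sum (map (λ j → distribution S (suc j) k * length (words (n ∸ suc j))) (upTo n))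
  length-pairs n k = trans (length-concatMap _ (upTo n))
    (cong sum (map-cong (λ j → length-cartesianProduct (filterᵇ (λ w → occurrences S w ≡ᵇ k) (words (suc j))) (words (n ∸ suc j))) (upTo n)))

  exceedance : ℕ → ℕ → ℕ
  exceedance n k = length (filterᵇ (λ w → k <ᵇ occurrences S w) (words n))

  -- Two inequalities through the same relation: `decompose` and `Glued-functional` give one,
  -- `compose` and `Glued-injective` the other.
  exceedance-suc : ∀ n k → exceedance (suc n) k ≡ sum (map (λ j → distribution S (suc j) k * length (words (n ∸ suc j))) (upTo n))
  exceedance-suc n k = trans (≤-antisym
    (length-≤-by R (Unique-filterᵇ exceeds (Unique-words (suc n))) apart (λ _ _ → Glued-functional))
    (length-≤-by (λ p π → R π p) (Unique-pairs n k) together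
      λ {x} {x′} x∈ x′∈ g g′ → let _ , _ , pσ , o , pρ = ∈-pairs⁻ {n} {k} x∈ ; _ , _ , pσ′ , o′ , pρ′ = ∈-pairs⁻ {n} {k} x′∈
                                   e₁ , e₂ = Glued-injective g g′ pσ pρ pσ′ pρ′ (trans o (sym o′)) in cong₂ _,_ e₁ e₂))
    (length-pairs n k)
    where
    exceeds : List ℕ → Bool
    exceeds w = k <ᵇ occurrences S w
    R : List ℕ → List ℕ × List ℕ → Set
    R π (σ , ρ) = Glued α β mk π σ ρ
    apart : ∀ {π} → π ∈ filterᵇ exceeds (words (suc n)) → ∃ λ p → p ∈ pairs n k × R π p
    apart π∈ with ∈-filterᵇ⁻ exceeds (words (suc n)) π∈
    ... | π∈′ , t with decompose (∈-words⁻ {suc n} π∈′) (<ᵇ⇒< k _ t)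
    ... | x ∷ σ , ρ , g , pσ , pρ , size , _ , o = (x ∷ σ , ρ) , ∈-pairs⁺
      (subst (length σ <_) (suc-injective size) (m≤n+m (suc (length σ)) (length ρ))) pσ o
      (subst (λ i → IsPerm i ρ) (sym (trans (cong (_∸ suc (length σ)) (sym (suc-injective size))) (m+n∸n≡m (length ρ) (suc (length σ))))) pρ) , g
    together : ∀ {p} → p ∈ pairs n k → ∃ λ π → π ∈ filterᵇ exceeds (words (suc n)) × R π p
    together {σ , ρ} p∈ =
      let j , j<n , pσ , o , pρ = ∈-pairs⁻ {n} {k} p∈
          π , g , pπ , lt = compose {n ∸ suc j} {j} pσ pρ
          π∈ = ∈-words⁺ {suc n} (subst (λ t → IsPerm t π) (cong suc (m∸n+n≡m j<n)) pπ)
      in π , ∈-filterᵇ⁺ exceeds π∈ (<⇒<ᵇ (subst (_< occurrences S π) o lt)) , g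

-- The number of all permutations

length-words : ∀ n → length (words n) ≡ n !
length-words zero    = refl
length-words (suc n) = trans (≤-antisym
  (length-≤-by R (Unique-words (suc n)) split-head (λ _ _ e e′ → trans e (sym e′)))
  (length-≤-by (λ p w → R w p) (Uniqueₚ.cartesianProduct⁺ (Uniqueₚ.upTo⁺ (suc n)) (Unique-words n)) add-head
    (λ _ _ → R-injective)))
  (trans (length-cartesianProduct (upTo (suc n)) (words n)) (cong₂ _*_ (length-upTo (suc n)) (length-words n)))
  where
  -- The first letter `a` is regarded as a block of size one, and `w′` is the rest with the gap at
  -- `a` closed.
  R : List ℕ → ℕ × List ℕ → Set
  R w (a , w′) = w ≡ inflate a 1 (0 ∷ []) w′
  R-injective : ∀ {p q w} → R w p → R w q → p ≡ q
  R-injective {a , u} {b , v} refl eq with +-cancelʳ-≡ 0 a b (∷-injectiveˡ eq)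
  ... | refl = cong (a ,_) (map-injective (lift-injective a 1) (∷-injectiveʳ eq))
  split-head : ∀ {w} → w ∈ words (suc n) → ∃ λ p → p ∈ cartesianProduct (upTo (suc n)) (words n) × R w p
  split-head w∈ = go (∈-words⁻ {suc n} w∈)
    where
    go : ∀ {w} → IsPerm (suc n) w → ∃ λ p → p ∈ cartesianProduct (upTo (suc n)) (words n) × R w p
    go {a ∷ r} perm@(isPerm _ (a<n ∷ _) (a∉ ∷ _)) = (a , map (unlift a 1) r)
      , ∈-cartesianProduct⁺ (∈-upTo⁺ a<n) (∈-words⁺ {n} (proj₂ (inflate-perm⁻ {a} {1} {n} {0 ∷ []} (s≤s⁻¹ a<n) refl (s≤s z≤n ∷ []) (subst (IsPerm (suc n)) w≡ perm))))
      , w≡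
      where
      out : All (Outside a 1) r
      out = All.map (λ {y} a≢y → outside y a≢y) a∉
        where
        outside : ∀ y → a ≢ y → Outside a 1 y
        outside y a≢y with <-cmp y a
        ... | tri< lt _ _ = inj₁ lt
        ... | tri≈ _ e _  = contradiction (sym e) a≢y
        ... | tri> _ _ gt = inj₂ (subst (_≤ y) (+-comm 1 a) gt)
      w≡ : a ∷ r ≡ inflate a 1 (0 ∷ []) (map (unlift a 1) r)
      w≡ = cong₂ _∷_ (sym (+-identityʳ a)) (sym (map-lift-unlift out))
  add-head : ∀ {p} → p ∈ cartesianProduct (upTo (suc n)) (words n) → ∃ λ w → w ∈ words (suc n) × R w p
  add-head {a , w} p∈ =
    let a∈ , w∈ = ∈-cartesianProduct⁻ (upTo (suc n)) (words n) p∈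
    in inflate a 1 (0 ∷ []) w
       , ∈-words⁺ {suc n} (inflate-perm (s≤s⁻¹ (∈-upTo⁻ a∈)) (isPerm refl (s≤s z≤n ∷ []) ([] ∷ [])) (∈-words⁻ {n} w∈))
       , refl

-- Counts of exactly and of more than k occurrences

module _ (α β : Bool) (mk : Marker) where

  private
    S = allowed α β mk

  exceedance-recurrence : ∀ n k →
    exceedance α β mk (suc n) k ≡ sum (map (λ j → distribution S (suc j) k * (n ∸ suc j) !) (upTo n))
  exceedance-recurrence n k = trans (exceedance-suc α β mk n k)
    (cong sum (map-cong (λ j → cong (distribution S (suc j) k *_) (length-words (n ∸ suc j))) (upTo n)))

  distribution-zero : ∀ n → distribution S n 0 + exceedance α β mk n 0 ≡ n !
  distribution-zero n = trans (go (words n)) (length-words n)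
    where
    go : ∀ ws → length (filterᵇ (λ w → occurrences S w ≡ᵇ 0) ws) + length (filterᵇ (λ w → 0 <ᵇ occurrences S w) ws) ≡ length ws
    go []       = refl
    go (w ∷ ws) with occurrences S w
    ... | zero  = cong suc (go ws)
    ... | suc _ = trans (+-suc _ _) (cong suc (go ws))

  distribution-suc : ∀ n k → distribution S n (suc k) + exceedance α β mk n (suc k) ≡ exceedance α β mk n k
  distribution-suc n k = go (words n)
    where
    split-above : ∀ x → ind (x ≡ᵇ suc k) + ind (suc k <ᵇ x) ≡ ind (k <ᵇ x)
    split-above x with <-cmp x (suc k)
    ... | tri< (s≤s x≤k) x≢ x≯ = trans (cong₂ (λ p q → ind p + ind q) (¬T⇒≡ (x≢ ∘ ≡ᵇ⇒≡ x (suc k))) (¬T⇒≡ (x≯ ∘ <ᵇ⇒< (suc k) x)))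
                                 (sym (cong ind (¬T⇒≡ (≤⇒≯ x≤k ∘ <ᵇ⇒< k x))))
    ... | tri≈ _ refl x≯ = trans (cong₂ (λ p q → ind p + ind q) (T⇒≡ (≡⇒≡ᵇ x x refl)) (¬T⇒≡ (x≯ ∘ <ᵇ⇒< (suc k) x)))
                             (sym (cong ind (T⇒≡ (<⇒<ᵇ (n<1+n k)))))
    ... | tri> _ x≢ x>  = trans (cong₂ (λ p q → ind p + ind q) (¬T⇒≡ (x≢ ∘ ≡ᵇ⇒≡ x (suc k))) (T⇒≡ (<⇒<ᵇ x>)))
                             (sym (cong ind (T⇒≡ (<⇒<ᵇ (<-trans (n<1+n k) x>)))))
    length-filterᵇ-∷ : ∀ (p : List ℕ → Bool) w ws → length (filterᵇ p (w ∷ ws)) ≡ ind (p w) + length (filterᵇ p ws)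
    length-filterᵇ-∷ p w ws with p w
    ... | true  = refl
    ... | false = refl
    go : ∀ ws → length (filterᵇ (λ w → occurrences S w ≡ᵇ suc k) ws) + length (filterᵇ (λ w → suc k <ᵇ occurrences S w) ws)
              ≡ length (filterᵇ (λ w → k <ᵇ occurrences S w) ws)
    go []       = refl
    go (w ∷ ws) = begin
      length (filterᵇ p (w ∷ ws)) + length (filterᵇ q (w ∷ ws))
        ≡⟨ cong₂ _+_ (length-filterᵇ-∷ p w ws) (length-filterᵇ-∷ q w ws) ⟩
      (ind (p w) + length (filterᵇ p ws)) + (ind (q w) + length (filterᵇ q ws))
        ≡⟨ interchange +-commutativeSemigroup (ind (p w)) _ _ _ ⟩
      (ind (p w) + ind (q w)) + (length (filterᵇ p ws) + length (filterᵇ q ws))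
        ≡⟨ cong₂ _+_ (split-above (occurrences S w)) (go ws) ⟩
      ind (r w) + length (filterᵇ r ws)
        ≡⟨ length-filterᵇ-∷ r w ws ⟨
      length (filterᵇ r (w ∷ ws)) ∎
      where
      open ≡-Reasoning
      p q r : List ℕ → Bool
      p w = occurrences S w ≡ᵇ suc k
      q w = suc k <ᵇ occurrences S w
      r w = k <ᵇ occurrences S w

-- Symmetry under reverse-complement

complement : ℕ → ℕ → ℕ
complement n x = n ∸ suc x

reverseComplement : ℕ → List ℕ → List ℕ
reverseComplement n w = reverse (map (complement n) w)

opposite : Boxes → Boxes
opposite box c r = box (2 ∸ c) (2 ∸ r)

complement-< : ∀ {n x} → x < n → complement n x < n
complement-< {n} {x} x<n = ∸-monoʳ-< {n} {suc x} {0} (s≤s z≤n) x<n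

complement-anti : ∀ {n x y} → y < n → x < y → complement n y < complement n x
complement-anti {n} y<n x<y = ∸-monoʳ-< (s≤s x<y) y<n

complement-involutive : ∀ {n x} → x < n → complement n (complement n x) ≡ x
complement-involutive {suc n} {x} (s≤s x≤n) = m∸[m∸n]≡n x≤n

complement-injective : ∀ {n x y} → x < n → y < n → complement n x ≡ complement n y → x ≡ y
complement-injective {n} x<n y<n eq =
  trans (sym (complement-involutive x<n)) (trans (cong (complement n) eq) (complement-involutive y<n))

strip-complement : ∀ {n a b y r} → a < n → b < n → y < n → Strip a b n y r →
  Strip (complement n b) (complement n a) n (complement n y) (2 ∸ r)
strip-complement a<n b<n y<n (first p)    = third (complement-anti a<n p) (complement-< y<n)
strip-complement a<n b<n y<n (second p q) = second (complement-anti b<n q) (complement-anti y<n p)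
strip-complement a<n b<n y<n (third p _)  = first (complement-anti y<n p)

row≤2 : ∀ a b y → row a b y ≤ 2
row≤2 a b y with row a b y | rowView a b y
... | _ | below _     = z≤n
... | _ | between _ _ = s≤s z≤n
... | _ | above _ _   = ≤-refl

-- The complement respects the open strips but not the half-open rows. The reversal therefore goes
-- through `Strip`, which requires `y` to differ from `a` and `b`.
opposite-row : ∀ {n a b y} → a < b → b < n → y < n → y ≢ a → y ≢ b →
  2 ∸ row (complement n b) (complement n a) (complement n y) ≡ row a b y
opposite-row {n} {a} {b} {y} a<b b<n y<n y≢a y≢b = trans
  (cong (2 ∸_) (strip⇒row (complement-anti b<n a<b)
    (strip-complement (<-trans a<b b<n) b<n y<n (row⇒strip y<n y≢a y≢b))))
  (m∸[m∸n]≡n (row≤2 a b y))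

cutSum-+ : ∀ f g w → cutSum (λ L a R → f L a R + g L a R) w ≡ cutSum f w + cutSum g w
cutSum-+ f g []      = refl
cutSum-+ f g (x ∷ w) = trans (cong (f [] x w + g [] x w +_) (cutSum-+ (λ L → f (x ∷ L)) (λ L → g (x ∷ L)) w))
  (interchange +-commutativeSemigroup (f [] x w) (g [] x w) _ _)

-- Reverse-complement exchanges the two points of an occurrence, so the sum over pairs is also
-- needed with the upper point chosen first.
cutSum-swap : ∀ (g : List ℕ → ℕ → List ℕ → ℕ → List ℕ → ℕ) w →
  cutSum (λ L a R → cutSum (λ M b N → g L a M b N) R) w ≡ cutSum (λ L b N → cutSum (λ L₁ a M → g L₁ a M b N) L) w
cutSum-swap g []      = refl
cutSum-swap g (x ∷ w) = trans
  (cong (cutSum (g [] x) w +_) (cutSum-swap (λ L → g (x ∷ L)) w))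
  (sym (cutSum-+ (g [] x) (λ L b N → cutSum (λ L₁ a M → g (x ∷ L₁) a M b N) L) w))

cutSum-reverse : ∀ f w → cutSum f (reverse w) ≡ cutSum (λ L a R → f (reverse R) a (reverse L)) w
cutSum-reverse f []      = refl
cutSum-reverse f (x ∷ w) = begin
  cutSum f (reverse (x ∷ w))
    ≡⟨ cong (cutSum f) (unfold-reverse x w) ⟩
  cutSum f (reverse w ++ x ∷ [])
    ≡⟨ cutSum-++ f (reverse w) (x ∷ []) ⟩
  cutSum (λ L a R → f L a (R ++ x ∷ [])) (reverse w) + (f (reverse w ++ []) x [] + 0)
    ≡⟨ cong₂ _+_ (cutSum-reverse _ w) (trans (+-identityʳ _) (cong (λ t → f t x []) (++-identityʳ (reverse w)))) ⟩
  cutSum (λ L a R → f (reverse R) a (reverse L ++ x ∷ [])) w + f (reverse w) x []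
    ≡⟨ +-comm _ (f (reverse w) x []) ⟩
  f (reverse w) x [] + cutSum (λ L a R → f (reverse R) a (reverse L ++ x ∷ [])) w
    ≡⟨ cong (f (reverse w) x [] +_) (cutSum-cong w λ L a R _ → cong (f (reverse R) a) (sym (unfold-reverse x L))) ⟩
  cutSum (λ L a R → f (reverse R) a (reverse L)) (x ∷ w) ∎
  where open ≡-Reasoning

cutSum-reverseComplement : ∀ f n w →
  cutSum f (reverseComplement n w) ≡
  cutSum (λ L a R → f (reverseComplement n R) (complement n a) (reverseComplement n L)) w
cutSum-reverseComplement f n w = trans (cutSum-reverse f (map (complement n) w)) (cutSum-map _ (complement n) w)

module _ {n : ℕ} {box : Boxes} where

  opposite-mesh : ∀ {L a M b N} → IsPerm n (L ++ a ∷ M ++ b ∷ N) →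
    meshᵇ (opposite box) (reverseComplement n N) (complement n b) (reverseComplement n M) (complement n a) (reverseComplement n L)
      ≡ meshᵇ box L a M b N
  opposite-mesh {L} {a} {M} {b} {N} perm = meshᵇ-ext to from
    where
    w-assoc = ++-assoc L (a ∷ M) (b ∷ N)

    entry : ∀ {y} → y ∈ L ++ M ++ N → y < n × y ≢ a × y ≢ b
    entry {y} y∈ with ∈-++⁻ L y∈
    ... | inj₁ p = All.lookup (bounded perm) (∈-++⁺ˡ p) , cut-distinct L (distinct perm) (∈-++⁺ˡ p)
      , cut-distinct (L ++ a ∷ M) (subst Unique (sym w-assoc) (distinct perm)) (∈-++⁺ˡ (∈-++⁺ˡ p))
    ... | inj₂ q with ∈-++⁻ M q
    ... | inj₁ p = All.lookup (bounded perm) (∈-++⁺ʳ L (there (∈-++⁺ˡ p))) , cut-distinct L (distinct perm) (∈-++⁺ʳ L (∈-++⁺ˡ p))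
      , cut-distinct (L ++ a ∷ M) (subst Unique (sym w-assoc) (distinct perm)) (∈-++⁺ˡ (∈-++⁺ʳ L (there p)))
    ... | inj₂ p = All.lookup (bounded perm) (∈-++⁺ʳ L (there (∈-++⁺ʳ M (there p))))
      , cut-distinct L (distinct perm) (∈-++⁺ʳ L (∈-++⁺ʳ M (there p)))
      , cut-distinct (L ++ a ∷ M) (subst Unique (sym w-assoc) (distinct perm)) (∈-++⁺ʳ (L ++ a ∷ M) p)

    a<n : a < n
    a<n = All.lookup (bounded perm) (∈-insert L)
    b<n : b < n
    b<n = All.lookup (bounded perm) (∈-++⁺ʳ L (there (∈-insert M)))

    module _ (a<b : a < b) where
      cell≡ : ∀ c {y} → y ∈ L ++ M ++ N →
        box c (2 ∸ row (complement n b) (complement n a) (complement n y)) ≡ box c (row a b y)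
      cell≡ c y∈ = let y<n , y≢a , y≢b = entry y∈ in cong (box c) (opposite-row a<b b<n y<n y≢a y≢b)

      All-opposite⁺ : ∀ c {W} → (∀ {y} → y ∈ W → y ∈ L ++ M ++ N) → All (λ y → T (box c (row a b y))) W →
        All (λ y → T (box c (2 ∸ row (complement n b) (complement n a) y))) (reverseComplement n W)
      All-opposite⁺ c {W} ⊆ ps = All-resp-↭ (↭-sym (↭-reverse (map (complement n) W)))
        (Allₚ.map⁺ (All.tabulate λ y∈ → subst T (sym (cell≡ c (⊆ y∈))) (All.lookup ps y∈)))

      All-opposite⁻ : ∀ c {W} → (∀ {y} → y ∈ W → y ∈ L ++ M ++ N) →
        All (λ y → T (box c (2 ∸ row (complement n b) (complement n a) y))) (reverseComplement n W) →
        All (λ y → T (box c (row a b y))) W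
      All-opposite⁻ c {W} ⊆ ps = All.tabulate λ y∈ → subst T (cell≡ c (⊆ y∈))
        (All.lookup (Allₚ.map⁻ (All-resp-↭ (↭-reverse (map (complement n) W)) ps)) y∈)

    to : Mesh (opposite box) (reverseComplement n N) (complement n b) (reverseComplement n M) (complement n a) (reverseComplement n L) →
      Mesh box L a M b N
    to (mesh lt p q r) = mesh a<b (All-opposite⁻ a<b 0 ∈-++⁺ˡ r) (All-opposite⁻ a<b 1 (∈-++⁺ʳ L ∘ ∈-++⁺ˡ) q)
      (All-opposite⁻ a<b 2 (∈-++⁺ʳ L ∘ ∈-++⁺ʳ M) p)
      where
      a<b : a < b
      a<b = subst₂ _<_ (complement-involutive a<n) (complement-involutive b<n) (complement-anti (complement-< a<n) lt)
    from : Mesh box L a M b N →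
      Mesh (opposite box) (reverseComplement n N) (complement n b) (reverseComplement n M) (complement n a) (reverseComplement n L)
    from (mesh a<b p q r) = mesh (complement-anti b<n a<b) (All-opposite⁺ a<b 2 (∈-++⁺ʳ L ∘ ∈-++⁺ʳ M) r)
      (All-opposite⁺ a<b 1 (∈-++⁺ʳ L ∘ ∈-++⁺ˡ) q) (All-opposite⁺ a<b 0 ∈-++⁺ˡ p)

  opposite-occurrences : ∀ {w} → IsPerm n w → occurrences (opposite box) (reverseComplement n w) ≡ occurrences box w
  opposite-occurrences {w} perm = begin
    cutSum (starts (opposite box)) (reverseComplement n w)
      ≡⟨ cutSum-reverseComplement _ n w ⟩
    cutSum (λ L b N → starts (opposite box) (rc N) (complement n b) (rc L)) w
      ≡⟨ cutSum-cong w (λ L b N _ → cutSum-reverseComplement _ n L) ⟩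
    cutSum (λ L b N → cutSum (λ L₁ a M → ind (meshᵇ (opposite box) (rc N) (complement n b) (rc M) (complement n a) (rc L₁))) L) w
      ≡⟨ cutSum-swap _ w ⟨
    cutSum (λ L a R → cutSum (λ M b N → ind (meshᵇ (opposite box) (rc N) (complement n b) (rc M) (complement n a) (rc L))) R) w
      ≡⟨ cutSum-cong w (λ { L a R refl → cutSum-cong R (λ { M b N refl → cong ind (opposite-mesh {L} {a} {M} {b} {N} perm) }) }) ⟩
    cutSum (starts box) w ∎
    where
    open ≡-Reasoning
    rc = reverseComplement n

Unique-map-∈ : ∀ {A B : Set} {f : A → B} {xs} → (∀ {x y} → x ∈ xs → y ∈ xs → f x ≡ f y → x ≡ y) → Unique xs → Unique (map f xs)
Unique-map-∈ {f = f} {xs = []}    inj []       = []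
Unique-map-∈ {f = f} {xs = x ∷ xs} inj (p ∷ u) =
  Allₚ.map⁺ (All.tabulate λ y∈ e → All.lookup p y∈ (inj (here refl) (there y∈) e))
  ∷ Unique-map-∈ (λ x∈ y∈ → inj (there x∈) (there y∈)) u

reverseComplement-perm : ∀ {n w} → IsPerm n w → IsPerm n (reverseComplement n w)
reverseComplement-perm {n} {w} perm = IsPerm-resp-↭ (↭-sym (↭-reverse (map (complement n) w))) (isPerm
  (trans (length-map (complement n) w) (len perm))
  (Allₚ.map⁺ (All.map complement-< (bounded perm)))
  (Unique-map-∈ (λ x∈ y∈ → complement-injective (All.lookup (bounded perm) x∈) (All.lookup (bounded perm) y∈)) (distinct perm)))

reverseComplement-involutive : ∀ {n w} → All (_< n) w → reverseComplement n (reverseComplement n w) ≡ w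
reverseComplement-involutive {n} {w} bd = trans (cong reverse (reverse-map (complement n) (map (complement n) w)))
  (trans (reverse-involutive _) (trans (sym (map-∘ w)) (fixed bd)))
  where
  fixed : ∀ {w} → All (_< n) w → map (complement n ∘ complement n) w ≡ w
  fixed []       = refl
  fixed (p ∷ ps) = cong₂ _∷_ (complement-involutive p) (fixed ps)

opposite-distribution : ∀ box n k → distribution (opposite box) n k ≡ distribution box n k
opposite-distribution box n k = ≤-antisym
  (length-≤-by (λ w w′ → w ≡ rc w′) (Unique-filterᵇ (hits (opposite box)) (Unique-words n)) back (λ _ _ e e′ → trans e (sym e′)))
  (length-≤-by (λ w w′ → w′ ≡ rc w) (Unique-filterᵇ (hits box) (Unique-words n)) forth
    λ {w} {w′} w∈ w′∈ e e′ → trans (sym (reverseComplement-involutive (bounded (perm-of box w∈))))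
      (trans (cong rc (trans (sym e) e′)) (reverseComplement-involutive (bounded (perm-of box w′∈)))))
  where
  rc = reverseComplement n
  hits : Boxes → List ℕ → Bool
  hits box w = occurrences box w ≡ᵇ k
  perm-of : ∀ box {w} → w ∈ filterᵇ (hits box) (words n) → IsPerm n w
  perm-of box w∈ = ∈-words⁻ {n} (proj₁ (∈-filterᵇ⁻ (hits box) (words n) w∈))
  forth : ∀ {w} → w ∈ filterᵇ (hits box) (words n) → ∃ λ w′ → w′ ∈ filterᵇ (hits (opposite box)) (words n) × w′ ≡ rc w
  forth {w} w∈ =
    let perm = perm-of box w∈
        t = proj₂ (∈-filterᵇ⁻ (hits box) (words n) w∈)
    in rc w , ∈-filterᵇ⁺ (hits (opposite box)) (∈-words⁺ {n} (reverseComplement-perm perm))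
                (subst (λ o → T (o ≡ᵇ k)) (sym (opposite-occurrences {n} {box} perm)) t) , refl
  back : ∀ {w} → w ∈ filterᵇ (hits (opposite box)) (words n) → ∃ λ w′ → w′ ∈ filterᵇ (hits box) (words n) × w ≡ rc w′
  back {w} w∈ =
    let perm = perm-of (opposite box) w∈
        t = proj₂ (∈-filterᵇ⁻ (hits (opposite box)) (words n) w∈)
        rc-perm = reverseComplement-perm perm
        twice = reverseComplement-involutive (bounded perm)
    in rc w , ∈-filterᵇ⁺ (hits box) (∈-words⁺ {n} rc-perm)
                (subst (λ o → T (o ≡ᵇ k)) (trans (cong (occurrences (opposite box)) (sym twice)) (opposite-occurrences {n} {box} rc-perm)) t)
            , sym twice

-- Occurrences (a , b) where a is a fixed point splitting the permutation into a direct sum, and b is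
-- a letter of the upper summand singled out by u.
origin : Boxes → Boxes
origin u c r = not ((c ≡ᵇ 0) xor (r ≡ᵇ 0)) ∧ u c r

record Chosen (u : Boxes) (a : ℕ) (M : List ℕ) (b : ℕ) (N : List ℕ) : Set where
  constructor chosen
  field
    chosenM : All (λ y → T (u 1 (row a b y))) M
    chosenN : All (λ y → T (u 2 (row a b y))) N

-- Existence and uniqueness of the selected letter are all that the count requires; which letter it
-- is has no influence on the number of occurrences.
record Selects (u : Boxes) : Set where
  field
    free   : T (u 0 0)
    choose : ∀ {a x R} → Unique (x ∷ R) → All (a <_) (x ∷ R) →
      ∃ λ M → ∃₂ λ b N → x ∷ R ≡ M ++ b ∷ N × Chosen u a M b N
    only   : ∀ {a} M {b N} M′ {b′ N′} → Unique (M ++ b ∷ N) → All (a <_) (M ++ b ∷ N) →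
      Chosen u a M b N → Chosen u a M′ b′ N′ → M ++ b ∷ N ≡ M′ ++ b′ ∷ N′ → M ≡ M′

isolated : List ℕ → ℕ → List ℕ → Bool
isolated L a R = all (_<ᵇ a) L ∧ all (a <ᵇ_) R

module _ {u : Boxes} (sel : Selects u) where
  open Selects sel

  private
    origin-0⁻ : ∀ {a b y} → T (origin u 0 (row a b y)) → y < a
    origin-0⁻ {a} {b} {y} t with row a b y | rowView a b y
    ... | _ | below p = p
    origin-0⁺ : ∀ {a b y} → y < a → T (origin u 0 (row a b y))
    origin-0⁺ {a} {b} {y} y<a rewrite T⇒≡ (<⇒<ᵇ y<a) = free
    origin-suc⁻ : ∀ {a b y} c → T (origin u (suc c) (row a b y)) → a ≤ y × T (u (suc c) (row a b y))
    origin-suc⁻ {a} {b} {y} c t with row a b y | rowView a b y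
    ... | _ | between p _ = p , t
    ... | _ | above p _   = p , t
    origin-suc⁺ : ∀ {a b y} c → a ≤ y → T (u (suc c) (row a b y)) → T (origin u (suc c) (row a b y))
    origin-suc⁺ {a} {b} {y} c a≤y t with row a b y | rowView a b y
    ... | _ | below p     = contradiction p (≤⇒≯ a≤y)
    ... | _ | between _ _ = t
    ... | _ | above _ _   = t

  origin-mesh⁺ : ∀ {L a M b N} → All (_< a) L → All (a <_) (M ++ b ∷ N) → Chosen u a M b N → Mesh (origin u) L a M b N
  origin-mesh⁺ {L} {a} {M} {b} {N} L<a a<R (chosen cM cN) = mesh (All.lookup a<R (∈-insert M))
    (All.map (λ {y} → origin-0⁺ {a} {b} {y}) L<a)
    (All.zipWith (λ {y} (p , q) → origin-suc⁺ {a} {b} {y} 0 (<⇒≤ p) q) (Allₚ.++⁻ˡ M a<R , cM))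
    (All.zipWith (λ {y} (p , q) → origin-suc⁺ {a} {b} {y} 1 (<⇒≤ p) q) (All.tail (Allₚ.++⁻ʳ M a<R) , cN))

  origin-mesh⁻ : ∀ {L a M b N} → Unique (L ++ a ∷ M ++ b ∷ N) → Mesh (origin u) L a M b N →
    All (_< a) L × All (a <_) (M ++ b ∷ N) × Chosen u a M b N
  origin-mesh⁻ {L} {a} {M} {b} {N} uniq (mesh a<b p q r) =
    All.map (λ {y} → origin-0⁻ {a} {b} {y}) p ,
    Allₚ.++⁺ (All.tabulate (λ {y} y∈ → ≤∧≢⇒< (proj₁ (origin-suc⁻ {a} {b} {y} 0 (All.lookup q y∈))) (≢a (∈-++⁺ˡ y∈))))
             (a<b ∷ All.tabulate (λ {y} y∈ → ≤∧≢⇒< (proj₁ (origin-suc⁻ {a} {b} {y} 1 (All.lookup r y∈))) (≢a (∈-++⁺ʳ M (there y∈))))) ,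
    chosen (All.map (λ {y} t → proj₂ (origin-suc⁻ {a} {b} {y} 0 t)) q) (All.map (λ {y} t → proj₂ (origin-suc⁻ {a} {b} {y} 1 t)) r)
    where
    ≢a : ∀ {y} → y ∈ M ++ b ∷ N → a ≢ y
    ≢a y∈ e = cut-distinct L uniq (∈-++⁺ʳ L y∈) (sym e)

  -- Each splitting point `a` has exactly one selected letter above it and so starts exactly one
  -- occurrence. The right side does not mention `u`, which makes different selections comparable.
  -- The list after `a` is nonempty, as otherwise there is nothing to select.
  origin-starts : ∀ {L a x R} → Unique (L ++ a ∷ x ∷ R) → starts (origin u) L a (x ∷ R) ≡ ind (isolated L a (x ∷ R))
  origin-starts {L} {a} {x} {R} uniq with T? (isolated L a (x ∷ R))
  ... | no ¬iso = trans (cutSum-zero (x ∷ R) λ M b N eq → ind-false λ t → ¬iso (isolated⁺ M eq t)) (sym (ind-false ¬iso))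
    where
    isolated⁺ : ∀ M {b N} → x ∷ R ≡ M ++ b ∷ N → T (meshᵇ (origin u) L a M b N) → T (isolated L a (x ∷ R))
    isolated⁺ M {b} {N} eq t =
      let L<a , a<R , _ = origin-mesh⁻ {L} {a} {M} {b} {N} (subst (λ r → Unique (L ++ a ∷ r)) eq uniq) (mesh⁻ t)
      in Equivalence.from (T-∧ {all (_<ᵇ a) L}) (T-all⁺ (_<ᵇ a) (All.map <⇒<ᵇ L<a) ,
           T-all⁺ (a <ᵇ_) {x ∷ R} (subst (All (T ∘ (a <ᵇ_))) (sym eq) (All.map <⇒<ᵇ a<R)))
  ... | yes iso = begin
    starts (origin u) L a (x ∷ R)          ≡⟨ cong (starts (origin u) L a) eq ⟩
    starts (origin u) L a (M ++ b ∷ N)     ≡⟨ cutSum-single (λ M b N → ind (meshᵇ (origin u) L a M b N)) M sole ⟩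
    ind (meshᵇ (origin u) L a M b N)       ≡⟨ cong ind (T⇒≡ {meshᵇ (origin u) L a M b N} (mesh⁺ (origin-mesh⁺ L<a a<R′ cho))) ⟩
    1                                      ≡⟨ cong ind (T⇒≡ iso) ⟨
    ind (isolated L a (x ∷ R)) ∎
    where
    open ≡-Reasoning
    parts = Equivalence.to (T-∧ {all (_<ᵇ a) L}) iso
    L<a : All (_< a) L
    L<a = All.map (λ {y} → <ᵇ⇒< y a) (T-all⁻ (_<ᵇ a) (proj₁ parts))
    a<R : All (a <_) (x ∷ R)
    a<R = All.map (λ {y} → <ᵇ⇒< a y) (T-all⁻ (a <ᵇ_) (proj₂ parts))
    uniqR : Unique (x ∷ R)
    uniqR = Unique-++ʳ (a ∷ []) (Unique-++ʳ L uniq)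
    choice = choose uniqR a<R
    M = proj₁ choice
    b = proj₁ (proj₂ choice)
    N = proj₁ (proj₂ (proj₂ choice))
    eq : x ∷ R ≡ M ++ b ∷ N
    eq = proj₁ (proj₂ (proj₂ (proj₂ choice)))
    cho : Chosen u a M b N
    cho = proj₂ (proj₂ (proj₂ (proj₂ choice)))
    a<R′ = subst (All (a <_)) eq a<R
    sole : ∀ M′ {b′ N′} → M′ ++ b′ ∷ N′ ≡ M ++ b ∷ N → ind (meshᵇ (origin u) L a M′ b′ N′) ≢ 0 → M′ ≡ M
    sole M′ {b′} {N′} e ≢0 = sym (only M M′ (subst Unique eq uniqR) a<R′ cho
      (proj₂ (proj₂ (origin-mesh⁻ {L} {a} {M′} {b′} {N′}
        (subst (λ r → Unique (L ++ a ∷ r)) (trans eq (sym e)) uniq) (mesh⁻ (ind-true ≢0))))) (sym e))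

origin-distribution : ∀ {u v} → Selects u → Selects v → ∀ n k → distribution (origin u) n k ≡ distribution (origin v) n k
origin-distribution {u} {v} selu selv n k = cong length (filterᵇ-cong (words n) λ {w} w∈ →
  cong (_≡ᵇ k) (cutSum-cong w λ L a R eq → same (subst Unique eq (distinct (∈-words⁻ {n} w∈)))))
  where
  same : ∀ {L a R} → Unique (L ++ a ∷ R) → starts (origin u) L a R ≡ starts (origin v) L a R
  same {R = []}    _    = refl
  same {R = x ∷ R} uniq = trans (origin-starts selu uniq) (sym (origin-starts selv uniq))

selects-last : Selects (unmarked atEnd)
selects-last = record
  { free   = _
  ; choose = λ {a} {x} {R} uniq _ → let M , b , N , eq , N≡[] = Marked-exists atEnd x R uniq in
      M , b , N , eq , chosen (All.tabulate (λ _ → _)) (subst (All _) (sym N≡[]) [])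
  ; only   = only
  }
  where
  only : ∀ {a} M {b N} M′ {b′ N′} → Unique (M ++ b ∷ N) → All (a <_) (M ++ b ∷ N) →
      Chosen (unmarked atEnd) a M b N → Chosen (unmarked atEnd) a M′ b′ N′ → M ++ b ∷ N ≡ M′ ++ b′ ∷ N′ → M ≡ M′
  only M {N = []}    M′ {N′ = []}    _ _ _                  _                  eq = ∷ʳ-injectiveˡ M M′ eq
  only M {N = _ ∷ _} M′              _ _ (chosen _ (() ∷ _)) _
  only M {N = []}    M′ {N′ = _ ∷ _} _ _ _                  (chosen _ (() ∷ _))

selects-first : Selects (λ c r → not (c ≡ᵇ 1))
selects-first = record
  { free   = _
  ; choose = λ {a} {x} {R} _ _ → [] , x , R , refl , chosen [] (All.tabulate (λ _ → _))
  ; only   = only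
  }
  where
  only : ∀ {a} M {b N} M′ {b′ N′} → Unique (M ++ b ∷ N) → All (a <_) (M ++ b ∷ N) →
      Chosen (λ c r → not (c ≡ᵇ 1)) a M b N → Chosen (λ c r → not (c ≡ᵇ 1)) a M′ b′ N′ → M ++ b ∷ N ≡ M′ ++ b′ ∷ N′ → M ≡ M′
  only []      []      _ _ _                  _                  _ = refl
  only (_ ∷ _) M′      _ _ (chosen (() ∷ _) _) _
  only []      (_ ∷ _) _ _ _                  (chosen (() ∷ _) _)

-- Among letters above `a`, an empty row 1 means that none is smaller than `b`.
selects-least : Selects (λ c r → not (r ≡ᵇ 1))
selects-least = record
  { free   = _
  ; choose = choose
  ; only   = only
  }
  where
  u : Boxes
  u c r = not (r ≡ᵇ 1)
  at-least⁺ : ∀ {a b y} → b ≤ y → T (not (row a b y ≡ᵇ 1))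
  at-least⁺ {a} {b} {y} b≤y with row a b y | rowView a b y
  ... | _ | below _     = _
  ... | _ | between _ p = contradiction p (≤⇒≯ b≤y)
  ... | _ | above _ _   = _
  at-least⁻ : ∀ {a b y} → a < y → T (not (row a b y ≡ᵇ 1)) → b ≤ y
  at-least⁻ {a} {b} {y} a<y t with row a b y | rowView a b y
  ... | _ | below p   = contradiction p (<⇒≯ a<y)
  ... | _ | above _ p = p
  choose : ∀ {a x R} → Unique (x ∷ R) → All (a <_) (x ∷ R) → ∃ λ M → ∃₂ λ b N → x ∷ R ≡ M ++ b ∷ N × Chosen u a M b N
  choose {a} {x} {R} _ _ = let M , b , N , eq , p , q = least x R in
    M , b , N , eq , chosen (All.map (λ {y} → at-least⁺ {a} {b} {y}) p) (All.map (λ {y} → at-least⁺ {a} {b} {y}) q)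
    where
    least : ∀ x R → ∃ λ M → ∃₂ λ b N → x ∷ R ≡ M ++ b ∷ N × All (b ≤_) M × All (b ≤_) N
    least x []      = [] , x , [] , refl , [] , []
    least x (y ∷ R) with least y R
    ... | M , b , N , eq , p , q with ≤-total b x
    ... | inj₁ b≤x = x ∷ M , b , N , cong (x ∷_) eq , b≤x ∷ p , q
    ... | inj₂ x≤b = [] , x , y ∷ R , refl , [] ,
      subst (All (x ≤_)) (sym eq) (Allₚ.++⁺ (All.map (≤-trans x≤b) p) (x≤b ∷ All.map (≤-trans x≤b) q))
  lower-bound : ∀ {a} M {b N} → All (a <_) (M ++ b ∷ N) → Chosen u a M b N → All (b ≤_) (M ++ b ∷ N)
  lower-bound {a} M {b} a< (chosen p q) =
    Allₚ.++⁺ (All.zipWith (λ {y} (lt , t) → at-least⁻ {a} {b} {y} lt t) (Allₚ.++⁻ˡ M a< , p))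
      (≤-refl ∷ All.zipWith (λ {y} (lt , t) → at-least⁻ {a} {b} {y} lt t) (All.tail (Allₚ.++⁻ʳ M a<) , q))
  only : ∀ {a} M {b N} M′ {b′ N′} → Unique (M ++ b ∷ N) → All (a <_) (M ++ b ∷ N) →
    Chosen u a M b N → Chosen u a M′ b′ N′ → M ++ b ∷ N ≡ M′ ++ b′ ∷ N′ → M ≡ M′
  only {a} M {b} {N} M′ {b′} {N′} uniq a< c c′ eq = position (cut-split M M′ eq)
    where
    b≡b′ : b ≡ b′
    b≡b′ = ≤-antisym (All.lookup (lower-bound M a< c) (subst (b′ ∈_) (sym eq) (∈-insert M′)))
      (All.lookup (lower-bound M′ (subst (All (a <_)) eq a<) c′) (subst (b ∈_) eq (∈-insert M)))
    position : (b ∈ M′ × _) ⊎ _ → M ≡ M′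
    position (inj₁ (b∈ , _)) = contradiction b≡b′ (cut-distinct M′ (subst Unique eq uniq) (∈-++⁺ˡ b∈))
    position (inj₂ ([]     , e    , _)) = trans e (++-identityʳ M′)
    position (inj₂ (x ∷ L₂ , refl , e)) = ⊥-elim (cut-distinct (M′ ++ x ∷ L₂) uniq
      (∈-++⁺ˡ (subst (_∈ M′ ++ x ∷ L₂) (trans (sym (∷-injectiveˡ e)) (sym b≡b′)) (∈-insert M′))) refl)

-- Comparing shadings box by box

cells : List (ℕ × ℕ)
cells = (0 , 0) ∷ (0 , 1) ∷ (0 , 2) ∷ (1 , 0) ∷ (1 , 1) ∷ (1 , 2) ∷ (2 , 0) ∷ (2 , 1) ∷ (2 , 2) ∷ []

cell∈ : ∀ {c r} → c < 3 → r < 3 → (c , r) ∈ cells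
cell∈ {c} {r} c<3 r<3 = ∈-cartesianProduct⁺ (∈-upTo⁺ c<3) (∈-upTo⁺ r<3)

-- Only nine boxes matter, so for concrete shadings the comparison is settled by evaluation.
agreeᵇ : Boxes → Boxes → Bool
agreeᵇ box box′ = all (λ (c , r) → not (box c r xor box′ c r)) cells

agree-distribution : ∀ box box′ → T (agreeᵇ box box′) → ∀ n k → distribution box n k ≡ distribution box′ n k
agree-distribution box box′ t n k = cong length (filterᵇ-cong (words n) λ {w} _ →
  cong (_≡ᵇ k) (cutSum-cong w λ L a R _ → cutSum-cong R λ M b N _ → cong ind
    (cong ((a <ᵇ b) ∧_) (cong₂ _∧_ (column 0 (s≤s z≤n) a b L) (cong₂ _∧_ (column 1 (s≤s (s≤s z≤n)) a b M) (column 2 ≤-refl a b N))))))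
  where
  not-xor : ∀ {p q} → T (not (p xor q)) → p ≡ q
  not-xor {true}  {true}  _ = refl
  not-xor {false} {false} _ = refl
  agree : ∀ {c r} → c < 3 → r < 3 → box c r ≡ box′ c r
  agree c<3 r<3 = not-xor (All.lookup (T-all⁻ (λ (c , r) → not (box c r xor box′ c r)) {cells} t)
    (cell∈ c<3 r<3))
  column : ∀ c → c < 3 → ∀ a b W → all (box c ∘ row a b) W ≡ all (box′ c ∘ row a b) W
  column c c<3 a b = all-cong (λ y → agree c<3 (s≤s (row≤2 a b y)))

-- The twenty patterns

-- The equality is one of counts and not of shadings, since reverse-complement and a change of the
-- selected letter preserve only the distribution.
record Reducible (R : MeshR) : Set where
  constructor reduced
  field
    α β : Bool
    mk  : Marker
    s≡  : ∀ n k → s R n k ≡ distribution (allowed α β mk) n k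

reducible : ∀ R α β mk → T (agreeᵇ (boxes R) (allowed α β mk)) → Reducible R
reducible R α β mk t = reduced α β mk λ n k → trans (s≡distribution R n k) (agree-distribution (boxes R) (allowed α β mk) t n k)

reducible-opposite : ∀ R α β mk → T (agreeᵇ (boxes R) (opposite (allowed α β mk))) → Reducible R
reducible-opposite R α β mk t = reduced α β mk λ n k →
  trans (s≡distribution R n k) (trans (agree-distribution (boxes R) (opposite (allowed α β mk)) t n k) (opposite-distribution (allowed α β mk) n k))

-- `origin (unmarked atEnd)` is by definition the shading `allowed false false atEnd`, so selecting
-- the last letter leads back to the main family.
reducible-origin : ∀ R {u} → Selects u → T (agreeᵇ (boxes R) (origin u)) → Reducible R
reducible-origin R {u} sel t = reduced false false atEnd λ n k →
  trans (s≡distribution R n k) (trans (agree-distribution (boxes R) (origin u) t n k) (origin-distribution sel selects-last n k))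

reducible-origin-opposite : ∀ R {u} → Selects u → T (agreeᵇ (boxes R) (opposite (origin u))) → Reducible R
reducible-origin-opposite R {u} sel t = reduced false false atEnd λ n k →
  trans (s≡distribution R n k) (trans (agree-distribution (boxes R) (opposite (origin u)) t n k) (trans (opposite-distribution (origin u) n k) (origin-distribution sel selects-last n k)))

-- The eight choices of `α`, `β` and `mk`, together with their opposites, account for sixteen
-- patterns. The other four select the first or the least letter of the upper summand, or are
-- opposite to such a pattern.
patterns-reducible : All Reducible patterns
patterns-reducible =
    reducible _ false true atMax _
  ∷ reducible-opposite _ true false atEnd _
  ∷ reducible _ true false atEnd _
  ∷ reducible-opposite _ false true atMax _
  ∷ reducible _ true true atMax _
  ∷ reducible-opposite _ true true atEnd _
  ∷ reducible _ true true atEnd _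
  ∷ reducible-opposite _ true true atMax _
  ∷ reducible-origin-opposite _ selects-least _
  ∷ reducible-origin _ selects-first _
  ∷ reducible-origin-opposite _ selects-first _
  ∷ reducible-origin _ selects-least _
  ∷ reducible _ true false atMax _
  ∷ reducible-opposite _ false true atEnd _
  ∷ reducible _ false true atEnd _
  ∷ reducible-opposite _ true false atMax _
  ∷ reducible-opposite _ false false atEnd _
  ∷ reducible _ false false atMax _
  ∷ reducible _ false false atEnd _
  ∷ reducible-opposite _ false false atMax _
  ∷ []

-- Generating functions

Σℤ : ℕ → (ℕ → ℤ) → ℤ
Σℤ n f = sumℤ (map f (upTo n))

Σℤ-suc : ∀ n f → Σℤ (suc n) f ≡ f 0 ℤ.+ Σℤ n (f ∘ suc)
Σℤ-suc n f = cong (λ t → f 0 ℤ.+ sumℤ t) (trans (map-applyUpTo suc f n) (sym (map-applyUpTo id (f ∘ suc) n)))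

Σℤ-cong : ∀ n {f g} → (∀ i → i < n → f i ≡ g i) → Σℤ n f ≡ Σℤ n g
Σℤ-cong zero    _  = refl
Σℤ-cong (suc n) {f} {g} eq = trans (Σℤ-suc n f) (trans
  (cong₂ ℤ._+_ (eq 0 (s≤s z≤n)) (Σℤ-cong n (λ i i<n → eq (suc i) (s≤s i<n)))) (sym (Σℤ-suc n g)))

Σℤ-last : ∀ n f → Σℤ (suc n) f ≡ Σℤ n f ℤ.+ f n
Σℤ-last zero    f = ℤₚ.+-comm (f 0) (ι 0)
Σℤ-last (suc n) f = begin
  Σℤ (suc (suc n)) f                        ≡⟨ Σℤ-suc (suc n) f ⟩
  f 0 ℤ.+ Σℤ (suc n) (f ∘ suc)              ≡⟨ cong (λ t → f 0 ℤ.+ t) (Σℤ-last n (f ∘ suc)) ⟩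
  f 0 ℤ.+ (Σℤ n (f ∘ suc) ℤ.+ f (suc n))    ≡⟨ ℤₚ.+-assoc (f 0) _ _ ⟨
  f 0 ℤ.+ Σℤ n (f ∘ suc) ℤ.+ f (suc n)      ≡⟨ cong (λ t → t ℤ.+ f (suc n)) (Σℤ-suc n f) ⟨
  Σℤ (suc n) f ℤ.+ f (suc n)                ∎
  where open ≡-Reasoning

Σℤ-zero : ∀ n {f} → (∀ i → i < n → f i ≡ ι 0) → Σℤ n f ≡ ι 0
Σℤ-zero zero    _ = refl
Σℤ-zero (suc n) {f} z = trans (Σℤ-suc n f)
  (cong₂ ℤ._+_ (z 0 (s≤s z≤n)) (Σℤ-zero n (λ i i<n → z (suc i) (s≤s i<n))))

Σℤ-- : ∀ n f g → Σℤ n (λ i → f i ℤ.- g i) ≡ Σℤ n f ℤ.- Σℤ n g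
Σℤ-- zero    f g = refl
Σℤ-- (suc n) f g = begin
  Σℤ (suc n) (λ i → f i ℤ.- g i)                      ≡⟨ Σℤ-last n _ ⟩
  Σℤ n (λ i → f i ℤ.- g i) ℤ.+ (f n ℤ.- g n)          ≡⟨ cong (λ t → t ℤ.+ (f n ℤ.- g n)) (Σℤ-- n f g) ⟩
  (Σℤ n f ℤ.- Σℤ n g) ℤ.+ (f n ℤ.- g n)               ≡⟨ regroup (Σℤ n f) (Σℤ n g) (f n) (g n) ⟩
  (Σℤ n f ℤ.+ f n) ℤ.- (Σℤ n g ℤ.+ g n)               ≡⟨ cong₂ ℤ._-_ (Σℤ-last n f) (Σℤ-last n g) ⟨
  Σℤ (suc n) f ℤ.- Σℤ (suc n) g                       ∎
  where
  open ≡-Reasoning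
  regroup : ∀ a b c d → (a ℤ.- b) ℤ.+ (c ℤ.- d) ≡ (a ℤ.+ c) ℤ.- (b ℤ.+ d)
  regroup = solve-∀

Σℤ-pos : ∀ n g → ι sum (map g (upTo n)) ≡ Σℤ n (λ i → ι g i)
Σℤ-pos n g = go (upTo n)
  where
  go : ∀ xs → ι sum (map g xs) ≡ sumℤ (map (λ i → ι g i) xs)
  go []       = refl
  go (x ∷ xs) = trans (ℤₚ.pos-+ (g x) _) (cong (λ t → ι g x ℤ.+ t) (go xs))

-- The coefficients of (1 - q) m!.
diffFact : ℕ → ℕ → ℤ
diffFact m 0             = ι (m !)
diffFact m 1             = ℤ.- (ι (m !))
diffFact m (suc (suc _)) = ι 0

X⊛Fact : ∀ m → (X ⊛ Fact) (suc m) ≡ ι (m !)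
X⊛Fact m = begin
  Σℤ (2 + m) f                                 ≡⟨ Σℤ-suc (suc m) f ⟩
  ι 0 ℤ.* ι (suc m !) ℤ.+ Σℤ (suc m) (f ∘ suc)  ≡⟨ cong₂ ℤ._+_ (ℤₚ.*-zeroˡ (ι (suc m !))) (Σℤ-suc m (f ∘ suc)) ⟩
  ι 0 ℤ.+ (ι 1 ℤ.* ι (m !) ℤ.+ Σℤ m (f ∘ suc ∘ suc))
    ≡⟨ cong (λ t → ι 0 ℤ.+ (ι 1 ℤ.* ι (m !) ℤ.+ t)) (Σℤ-zero m (λ i _ → ℤₚ.*-zeroˡ (Fact (m ∸ suc i)))) ⟩
  ι 0 ℤ.+ (ι 1 ℤ.* ι (m !) ℤ.+ ι 0)            ≡⟨ simplify (ι (m !)) ⟩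
  ι (m !)                                      ∎
  where
  open ≡-Reasoning
  f : ℕ → ℤ
  f i = X i ℤ.* Fact (suc m ∸ i)
  simplify : ∀ x → ι 0 ℤ.+ (ι 1 ℤ.* x ℤ.+ ι 0) ≡ x
  simplify = solve-∀

onePlusX⊛Fact : ∀ m → (onePlusX ⊛ Fact) (suc m) ≡ ι (suc m !) ℤ.+ ι (m !)
onePlusX⊛Fact m = begin
  Σℤ (2 + m) f                                 ≡⟨ Σℤ-suc (suc m) f ⟩
  ι 1 ℤ.* ι (suc m !) ℤ.+ Σℤ (suc m) (f ∘ suc)  ≡⟨ cong (λ t → ι 1 ℤ.* ι (suc m !) ℤ.+ t) (Σℤ-suc m (f ∘ suc)) ⟩
  ι 1 ℤ.* ι (suc m !) ℤ.+ (ι 1 ℤ.* ι (m !) ℤ.+ Σℤ m (f ∘ suc ∘ suc))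
    ≡⟨ cong (λ t → ι 1 ℤ.* ι (suc m !) ℤ.+ (ι 1 ℤ.* ι (m !) ℤ.+ t)) (Σℤ-zero m (λ i _ → ℤₚ.*-zeroˡ (Fact (m ∸ suc i)))) ⟩
  ι 1 ℤ.* ι (suc m !) ℤ.+ (ι 1 ℤ.* ι (m !) ℤ.+ ι 0) ≡⟨ simplify (ι (suc m !)) (ι (m !)) ⟩
  ι (suc m !) ℤ.+ ι (m !)                      ∎
  where
  open ≡-Reasoning
  f : ℕ → ℤ
  f i = onePlusX i ℤ.* Fact (suc m ∸ i)
  simplify : ∀ x y → ι 1 ℤ.* x ℤ.+ (ι 1 ℤ.* y ℤ.+ ι 0) ≡ x ℤ.+ y
  simplify = solve-∀

-- The hypothesis on v says that v is the polynomial v₀ + v₁ q.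
convolve-left : ∀ (v u : ℕ → ℤ) k → (∀ j → v (suc (suc j)) ≡ ι 0) →
  Σℤ (2 + k) (λ j → v j ℤ.* u (suc k ∸ j)) ≡ v 0 ℤ.* u (suc k) ℤ.+ v 1 ℤ.* u k
convolve-left v u k v≡0 = begin
  Σℤ (2 + k) f                                 ≡⟨ Σℤ-suc (suc k) f ⟩
  f 0 ℤ.+ Σℤ (suc k) (f ∘ suc)                 ≡⟨ cong (λ t → f 0 ℤ.+ t) (Σℤ-suc k (f ∘ suc)) ⟩
  f 0 ℤ.+ (f 1 ℤ.+ Σℤ k (f ∘ suc ∘ suc))       ≡⟨ cong (λ t → f 0 ℤ.+ (f 1 ℤ.+ t)) (Σℤ-zero k late) ⟩
  f 0 ℤ.+ (f 1 ℤ.+ ι 0)                        ≡⟨ cong (λ t → f 0 ℤ.+ t) (ℤₚ.+-identityʳ (f 1)) ⟩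
  v 0 ℤ.* u (suc k) ℤ.+ v 1 ℤ.* u k            ∎
  where
  open ≡-Reasoning
  f : ℕ → ℤ
  f j = v j ℤ.* u (suc k ∸ j)
  late : ∀ j → j < k → f (2 + j) ≡ ι 0
  late j _ = trans (cong (ℤ._* u (k ∸ suc j)) (v≡0 j)) (ℤₚ.*-zeroˡ (u (k ∸ suc j)))

convolve-right : ∀ (u v : ℕ → ℤ) k → (∀ j → v (suc (suc j)) ≡ ι 0) →
  Σℤ (2 + k) (λ j → u j ℤ.* v (suc k ∸ j)) ≡ u k ℤ.* v 1 ℤ.+ u (suc k) ℤ.* v 0
convolve-right u v k v≡0 = begin
  Σℤ (2 + k) f                       ≡⟨ Σℤ-last (suc k) f ⟩
  Σℤ (suc k) f ℤ.+ f (suc k)         ≡⟨ cong (λ t → t ℤ.+ f (suc k)) (Σℤ-last k f) ⟩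
  Σℤ k f ℤ.+ f k ℤ.+ f (suc k)       ≡⟨ cong (λ t → t ℤ.+ f k ℤ.+ f (suc k)) (Σℤ-zero k early) ⟩
  ι 0 ℤ.+ f k ℤ.+ f (suc k)
    ≡⟨ cong₂ (λ p q → p ℤ.+ q) (trans (ℤₚ.+-identityˡ (f k)) (cong (λ t → u k ℤ.* v t) (m+n∸n≡m 1 k)))
             (cong (λ t → u (suc k) ℤ.* v t) (n∸n≡0 k)) ⟩
  u k ℤ.* v 1 ℤ.+ u (suc k) ℤ.* v 0  ∎
  where
  open ≡-Reasoning
  f : ℕ → ℤ
  f j = u j ℤ.* v (suc k ∸ j)
  early : ∀ j → j < k → f j ≡ ι 0
  early j j<k = begin
    u j ℤ.* v (suc k ∸ j)              ≡⟨ cong (λ t → u j ℤ.* v t) (trans (+-∸-assoc 1 (<⇒≤ j<k)) (cong suc (+-∸-assoc 1 j<k))) ⟩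
    u j ℤ.* v (2 + (k ∸ suc j))        ≡⟨ cong (u j ℤ.*_) (v≡0 (k ∸ suc j)) ⟩
    u j ℤ.* ι 0                        ≡⟨ ℤₚ.*-zeroʳ (u j) ⟩
    ι 0                                ∎

-- The row `v` is the polynomial 1 - q, the coefficient of x both in x(1 - q) and in 1 + x(1 - q).
linear-row : ∀ (v : ℕ → ℤ) → v 0 ≡ ι 1 → v 1 ≡ ℤ.- (ι 1) → (∀ j → v (suc (suc j)) ≡ ι 0) → ∀ m k →
  Σℤ (suc k) (λ j → v j ℤ.* Fact₂ m (k ∸ j)) ≡ diffFact m k
linear-row v v₀ v₁ v₂ m zero rewrite v₀ = simplify (ι (m !))
  where
  simplify : ∀ x → ι 1 ℤ.* x ℤ.+ ι 0 ≡ x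
  simplify = solve-∀
linear-row v v₀ v₁ v₂ m (suc k) = trans (convolve-left v (Fact₂ m) k v₂)
  (trans (cong₂ (λ p q → p ℤ.* ι 0 ℤ.+ q ℤ.* Fact₂ m k) v₀ v₁) (rest k))
  where
  rest : ∀ k → ι 1 ℤ.* ι 0 ℤ.+ ℤ.- (ι 1) ℤ.* Fact₂ m k ≡ diffFact m (suc k)
  rest zero    = trans (ℤₚ.+-identityˡ _) (ℤₚ.-1*i≡-i (ι (m !)))
  rest (suc k) = refl

zero-row : ∀ (v u : ℕ → ℤ) → (∀ j → v j ≡ ι 0) → ∀ k → Σℤ (suc k) (λ j → v j ℤ.* u (k ∸ j)) ≡ ι 0
zero-row v u v≡0 k = Σℤ-zero (suc k) λ j _ → trans (cong (ℤ._* u (k ∸ j)) (v≡0 j)) (ℤₚ.*-zeroˡ (u (k ∸ j)))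

X1q⊛₂Fact₂ : ∀ m k → (X1q ⊛₂ Fact₂) (suc m) k ≡ diffFact m k
X1q⊛₂Fact₂ m k = begin
  Σℤ (2 + m) f                                   ≡⟨ Σℤ-suc (suc m) f ⟩
  f 0 ℤ.+ Σℤ (suc m) (f ∘ suc)                   ≡⟨ cong₂ ℤ._+_ (zero-row (X1q 0) (Fact₂ (suc m)) (λ _ → refl) k) (Σℤ-suc m (f ∘ suc)) ⟩
  ι 0 ℤ.+ (f 1 ℤ.+ Σℤ m (f ∘ suc ∘ suc))
    ≡⟨ cong₂ (λ p q → ι 0 ℤ.+ (p ℤ.+ q)) (linear-row (X1q 1) refl refl (λ _ → refl) m k)
         (Σℤ-zero m λ i _ → zero-row (X1q (2 + i)) (Fact₂ (m ∸ suc i)) (λ _ → refl) k) ⟩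
  ι 0 ℤ.+ (diffFact m k ℤ.+ ι 0)                 ≡⟨ trans (ℤₚ.+-identityˡ _) (ℤₚ.+-identityʳ _) ⟩
  diffFact m k                                   ∎
  where
  open ≡-Reasoning
  f : ℕ → ℤ
  f i = Σℤ (suc k) (λ j → X1q i j ℤ.* Fact₂ (suc m ∸ i) (k ∸ j))

unit-row : ∀ (v u : ℕ → ℤ) → v 0 ≡ ι 1 → (∀ j → v (suc j) ≡ ι 0) → ∀ k → Σℤ (suc k) (λ j → v j ℤ.* u (k ∸ j)) ≡ u k
unit-row v u v₀ v₁ k = trans (Σℤ-suc k (λ j → v j ℤ.* u (k ∸ j))) (trans
  (cong₂ ℤ._+_ (trans (cong (ℤ._* u k) v₀) (ℤₚ.*-identityˡ (u k)))
    (Σℤ-zero k λ j _ → trans (cong (ℤ._* u (k ∸ suc j)) (v₁ j)) (ℤₚ.*-zeroˡ (u (k ∸ suc j)))))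
  (ℤₚ.+-identityʳ (u k)))

onePlusX1q⊛₂Fact₂ : ∀ m k → (onePlusX1q ⊛₂ Fact₂) (suc m) k ≡ Fact₂ (suc m) k ℤ.+ diffFact m k
onePlusX1q⊛₂Fact₂ m k = begin
  Σℤ (2 + m) f                                   ≡⟨ Σℤ-suc (suc m) f ⟩
  f 0 ℤ.+ Σℤ (suc m) (f ∘ suc)
    ≡⟨ cong₂ ℤ._+_ (unit-row (onePlusX1q 0) (Fact₂ (suc m)) refl (λ _ → refl) k) (Σℤ-suc m (f ∘ suc)) ⟩
  Fact₂ (suc m) k ℤ.+ (f 1 ℤ.+ Σℤ m (f ∘ suc ∘ suc))
    ≡⟨ cong₂ (λ p q → Fact₂ (suc m) k ℤ.+ (p ℤ.+ q)) (linear-row (onePlusX1q 1) refl refl (λ _ → refl) m k)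
         (Σℤ-zero m λ i _ → zero-row (onePlusX1q (2 + i)) (Fact₂ (m ∸ suc i)) (λ _ → refl) k) ⟩
  Fact₂ (suc m) k ℤ.+ (diffFact m k ℤ.+ ι 0)     ≡⟨ cong (λ t → Fact₂ (suc m) k ℤ.+ t) (ℤₚ.+-identityʳ _) ⟩
  Fact₂ (suc m) k ℤ.+ diffFact m k               ∎
  where
  open ≡-Reasoning
  f : ℕ → ℤ
  f i = Σℤ (suc k) (λ j → onePlusX1q i j ℤ.* Fact₂ (suc m ∸ i) (k ∸ j))

-- From the recurrence to the functional equations

-- a n k stands for the number of permutations of [n] with more than k occurrences.
record Recurrent (c : ℕ → ℕ → ℕ) : Set where
  field
    a       : ℕ → ℕ → ℕ
    c00     : c 0 0 ≡ 1
    c0s     : ∀ k → c 0 (suc k) ≡ 0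
    c+a-0   : ∀ n → c n 0 + a n 0 ≡ n !
    c+a-suc : ∀ n k → c n (suc k) + a n (suc k) ≡ a n k
    a-suc   : ∀ n k → a (suc n) k ≡ sum (map (λ j → c (suc j) k * (n ∸ suc j) !) (upTo n))

-- Strong induction on the length: `a` at `suc n` involves `c` only at the lengths from 1 to `n`,
-- and the two sum rules recover `c` at `suc n` from it.
recurrent-unique : ∀ {c c′} → Recurrent c → Recurrent c′ → ∀ n k → c n k ≡ c′ n k
recurrent-unique {c} {c′} r r′ = <-rec (λ n → ∀ k → c n k ≡ c′ n k) step
  where
  module P = Recurrent r
  module Q = Recurrent r′
  step : ∀ n → (∀ {m} → m < n → ∀ k → c m k ≡ c′ m k) → ∀ k → c n k ≡ c′ n k
  step zero    _  zero    = trans P.c00 (sym Q.c00)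
  step zero    _  (suc k) = trans (P.c0s k) (sym (Q.c0s k))
  step (suc n) ih k = c-equal k
    where
    a-equal : ∀ k → P.a (suc n) k ≡ Q.a (suc n) k
    a-equal k = trans (P.a-suc n k) (trans (cong sum (map-cong-local (All.tabulate λ {j} j∈ →
      cong (_* (n ∸ suc j) !) (ih (s≤s (∈-upTo⁻ j∈)) k)))) (sym (Q.a-suc n k)))
    c-equal : ∀ k → c (suc n) k ≡ c′ (suc n) k
    c-equal zero    = +-cancelʳ-≡ (Q.a (suc n) 0) _ _
      (trans (cong (λ t → c (suc n) 0 + t) (sym (a-equal 0))) (trans (P.c+a-0 (suc n)) (sym (Q.c+a-0 (suc n)))))
    c-equal (suc k) = +-cancelʳ-≡ (Q.a (suc n) (suc k)) _ _
      (trans (cong (λ t → c (suc n) (suc k) + t) (sym (a-equal (suc k))))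
        (trans (P.c+a-suc (suc n) k) (trans (a-equal k) (sym (Q.c+a-suc (suc n) k)))))

module _ {c : ℕ → ℕ → ℕ} (r : Recurrent c) where
  open Recurrent r

  private
    suc-∸ : ∀ {i m} → i < m → m ∸ i ≡ suc (m ∸ suc i)
    suc-∸ = +-∸-assoc 1

    Σ-a : ∀ m k → Σℤ m (λ i → ι (c (suc i) k * (m ∸ suc i) !)) ≡ ι a (suc m) k
    Σ-a m k = trans (sym (Σℤ-pos m _)) (cong ι_ (sym (a-suc m k)))

  -- In the coefficient of index `suc m` the inner terms of the convolution add up to `a (suc m) 0`
  -- by the recurrence. The last term completes this to `suc m !`, and the first, which belongs to
  -- the empty permutation, supplies the extra `m !` on the right.
  univariate : ∀ n → ((λ n → ι c n 0) ⊛ (oneSer ⊕ (X ⊛ Fact))) n ≡ (onePlusX ⊛ Fact) n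
  univariate zero    = cong (λ t → ι t ℤ.* ι 1 ℤ.+ ι 0) c00
  univariate (suc m) = begin
    Σℤ (2 + m) f                                     ≡⟨ Σℤ-suc (suc m) f ⟩
    f 0 ℤ.+ Σℤ (suc m) (f ∘ suc)                     ≡⟨ cong (λ t → f 0 ℤ.+ t) (Σℤ-last m (f ∘ suc)) ⟩
    f 0 ℤ.+ (Σℤ m (f ∘ suc) ℤ.+ f (suc m))
      ≡⟨ cong₂ ℤ._+_ first-term (cong₂ ℤ._+_ (trans (Σℤ-cong m middle) (Σ-a m 0)) last-term) ⟩
    ι (m !) ℤ.+ (ι a (suc m) 0 ℤ.+ ι c (suc m) 0)    ≡⟨ rotate (ι (m !)) (ι a (suc m) 0) (ι c (suc m) 0) ⟩
    ι c (suc m) 0 ℤ.+ ι a (suc m) 0 ℤ.+ ι (m !)      ≡⟨ cong (λ t → ι t ℤ.+ ι (m !)) (c+a-0 (suc m)) ⟩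
    ι (suc m !) ℤ.+ ι (m !)                          ≡⟨ onePlusX⊛Fact m ⟨
    (onePlusX ⊛ Fact) (suc m)                        ∎
    where
    open ≡-Reasoning
    G : Ser
    G = oneSer ⊕ (X ⊛ Fact)
    f : ℕ → ℤ
    f i = ι c i 0 ℤ.* G (suc m ∸ i)
    G-suc : ∀ l → G (suc l) ≡ ι (l !)
    G-suc l = trans (ℤₚ.+-identityˡ _) (X⊛Fact l)
    first-term : f 0 ≡ ι (m !)
    first-term = trans (cong₂ (λ t u → ι t ℤ.* u) c00 (G-suc m)) (ℤₚ.*-identityˡ _)
    middle : ∀ i → i < m → f (suc i) ≡ ι (c (suc i) 0 * (m ∸ suc i) !)
    middle i i<m = trans (cong (ι c (suc i) 0 ℤ.*_) (trans (cong G (suc-∸ i<m)) (G-suc (m ∸ suc i)))) (sym (ℤₚ.pos-* (c (suc i) 0) _))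
    last-term : f (suc m) ≡ ι c (suc m) 0
    last-term = trans (cong (λ t → ι c (suc m) 0 ℤ.* G t) (n∸n≡0 m)) (ℤₚ.*-identityʳ _)
    rotate : ∀ x y z → x ℤ.+ (y ℤ.+ z) ≡ z ℤ.+ y ℤ.+ x
    rotate = solve-∀

  private
    G : Ser₂
    G = one₂ ⊕₂ (X1q ⊛₂ Fact₂)

    G-suc : ∀ m k → G (suc m) k ≡ diffFact m k
    G-suc m k = trans (ℤₚ.+-identityˡ _) (X1q⊛₂Fact₂ m k)

    G-zero : ∀ k → G 0 (suc k) ≡ ι 0
    G-zero k = trans (ℤₚ.+-identityˡ _) (trans (ℤₚ.+-identityʳ _) (zero-row (X1q 0) (Fact₂ 0) (λ _ → refl) (suc k)))

    row-last : ∀ n k → Σℤ (suc k) (λ j → ι c n j ℤ.* G 0 (k ∸ j)) ≡ ι c n k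
    row-last n zero    = trans (ℤₚ.+-identityʳ _) (ℤₚ.*-identityʳ (ι c n 0))
    row-last n (suc k) = trans (convolve-right (λ j → ι c n j) (G 0) k (λ j → G-zero (suc j)))
      (trans (cong (λ t → ι c n k ℤ.* t ℤ.+ ι c n (suc k) ℤ.* ι 1) (G-zero 0)) (simplify (ι c n k) (ι c n (suc k))))
      where
      simplify : ∀ x y → x ℤ.* ι 0 ℤ.+ y ℤ.* ι 1 ≡ y
      simplify = solve-∀

    -- The coefficients of (1 - q) times the series with coefficients `u k`.
    step : (ℕ → ℕ) → ℕ → ℤ
    step u 0       = ι u 0
    step u (suc k) = ι u (suc k) ℤ.- ι u k

    row-before : ∀ i m k → Σℤ (suc k) (λ j → ι c i j ℤ.* G (suc m) (k ∸ j)) ≡ step (λ k → c i k * m !) k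
    row-before i m zero    = trans (ℤₚ.+-identityʳ _) (trans (cong (ι c i 0 ℤ.*_) (G-suc m 0)) (sym (ℤₚ.pos-* (c i 0) (m !))))
    row-before i m (suc k) = trans (convolve-right (λ j → ι c i j) (G (suc m)) k (λ j → G-suc m (suc (suc j))))
      (trans (cong₂ (λ p q → ι c i k ℤ.* p ℤ.+ ι c i (suc k) ℤ.* q) (G-suc m 1) (G-suc m 0))
        (trans (rotate (ι c i k) (ι c i (suc k)) (ι (m !)))
          (sym (cong₂ ℤ._-_ (ℤₚ.pos-* (c i (suc k)) (m !)) (ℤₚ.pos-* (c i k) (m !))))))
      where
      rotate : ∀ x y z → x ℤ.* (ℤ.- z) ℤ.+ y ℤ.* z ≡ y ℤ.* z ℤ.- x ℤ.* z
      rotate = solve-∀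

    row-first : ∀ m k → step (λ k → c 0 k * m !) k ≡ diffFact m k
    row-first m 0             = trans (cong (λ t → ι (t * m !)) c00) (cong ι_ (*-identityˡ (m !)))
    row-first m 1             = trans (cong₂ (λ t u → ι (t * m !) ℤ.- ι (u * m !)) (c0s 0) c00)
      (trans (ℤₚ.+-identityˡ _) (cong (λ t → ℤ.- (ι t)) (*-identityˡ (m !))))
    row-first m (suc (suc k)) = cong₂ (λ t u → ι (t * m !) ℤ.- ι (u * m !)) (c0s (suc k)) (c0s k)

    rows-middle : ∀ m k → Σℤ m (λ i → step (λ k → c (suc i) k * (m ∸ suc i) !) k) ≡ step (a (suc m)) k
    rows-middle m zero    = Σ-a m 0
    rows-middle m (suc k) = trans (Σℤ-- m _ _) (cong₂ ℤ._-_ (Σ-a m (suc k)) (Σ-a m k))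

    -- Summation by parts in q: the sum rules of `Recurrent` say that the differences of `a` cancel
    -- `c` except at q⁰, where `n !` remains.
    step-a+c : ∀ n k → step (a n) k ℤ.+ ι c n k ≡ Fact₂ n k
    step-a+c n zero    = cong ι_ (trans (+-comm (a n 0) (c n 0)) (c+a-0 n))
    step-a+c n (suc k) = trans (rotate (ι a n (suc k)) (ι a n k) (ι c n (suc k)))
      (trans (cong (λ t → ι t ℤ.- ι a n k) (c+a-suc n k)) (ℤₚ.+-inverseʳ (ι a n k)))
      where
      rotate : ∀ x y z → (x ℤ.- y) ℤ.+ z ≡ (z ℤ.+ x) ℤ.- y
      rotate = solve-∀

  -- The same division into first, inner and last terms as in `univariate`, now with a polynomial in
  -- q for each power of x: the factor 1 - q turns the inner terms into `step (a (suc m))`.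
  bivariate : ∀ n k → ((λ n k → ι c n k) ⊛₂ (one₂ ⊕₂ (X1q ⊛₂ Fact₂))) n k ≡ (onePlusX1q ⊛₂ Fact₂) n k
  bivariate zero k = trans (ℤₚ.+-identityʳ _) (trans (row-last 0 k) (trans (c0≡ k)
    (sym (trans (ℤₚ.+-identityʳ _) (unit-row (onePlusX1q 0) (Fact₂ 0) refl (λ _ → refl) k)))))
    where
    c0≡ : ∀ k → ι c 0 k ≡ Fact₂ 0 k
    c0≡ zero    = cong ι_ c00
    c0≡ (suc k) = cong ι_ (c0s k)
  bivariate (suc m) k = begin
    Σℤ (2 + m) f                                                  ≡⟨ Σℤ-suc (suc m) f ⟩
    f 0 ℤ.+ Σℤ (suc m) (f ∘ suc)                                  ≡⟨ cong (λ t → f 0 ℤ.+ t) (Σℤ-last m (f ∘ suc)) ⟩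
    f 0 ℤ.+ (Σℤ m (f ∘ suc) ℤ.+ f (suc m))
      ≡⟨ cong₂ ℤ._+_ (trans (row-before 0 m k) (row-first m k))
           (cong₂ ℤ._+_ (trans (Σℤ-cong m middle) (rows-middle m k))
             (trans (cong (λ t → Σℤ (suc k) (λ j → ι c (suc m) j ℤ.* G t (k ∸ j))) (n∸n≡0 m)) (row-last (suc m) k))) ⟩
    diffFact m k ℤ.+ (step (a (suc m)) k ℤ.+ ι c (suc m) k)        ≡⟨ cong (λ t → diffFact m k ℤ.+ t) (step-a+c (suc m) k) ⟩
    diffFact m k ℤ.+ Fact₂ (suc m) k                              ≡⟨ ℤₚ.+-comm (diffFact m k) _ ⟩
    Fact₂ (suc m) k ℤ.+ diffFact m k                              ≡⟨ onePlusX1q⊛₂Fact₂ m k ⟨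
    (onePlusX1q ⊛₂ Fact₂) (suc m) k                               ∎
    where
    open ≡-Reasoning
    f : ℕ → ℤ
    f i = Σℤ (suc k) (λ j → ι c i j ℤ.* G (suc m ∸ i) (k ∸ j))
    middle : ∀ i → i < m → f (suc i) ≡ step (λ k → c (suc i) k * (m ∸ suc i) !) k
    middle i i<m = trans (cong (λ t → Σℤ (suc k) (λ j → ι c (suc i) j ℤ.* G t (k ∸ j))) (suc-∸ i<m)) (row-before (suc i) (m ∸ suc i) k)

allowed-recurrent : ∀ α β mk → Recurrent (distribution (allowed α β mk))
allowed-recurrent α β mk = record
  { a       = exceedance α β mk
  ; c00     = refl
  ; c0s     = λ _ → refl
  ; c+a-0   = distribution-zero α β mk
  ; c+a-suc = distribution-suc α β mk
  ; a-suc   = exceedance-recurrence α β mk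
  }

recurrent-resp : ∀ {c c′} → (∀ n k → c n k ≡ c′ n k) → Recurrent c′ → Recurrent c
recurrent-resp {c} {c′} eq r = record
  { a       = a
  ; c00     = trans (eq 0 0) c00
  ; c0s     = λ k → trans (eq 0 (suc k)) (c0s k)
  ; c+a-0   = λ n → trans (cong (_+ a n 0) (eq n 0)) (c+a-0 n)
  ; c+a-suc = λ n k → trans (cong (_+ a n (suc k)) (eq n (suc k))) (c+a-suc n k)
  ; a-suc   = λ n k → trans (a-suc n k) (cong sum (map-cong (λ j → cong (_* (n ∸ suc j) !) (sym (eq (suc j) k))) (upTo n)))
  }
  where open Recurrent r

reducible-recurrent : ∀ {R} → Reducible R → Recurrent (s R)
reducible-recurrent (reduced α β mk s≡) = recurrent-resp s≡ (allowed-recurrent α β mk)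

pattern-recurrent : ∀ {R} → R ∈ patterns → Recurrent (s R)
pattern-recurrent R∈ = reducible-recurrent (All.lookup patterns-reducible R∈)

theorem3p16 : (∀ R₁ R₂ → R₁ ∈ patterns → R₂ ∈ patterns → Equidistributed R₁ R₂)
    × (∀ R → R ∈ patterns → AFormula R × FqFormula R)
theorem3p16 = (λ R₁ R₂ R₁∈ R₂∈ → recurrent-unique (pattern-recurrent R₁∈) (pattern-recurrent R₂∈))
            , (λ R R∈ → univariate (pattern-recurrent R∈) , bivariate (pattern-recurrent R∈))
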